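{- For every prime power $q\ge 4$ there exists a set $\mathcal X$ of $q^2-q+1$ points of $\mathrm{AG}(6,q)$ that is both a $5$-general set and a $(6,4)$-set, and that is transitive: the group of projectivities of $\mathrm{PG}(6,q)$ stabilizing $\mathcal X$ and the hyperplane at infinity acts transitively on the points of $\mathcal X$.
   Context: For integers $r,s$, an $(r,s)$-set of $\mathrm{PG}(n,q)$ is a set $\mathcal X$ of points such that: (i) every $s$-dimensional projective subspace contains at most $r$ points of $\mathcal X$; (ii) $\mathcal X$ spans $\mathrm{PG}(n,q)$; (iii) some $(s+1)$-dimensional projective subspace contains $r+2$ points of $\mathcal X$. A $k$-general set is a $(k-1,k-2)$-set (so a $5$-general set is a $(4,3)$-set). A set of points of $\mathrm{AG}(n,q)$ is called an $(r,s)$-set (resp. $k$-general set) of $\mathrm{AG}(n,q)$ if, regarded as a subset of $\mathrm{PG}(n,q)=\mathrm{AG}(n,q)\cup H_\infty$ ($H_\infty$ the hyperplane at infinity), it is an $(r,s)$-set (resp. $k$-general set) of $\mathrm{PG}(n,q)$. -}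

module Defs where

open import Level using (Level; _⊔_)
open import Algebra.Apartness.Bundles using (HeytingField; HeytingCommutativeRing)
open import Algebra.Bundles using (CommutativeRing)
open import Algebra.Module.Bundles.Raw using (RawLeftModule)
import Algebra.Module.Morphism.Structures as ModuleMorphisms
import Algebra.Definitions.RawMonoid as RawMonoidDefs
open import Data.Fin.Base using (Fin; zero)
open import Data.Nat.Base using (ℕ; suc; _+_; _∸_; _^_; _≤_; NonZero)
open import Data.Nat.Primality using (Prime)
open import Data.Product.Base using (∃; ∃-syntax; ∃₂; _×_)
open import Data.Vec.Functional using (Vector; zipWith; map; replicate)
open import Function.Base using (_∘_)
open import Function.Bundles using (Bijection; _⇔_)
open import Function.Definitions using (Injective)
open import Relation.Binary.PropositionalEquality.Core using (_≡_)
open import Relation.Binary.PropositionalEquality.Properties using (setoid)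
open import Relation.Nullary.Negation.Core using (¬_)
open import Relation.Unary using (Pred; _⊆_; ∁)
import Data.Vec.Functional.Relation.Binary.Equality.Setoid as VectorEquality

IsPrimePower : ℕ → Set
IsPrimePower q = ∃₂ λ p h → Prime p × NonZero h × q ≡ p ^ h

-- A Heyting field that is finite in this sense has decidable equality and
-- is therefore a field in the classical sense: every x ≉ 0# is invertible.
HasOrder : ∀ {c ℓ₁ ℓ₂} → HeytingField c ℓ₁ ℓ₂ → ℕ → Set (c ⊔ ℓ₁)
HasOrder F q = Bijection (setoid (Fin q)) (HeytingField.setoid F)

module PG {c ℓ₁ ℓ₂} (F : HeytingField c ℓ₁ ℓ₂) (n : ℕ) where

  private
    module F = CommutativeRing (HeytingCommutativeRing.commutativeRing
      (HeytingField.heytingCommutativeRing F))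
  open F using (Carrier; _≈_; 0#)
  open VectorEquality F.setoid using (_≋_; ≋-sym; ≋-trans)
  open RawMonoidDefs F.+-rawMonoid using (sum)

  -- F^(n+1), whose lines through the origin are the points of PG(n,q).
  vectorSpace : RawLeftModule Carrier c ℓ₁
  vectorSpace = record
    { Carrierᴹ = Vector Carrier (suc n)
    ; _≈ᴹ_     = _≋_
    ; _+ᴹ_     = zipWith F._+_
    ; _*ₗ_     = λ a → map (a F.*_)
    ; 0ᴹ       = replicate (suc n) 0#
    ; -ᴹ_      = map (F.-_)
    }

  open RawLeftModule vectorSpace using (_≈ᴹ_; _*ₗ_; 0ᴹ) renaming (Carrierᴹ to V)
  open ModuleMorphisms.LeftModuleMorphisms vectorSpace vectorSpace
    using (IsLeftModuleIsomorphism; module IsLeftModuleIsomorphism)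

  linearCombination : ∀ {m} → Vector Carrier m → Vector V m → V
  linearCombination a v i = sum (λ j → a j F.* v j i)

  _∈⟨_⟩ : ∀ {m} → V → Vector V m → Set (c ⊔ ℓ₁)
  u ∈⟨ v ⟩ = ∃[ a ] u ≈ᴹ linearCombination a v

  LinearlyIndependent : ∀ {m} → Vector V m → Set (c ⊔ ℓ₁)
  LinearlyIndependent v = ∀ a → linearCombination a v ≈ᴹ 0ᴹ → ∀ j → a j ≈ 0#

  record Point : Set (c ⊔ ℓ₁) where
    field
      vector  : V
      nonZero : ¬ (vector ≈ᴹ 0ᴹ)

  open Point

  infix 4 _∼_

  _∼_ : Point → Point → Set (c ⊔ ℓ₁)
  P ∼ Q = ∃[ a ] ¬ (a ≈ 0#) × vector P ≈ᴹ a *ₗ vector Q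

  -- Projective dimension s means vector space dimension s + 1.
  record Subspace (s : ℕ) : Set (c ⊔ ℓ₁) where
    field
      basis       : Vector V (suc s)
      independent : LinearlyIndependent basis

  open Subspace

  points : ∀ {s} → Subspace s → Pred Point (c ⊔ ℓ₁)
  points S P = vector P ∈⟨ basis S ⟩

  -- Sets of points are predicates; points are counted up to _∼_.

  Enumerates : ∀ {ℓ m} → Pred Point ℓ → Vector Point m → Set (c ⊔ ℓ₁ ⊔ ℓ)
  Enumerates X f = Injective _≡_ _∼_ f × (∀ i → X (f i))

  HasAtLeast HasAtMost HasExactly : ∀ {ℓ} → ℕ → Pred Point ℓ → Set (c ⊔ ℓ₁ ⊔ ℓ)
  HasAtLeast m X = ∃ λ (f : Vector Point m) → Enumerates X f
  HasAtMost  r X = ∀ m → HasAtLeast m X → m ≤ r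
  HasExactly m X = ∃ λ (f : Vector Point m) →
    Enumerates X f × (∀ P → X P → ∃[ i ] P ∼ f i)

  Spanning : ∀ {ℓ} → Pred Point ℓ → Set (c ⊔ ℓ₁ ⊔ ℓ)
  Spanning X = ∀ Q → ∃₂ λ m (f : Vector Point m) →
    (∀ i → X (f i)) × vector Q ∈⟨ vector ∘ f ⟩

  _∩points_ : ∀ {ℓ s} → Pred Point ℓ → Subspace s → Pred Point (c ⊔ ℓ₁ ⊔ ℓ)
  (X ∩points S) P = X P × points S P

  record IsRSSet {ℓ} (r s : ℕ) (X : Pred Point ℓ) : Set (c ⊔ ℓ₁ ⊔ ℓ) where
    field
      atMost   : (S : Subspace s) → HasAtMost r (X ∩points S)
      spanning : Spanning X
      attained : ∃ λ (S : Subspace (suc s)) → HasAtLeast (2 + r) (X ∩points S)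

  -- Meaningful for k ≥ 2 only, because of the truncated subtraction.
  IsGeneralSet : ∀ {ℓ} (k : ℕ) → Pred Point ℓ → Set (c ⊔ ℓ₁ ⊔ ℓ)
  IsGeneralSet k = IsRSSet (k ∸ 1) (k ∸ 2)

  -- The affine point x of F^n is the projective point (1, x).
  H∞ : Pred Point ℓ₁
  H∞ P = vector P zero ≈ 0#

  AG : Pred Point ℓ₁
  AG = ∁ H∞

  IsAffineRSSet : ∀ {ℓ} (r s : ℕ) → Pred Point ℓ → Set (c ⊔ ℓ₁ ⊔ ℓ)
  IsAffineRSSet r s X = X ⊆ AG × IsRSSet r s X

  IsAffineGeneralSet : ∀ {ℓ} (k : ℕ) → Pred Point ℓ → Set (c ⊔ ℓ₁ ⊔ ℓ)
  IsAffineGeneralSet k X = X ⊆ AG × IsGeneralSet k X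

  -- Projectivities are represented by linear automorphisms of F^(n+1).
  record Projectivity : Set (c ⊔ ℓ₁) where
    field
      ⟦_⟧           : V → V
      isIsomorphism : IsLeftModuleIsomorphism ⟦_⟧

    open IsLeftModuleIsomorphism isIsomorphism

    infixr 9 _·_

    _·_ : Point → Point
    _·_ P = record
      { vector  = ⟦ vector P ⟧
      ; nonZero = λ gP≈0 → nonZero P (injective (≋-trans gP≈0 (≋-sym 0ᴹ-homo)))
      }

  open Projectivity using (_·_)

  -- Since g is a bijection on points, this says g(X) = X.
  Stabilizes : ∀ {ℓ} → Projectivity → Pred Point ℓ → Set (c ⊔ ℓ₁ ⊔ ℓ)
  Stabilizes g X = ∀ P → X P ⇔ X (g · P)

  IsTransitive : ∀ {ℓ} → Pred Point ℓ → Set (c ⊔ ℓ₁ ⊔ ℓ)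
  IsTransitive X = ∀ P Q → X P → X Q →
    ∃[ g ] Stabilizes g X × Stabilizes g H∞ × (g · P) ∼ Q

{-# OPTIONS --safe #-}

-- Let K be the extension of degree six of F and σ a generator of its Galois
-- group. The set X consists of the points (1 , x), where x runs through the
-- torus T of all nonzero x in K with x σ²x = σx; for the Frobenius map σ, it is
-- the group of order q² - q + 1. As σ³ inverts T, the conjugates of x are x, y,
-- y/x, 1/x, 1/y and x/y, where y = σx. So the points of X are rational points
-- of a del Pezzo surface of degree six, and a linear relation between them is
-- also one between the values of any product of a linear form in 1, x, y and
-- a linear form in 1, 1/x, 1/y. No three of the points (1 , x , y) of the plane
-- are collinear, and the product of a line through two of them and the inverse
-- of a line through two others isolates one point out of five. Seven points in
-- a subspace of projective dimension four would give rise to a conic through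
-- the points (1 , x , y), parametrised over F, which is incompatible with the
-- action of σ.
--
-- The slopes (σx - 1) / (x - 1) parametrise T by the elements of the quadratic
-- extension of F that are not in F, which gives the order of T. Multiplication
-- by T is transitive on X, and Fourier inversion on T shows that X spans. Six
-- dependent points are found by the pigeonhole principle among pairs x, 1/x
-- if q > 4, and by computation if q = 4. Of the hyperplanes through six
-- dependent points, one contains two more, again by counting.

module Submission where

open import Defs
open import Level using (0ℓ; _⊔_; Lift; lift; lower)
open import Algebra.Apartness.Bundles using (HeytingField; HeytingCommutativeRing)
open import Algebra.Bundles using (CommutativeRing; RawRing)
open import Algebra.Core using (Op₁; Op₂)
open import Algebra.Morphism.Structures using (IsRingHomomorphism; IsRingMonomorphism)
import Algebra.Morphism.RingMonomorphism as RingMonomorphism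
open import Algebra.Structures using (IsCommutativeRing)
open import Data.Bool.Base as Bool using (Bool; true; false; if_then_else_; _xor_; _∧_)
open import Data.Empty using (⊥)
open import Data.Fin.Base as Fin using (Fin; zero; suc; toℕ; punchIn; punchOut; inject≤; _↑ʳ_; combine; quotient; remainder; funToFin; finToFun)
open import Data.Fin.Patterns
open import Data.Fin.Permutation using (Permutation; permutation; _⟨$⟩ʳ_)
import Data.Fin.Properties as Fin
open import Data.Integer.Base as ℤ using (ℤ)
import Data.Integer.Properties as ℤ
open import Data.Maybe.Base using (nothing)
open import Data.Nat.Base as ℕ using (ℕ; zero; suc; _∸_; _^_; _≤_; _<_; s≤s; z≤n)
import Data.Nat.Properties as ℕ
open import Data.Nat.Solver using (module +-*-Solver)
open import Data.Product.Base using (∃; ∃₂; _×_; _,_; proj₁; proj₂)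
open import Data.Product.Properties using (≡-dec)
open import Data.Sum.Base using (_⊎_; inj₁; inj₂; [_,_]′)
open import Data.Vec.Base as Vec using (Vec; []; _∷_; lookup)
open import Data.Vec.Functional as Vector using (insertAt)
open import Data.Vec.Functional.Properties using (insertAt-lookup; insertAt-punchIn)
open import Data.Vec.Properties using (lookup-map)
open import Data.Vec.Relation.Unary.All using (All; []; _∷_)
open import Data.Vec.Relation.Unary.AllPairs using ([]; _∷_)
open import Data.Vec.Relation.Unary.Unique.Propositional using (Unique)
open import Data.Vec.Relation.Unary.Unique.Propositional.Properties using (lookup-injective)
open import Function.Base using (_∘_; id)
open import Function.Bundles using (_↔_; Inverse; Bijection; mk⇔)
open import Function.Construct.Identity using (↔-id)
open import Function.Definitions using (Injective)
open import Relation.Binary.Definitions using (DecidableEquality; _Respects_)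
open import Relation.Binary.PropositionalEquality as ≡ using (_≡_; _≢_)
open import Relation.Nullary.Decidable using (dec-true; dec-false)
open import Relation.Nullary.Decidable.Core using (yes; no; isYes; ¬?; does; decidable-stable; map′; _×-dec_)
open import Relation.Nullary.Negation using (¬_; contradiction)
open import Relation.Unary using (Pred)
open import Tactic.RingSolver.Core.AlmostCommutativeRing using (fromCommutativeRing)
open import Tactic.RingSolver.Core.Expression using (Expr; Κ; Ι; _⊕_; _⊗_; _⊛_; ⊝_; module Eval)
open import Tactic.RingSolver.Core.Polynomial.Parameters using (Homomorphism)

-- The equation of T involves only σ, so instead of the Frobenius map an explicit tower serves: a
-- simplest cubic, whose Galois action has a polynomial formula, and w² - w + n, which covers all
-- characteristics. Irreducible members of both families exist because a function on a finite set
-- that takes a value twice misses another. Seven points in projective dimension four satisfy two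
-- independent relations. As any five points are independent, a nonzero relation has at most one
-- zero, and the quotient t of two suitable relations takes different values in F at six of the
-- points. These values are fixed by σ, so identities between t and a point can be conjugated. Of
-- low degree in t and valid at that many values, they become identities of forms, whose roots
-- contradict each other. The counts are tight. Eight points in a hyperplane need q² < (q² - q -
-- 5)(q - 1), which starts to hold at q = 4. Six dependent points from pairs x, 1/x need 2q² < (q² -
-- q - 2)(q - 1), where the factor 2 keeps a pair from being matched with itself; this fails at q =
-- 4.

infixl 6 _⊖_
_⊖_ : ∀ {n} → Expr ℤ n → Expr ℤ n → Expr ℤ n
x ⊖ y = x ⊕ ⊝ y

con : ∀ {n} → ℕ → Expr ℤ n
con k = Κ (ℤ.+ k)

infix 4 _⊜_
_⊜_ : ∀ {n} → Expr ℤ n → Expr ℤ n → Expr ℤ n × Expr ℤ n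
_⊜_ = _,_

-- With coefficients in an abstract ring, the ring solver cannot recognise that
-- 1# - 1# vanishes.
module IntegerCoefficients (R : CommutativeRing 0ℓ 0ℓ) where

  open CommutativeRing R
  open import Data.Integer.Base using (+_; -[1+_])
  open import Algebra.Properties.Ring ring using (-‿distribˡ-*; -‿distribʳ-*; -0#≈0#; -‿involutive)
  open import Algebra.Properties.AbelianGroup +-abelianGroup using (⁻¹-∙-comm)
  open import Algebra.Properties.Semiring.Mult.TCOptimised semiring
    using (×1-homo-*; ×-homo-+; 1+×) renaming (_×_ to _×′_)
  open import Relation.Binary.Reasoning.Setoid setoid

  fromℤ : ℤ → Carrier
  fromℤ (+ n)    = n ×′ 1#
  fromℤ -[1+ n ] = - (suc n ×′ 1#)

  private
    ∸-lemma : ∀ x y z → (x + y) - (x + z) ≈ y - z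
    ∸-lemma x y z = begin
      x + y - (x + z)         ≈⟨ +-cong (+-comm x y) (sym (⁻¹-∙-comm x z)) ⟩
      y + x + (- x + - z)     ≈⟨ +-assoc y x _ ⟩
      y + (x + (- x + - z))   ≈⟨ +-congˡ (+-assoc x (- x) (- z)) ⟨
      y + (x + - x + - z)     ≈⟨ +-congˡ (+-congʳ (-‿inverseʳ x)) ⟩
      y + (0# + - z)          ≈⟨ +-congˡ (+-identityˡ _) ⟩
      y - z                   ∎

    fromℤ-⊖ : ∀ m n → fromℤ (m ℤ.⊖ n) ≈ m ×′ 1# - n ×′ 1#
    fromℤ-⊖ zero    zero    = sym (-‿inverseʳ 0#)
    fromℤ-⊖ zero    (suc n) = sym (+-identityˡ _)
    fromℤ-⊖ (suc m) zero    = begin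
      suc m ×′ 1#       ≈⟨ +-identityʳ _ ⟨
      suc m ×′ 1# + 0#  ≈⟨ +-congˡ -0#≈0# ⟨
      suc m ×′ 1# - 0#  ∎
    fromℤ-⊖ (suc m) (suc n) = begin
      fromℤ (suc m ℤ.⊖ suc n)             ≡⟨ ≡.cong fromℤ (ℤ.[1+m]⊖[1+n]≡m⊖n m n) ⟩
      fromℤ (m ℤ.⊖ n)                     ≈⟨ fromℤ-⊖ m n ⟩
      m ×′ 1# - n ×′ 1#                   ≈⟨ ∸-lemma 1# _ _ ⟨
      1# + m ×′ 1# - (1# + n ×′ 1#)       ≈⟨ +-cong (1+× m 1#) (-‿cong (1+× n 1#)) ⟨
      suc m ×′ 1# - suc n ×′ 1#           ∎

    fromℤ-neg : ∀ i → fromℤ (ℤ.- i) ≈ - fromℤ i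
    fromℤ-neg (+ zero)  = sym -0#≈0#
    fromℤ-neg (+ suc n) = refl
    fromℤ-neg -[1+ n ]  = sym (-‿involutive _)

    fromℤ-+ : ∀ i j → fromℤ (i ℤ.+ j) ≈ fromℤ i + fromℤ j
    fromℤ-+ (+ m)    (+ n)    = ×-homo-+ 1# m n
    fromℤ-+ (+ m)    -[1+ n ] = fromℤ-⊖ m (suc n)
    fromℤ-+ -[1+ m ] (+ n)    = trans (fromℤ-⊖ n (suc m)) (+-comm _ _)
    fromℤ-+ -[1+ m ] -[1+ n ] = begin
      - (suc (suc (m ℕ.+ n)) ×′ 1#)    ≡⟨ ≡.cong (λ k → - (suc k ×′ 1#)) (ℕ.+-suc m n) ⟨
      - ((suc m ℕ.+ suc n) ×′ 1#)      ≈⟨ -‿cong (×-homo-+ 1# (suc m) (suc n)) ⟩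
      - (suc m ×′ 1# + suc n ×′ 1#)    ≈⟨ ⁻¹-∙-comm _ _ ⟨
      - (suc m ×′ 1#) - (suc n ×′ 1#)  ∎

    fromℤ-*⁺ : ∀ m j → fromℤ (+ m ℤ.* j) ≈ fromℤ (+ m) * fromℤ j
    fromℤ-*⁺ m (+ n) = begin
      fromℤ (+ m ℤ.* + n)    ≡⟨ ≡.cong fromℤ (ℤ.pos-* m n) ⟨
      (m ℕ.* n) ×′ 1#        ≈⟨ ×1-homo-* m n ⟩
      m ×′ 1# * (n ×′ 1#)    ∎
    fromℤ-*⁺ m -[1+ n ] = begin
      fromℤ (+ m ℤ.* -[1+ n ])        ≡⟨ ≡.cong fromℤ (ℤ.neg-distribʳ-* (+ m) (+ suc n)) ⟨
      fromℤ (ℤ.- (+ m ℤ.* + suc n))   ≈⟨ fromℤ-neg (+ m ℤ.* + suc n) ⟩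
      - fromℤ (+ m ℤ.* + suc n)       ≈⟨ -‿cong (fromℤ-*⁺ m (+ suc n)) ⟩
      - (m ×′ 1# * (suc n ×′ 1#))     ≈⟨ -‿distribʳ-* _ _ ⟩
      m ×′ 1# * - (suc n ×′ 1#)       ∎

    fromℤ-* : ∀ i j → fromℤ (i ℤ.* j) ≈ fromℤ i * fromℤ j
    fromℤ-* (+ m)    j = fromℤ-*⁺ m j
    fromℤ-* -[1+ m ] j = begin
      fromℤ (-[1+ m ] ℤ.* j)         ≡⟨ ≡.cong fromℤ (ℤ.neg-distribˡ-* (+ suc m) j) ⟨
      fromℤ (ℤ.- (+ suc m ℤ.* j))    ≈⟨ fromℤ-neg (+ suc m ℤ.* j) ⟩
      - fromℤ (+ suc m ℤ.* j)        ≈⟨ -‿cong (fromℤ-*⁺ (suc m) j) ⟩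
      - (suc m ×′ 1# * fromℤ j)      ≈⟨ -‿distribˡ-* _ _ ⟩
      - (suc m ×′ 1#) * fromℤ j      ∎

    isZero : ℤ → Bool
    isZero i = isYes (i ℤ.≟ + 0)

    isZero-sound : ∀ i → Bool.T (isZero i) → 0# ≈ fromℤ i
    isZero-sound i _ with yes ≡.refl ← i ℤ.≟ + 0 = refl

    homo : Homomorphism 0ℓ 0ℓ 0ℓ 0ℓ
    homo = record
      { from = record { rawRing = ℤ.+-*-rawRing ; isZero = isZero }
      ; to = fromCommutativeRing R (λ _ → nothing)
      ; morphism = record
        { ⟦_⟧ = fromℤ ; +-homo = fromℤ-+ ; *-homo = fromℤ-* ; -‿homo = fromℤ-neg
        ; 0-homo = refl ; 1-homo = refl }
      ; Zero-C⟶Zero-R = isZero-sound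
      }

  open Eval rawRing fromℤ public

  private
    open import Tactic.RingSolver.Core.Polynomial.Base (Homomorphism.from homo)
    open import Tactic.RingSolver.Core.Polynomial.Semantics homo renaming (⟦_⟧ to ⟦_⟧ₚ)
    open import Tactic.RingSolver.Core.Polynomial.Homomorphism homo
    open import Algebra.Properties.Semiring.Exp.TCOptimised semiring using (^-congˡ)

    norm : ∀ {n} → Expr ℤ n → Poly n
    norm (Κ x)   = κ x
    norm (Ι x)   = ι x
    norm (x ⊕ y) = norm x ⊞ norm y
    norm (x ⊗ y) = norm x ⊠ norm y
    norm (⊝ x)   = ⊟ norm x
    norm (x ⊛ i) = norm x ⊡ i

  ⟦_⇓⟧ : ∀ {n} → Expr ℤ n → Vec Carrier n → Carrier
  ⟦ e ⇓⟧ = ⟦ norm e ⟧ₚ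

  private
    correct : ∀ {n} (e : Expr ℤ n) ρ → ⟦ e ⇓⟧ ρ ≈ ⟦ e ⟧ ρ
    correct (Κ x)   ρ = κ-hom x ρ
    correct (Ι x)   ρ = ι-hom x ρ
    correct (x ⊕ y) ρ = trans (⊞-hom (norm x) (norm y) ρ) (+-cong (correct x ρ) (correct y ρ))
    correct (x ⊗ y) ρ = trans (⊠-hom (norm x) (norm y) ρ) (*-cong (correct x ρ) (correct y ρ))
    correct (⊝ x)   ρ = trans (⊟-hom (norm x) ρ) (-‿cong (correct x ρ))
    correct (x ⊛ i) ρ = trans (⊡-hom (norm x) i ρ) (^-congˡ i (correct x ρ))

  open import Relation.Binary.Reflection setoid Ι ⟦_⟧ ⟦_⇓⟧ correct public using (solve; prove)

open ≡ using (refl; sym; trans; cong; cong₂; subst)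
open ≡.≡-Reasoning

-- Linear algebra and polynomials over fields with decidable equality.

record Field : Set₁ where
  infix  9 _⁻¹
  infix  8 -_
  infixl 7 _*_
  infixl 6 _+_
  infix  4 _≟_
  field
    Carrier           : Set
    _+_ _*_           : Op₂ Carrier
    -_                : Op₁ Carrier
    0# 1#             : Carrier
    isCommutativeRing : IsCommutativeRing _≡_ _+_ _*_ -_ 0# 1#
    1≢0               : 1# ≢ 0#
    _⁻¹               : Op₁ Carrier
    *-inverseʳ        : ∀ {x} → x ≢ 0# → x * x ⁻¹ ≡ 1#
    _≟_               : DecidableEquality Carrier

  commutativeRing : CommutativeRing 0ℓ 0ℓ
  commutativeRing = record { isCommutativeRing = isCommutativeRing }

  open CommutativeRing commutativeRing public
    using (rawRing; ring; semiring; _-_; +-assoc; +-comm; +-identityˡ; +-identityʳ; *-assoc; *-comm; *-identityˡ; *-identityʳ; zeroˡ; zeroʳ; distribˡ; distribʳ; -‿inverseˡ; -‿inverseʳ)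

module FieldProperties (K : Field) where

  open Field K
  open IntegerCoefficients commutativeRing public using (solve; prove; ⟦_⟧; ⟦_⇓⟧)
  open import Algebra.Properties.Ring ring public using (-0#≈0#)
  open import Algebra.Properties.Group (CommutativeRing.+-group commutativeRing) public
    using () renaming (x∙y⁻¹≈ε⇒x≈y to x-y≈0⇒x≈y; x≈y⇒x∙y⁻¹≈ε to x≈y⇒x-y≈0)
  open import Algebra.Properties.Semiring.Sum semiring public
    using (sum; sum-cong-≗; ∑-distrib-+; ∑-comm; *-distribˡ-sum; *-distribʳ-sum; sum-remove; sum-permute; sum-replicate; sum-replicate-zero)

  private
    variable
      x y z u v : Carrier

  *-cancelˡ : x ≢ 0# → x * y ≡ x * z → y ≡ z
  *-cancelˡ {x} {y} {z} x≢0 xy≡xz = begin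
    y               ≡⟨ lemma y ⟨
    x ⁻¹ * (x * y)  ≡⟨ cong (x ⁻¹ *_) xy≡xz ⟩
    x ⁻¹ * (x * z)  ≡⟨ lemma z ⟩
    z               ∎
    where
    lemma : ∀ w → x ⁻¹ * (x * w) ≡ w
    lemma w = begin
      x ⁻¹ * (x * w)  ≡⟨ solve 3 (λ a b c → a ⊗ (b ⊗ c) ⊜ b ⊗ a ⊗ c) refl (x ⁻¹) x w ⟩
      x * x ⁻¹ * w    ≡⟨ cong (_* w) (*-inverseʳ x≢0) ⟩
      1# * w          ≡⟨ *-identityˡ w ⟩
      w               ∎

  *-cancelˡ-0 : x ≢ 0# → x * y ≡ 0# → y ≡ 0#
  *-cancelˡ-0 {x} x≢0 xy≡0 = *-cancelˡ x≢0 (trans xy≡0 (sym (zeroʳ x)))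

  *≡0 : x * y ≡ 0# → x ≡ 0# ⊎ y ≡ 0#
  *≡0 {x} xy≡0 with x ≟ 0#
  ... | yes x≡0 = inj₁ x≡0
  ... | no  x≢0 = inj₂ (*-cancelˡ-0 x≢0 xy≡0)

  *-≢0 : x ≢ 0# → y ≢ 0# → x * y ≢ 0#
  *-≢0 x≢0 y≢0 xy≡0 = y≢0 (*-cancelˡ-0 x≢0 xy≡0)

  ⁻¹-≢0 : x ≢ 0# → x ⁻¹ ≢ 0#
  ⁻¹-≢0 {x} x≢0 eq = 1≢0 (trans (sym (*-inverseʳ x≢0)) (trans (cong (x *_) eq) (zeroʳ x)))

  neg-≡0 : - x ≡ 0# → x ≡ 0#
  neg-≡0 {x} eq = trans (solve 1 (λ x → x ⊜ ⊝ ⊝ x) refl x) (trans (cong -_ eq) -0#≈0#)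

  -≢0 : x ≢ y → x - y ≢ 0#
  -≢0 x≢y eq = x≢y (x-y≈0⇒x≈y _ _ eq)

  -- Deduction by certificate: the difference of the two sides is written as a combination of the
  -- differences of known equations, and the ring solver checks that identity. The multipliers
  -- supplied here and below are its cofactors.
  linear₁ : ∀ a → x - y ≡ a * (u - v) → u ≡ v → x ≡ y
  linear₁ {x} {y} {u} a eq refl = x-y≈0⇒x≈y x y (begin
    x - y        ≡⟨ eq ⟩
    a * (u - u)  ≡⟨ solve 2 (λ a u → a ⊗ (u ⊖ u) ⊜ con 0) refl a u ⟩
    0#           ∎)

  linear₂ : ∀ {u₁ v₁ u₂ v₂} a₁ a₂ → x - y ≡ a₁ * (u₁ - v₁) + a₂ * (u₂ - v₂) →
            u₁ ≡ v₁ → u₂ ≡ v₂ → x ≡ y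
  linear₂ {u₁ = u₁} {u₂ = u₂} a₁ a₂ eq refl refl = x-y≈0⇒x≈y _ _ (trans eq
    (solve 4 (λ a u b v → a ⊗ (u ⊖ u) ⊕ b ⊗ (v ⊖ v) ⊜ con 0) refl a₁ u₁ a₂ u₂))

  linear₃ : ∀ {u₁ v₁ u₂ v₂ u₃ v₃} a₁ a₂ a₃ →
            x - y ≡ a₁ * (u₁ - v₁) + a₂ * (u₂ - v₂) + a₃ * (u₃ - v₃) →
            u₁ ≡ v₁ → u₂ ≡ v₂ → u₃ ≡ v₃ → x ≡ y
  linear₃ {u₁ = u₁} {u₂ = u₂} {u₃ = u₃} a₁ a₂ a₃ eq refl refl refl = x-y≈0⇒x≈y _ _ (trans eq
    (solve 6 (λ a u b v c w → a ⊗ (u ⊖ u) ⊕ b ⊗ (v ⊖ v) ⊕ c ⊗ (w ⊖ w) ⊜ con 0) refl a₁ u₁ a₂ u₂ a₃ u₃))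

  sum-zero : ∀ {n} (f : Fin n → Carrier) → (∀ i → f i ≡ 0#) → sum f ≡ 0#
  sum-zero {n} f f≡0 = trans (sum-cong-≗ f≡0) (sum-replicate-zero n)

  sum-+ : ∀ {n} (f g : Fin n → Carrier) → sum f ≡ 0# → sum g ≡ 0# → sum (λ i → f i + g i) ≡ 0#
  sum-+ f g f≡0 g≡0 = trans (∑-distrib-+ f g) (trans (cong₂ _+_ f≡0 g≡0) (+-identityˡ 0#))

  sum-* : ∀ {n} a (f : Fin n → Carrier) → sum f ≡ 0# → sum (λ i → a * f i) ≡ 0#
  sum-* a f f≡0 = trans (sym (*-distribˡ-sum a f)) (trans (cong (a *_) f≡0) (zeroʳ a))

  sum-single : ∀ {n} (f : Fin n → Carrier) j → (∀ i → i ≢ j → f i ≡ 0#) → sum f ≡ f j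
  sum-single {suc n} f j zeros = begin
    sum f                                ≡⟨ sum-remove {i = j} f ⟩
    f j + sum (λ i → f (punchIn j i))    ≡⟨ cong (f j +_) (sum-zero _ λ i → zeros (punchIn j i) (Fin.punchInᵢ≢i j i)) ⟩
    f j + 0#                             ≡⟨ +-identityʳ (f j) ⟩
    f j                                  ∎

  LinearlyDependent : ∀ {m k} → (Fin m → Fin k → Carrier) → Set
  LinearlyDependent {m} v = ∃ λ (c : Fin m → Carrier) →
    (∃ λ i → c i ≢ 0#) × (∀ j → sum (λ i → c i * v i j) ≡ 0#)

  private
    sum-eliminate : ∀ {m} (c a r : Fin m → Carrier) b →
      sum (λ i → c i * (a i - r i * b)) ≡ - sum (λ i → c i * r i) * b + sum (λ i → c i * a i)
    sum-eliminate c a r b = begin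
      sum (λ i → c i * (a i - r i * b))
        ≡⟨ sum-cong-≗ (λ i → solve 4 (λ c a r b → c ⊗ (a ⊖ r ⊗ b) ⊜ (⊝ b) ⊗ (c ⊗ r) ⊕ c ⊗ a) refl (c i) (a i) (r i) b) ⟩
      sum (λ i → - b * (c i * r i) + c i * a i)
        ≡⟨ ∑-distrib-+ (λ i → - b * (c i * r i)) (λ i → c i * a i) ⟩
      sum (λ i → - b * (c i * r i)) + sum (λ i → c i * a i)
        ≡⟨ cong (_+ sum (λ i → c i * a i)) (*-distribˡ-sum (- b) (λ i → c i * r i)) ⟨
      - b * sum (λ i → c i * r i) + sum (λ i → c i * a i)
        ≡⟨ cong (_+ sum (λ i → c i * a i)) (solve 2 (λ b s → (⊝ b) ⊗ s ⊜ (⊝ s) ⊗ b) refl b (sum (λ i → c i * r i))) ⟩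
      - sum (λ i → c i * r i) * b + sum (λ i → c i * a i) ∎

  linearlyDependent : ∀ {m k} → k < m → (v : Fin m → Fin k → Carrier) → LinearlyDependent v
  linearlyDependent {suc m} {zero} _ v = (λ _ → 1#) , (zero , 1≢0) , λ ()
  linearlyDependent {suc m} {suc k} (s≤s k<m) v with Fin.any? (λ i → ¬? (v i zero ≟ 0#))
  ... | no none =
    let c , c≢0 , eq = linearlyDependent (ℕ.m<n⇒m<1+n k<m) (λ i j → v i (suc j))
        zeros i = decidable-stable (v i zero ≟ 0#) (λ vi≢0 → none (i , vi≢0))
    in c , c≢0 , λ
      { zero    → sum-zero _ λ i → trans (cong (c i *_) (zeros i)) (zeroʳ (c i))
      ; (suc j) → eq j }
  ... | yes (p , vp≢0) = c , (punchIn p i₀ , λ eq → ci₀≢0 (trans (sym (insertAt-punchIn c′ p _ i₀)) eq)) , eqs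
    where
    r : Fin m → Carrier
    r i = v (punchIn p i) zero * v p zero ⁻¹

    rec = linearlyDependent k<m (λ i j → v (punchIn p i) (suc j) - r i * v p (suc j))
    c′ = proj₁ rec
    i₀ = proj₁ (proj₁ (proj₂ rec))
    ci₀≢0 = proj₂ (proj₁ (proj₂ rec))

    c : Fin (suc m) → Carrier
    c = insertAt c′ p (- sum (λ i → c′ i * r i))

    eliminated : ∀ j → sum (λ i → c i * v i j) ≡ sum (λ i → c′ i * (v (punchIn p i) j - r i * v p j))
    eliminated j = begin
      sum (λ i → c i * v i j)
        ≡⟨ sum-remove {i = p} (λ i → c i * v i j) ⟩
      c p * v p j + sum (λ i → c (punchIn p i) * v (punchIn p i) j)
        ≡⟨ cong₂ _+_ (cong (_* v p j) (insertAt-lookup c′ p _))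
             (sum-cong-≗ λ i → cong (_* v (punchIn p i) j) (insertAt-punchIn c′ p _ i)) ⟩
      - sum (λ i → c′ i * r i) * v p j + sum (λ i → c′ i * v (punchIn p i) j)
        ≡⟨ sum-eliminate c′ _ r (v p j) ⟨
      sum (λ i → c′ i * (v (punchIn p i) j - r i * v p j)) ∎

    eqs : ∀ j → sum (λ i → c i * v i j) ≡ 0#
    eqs (suc j) = trans (eliminated (suc j)) (proj₂ (proj₂ rec) j)
    eqs zero    = trans (eliminated zero) (sum-zero _ λ i →
      trans (cong (λ s → c′ i * (v (punchIn p i) zero - s)) (begin
        v (punchIn p i) zero * v p zero ⁻¹ * v p zero
          ≡⟨ solve 3 (λ a b c → a ⊗ b ⊗ c ⊜ a ⊗ (c ⊗ b)) refl _ _ _ ⟩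
        v (punchIn p i) zero * (v p zero * v p zero ⁻¹)
          ≡⟨ cong (v (punchIn p i) zero *_) (*-inverseʳ vp≢0) ⟩
        v (punchIn p i) zero * 1#
          ≡⟨ *-identityʳ _ ⟩
        v (punchIn p i) zero ∎))
      (trans (cong (c′ i *_) (-‿inverseʳ _)) (zeroʳ _)))

  -- The coefficient of the k-th power is at position k.
  eval : ∀ {n} → Vec Carrier n → Carrier → Carrier
  eval []       t = 0#
  eval (c ∷ cs) t = c + t * eval cs t

  private
    -- Horner's scheme: the quotient of cs(t) - cs(r) by t - r.
    deflate : ∀ {n} → Vec Carrier (suc n) → Carrier → Vec Carrier n
    deflate (c ∷ [])          r = []
    deflate (c ∷ cs@(_ ∷ _)) r = eval cs r ∷ deflate cs r

    factor : ∀ {n} (cs : Vec Carrier (suc n)) r t →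
      eval cs t - eval cs r ≡ (t - r) * eval (deflate cs r) t
    factor (c ∷ [])          r t =
      solve 3 (λ c r t → c ⊕ t ⊗ con 0 ⊖ (c ⊕ r ⊗ con 0) ⊜ (t ⊖ r) ⊗ con 0) refl c r t
    factor (c ∷ cs@(_ ∷ _)) r t = begin
      (c + t * eval cs t) - (c + r * eval cs r)
        ≡⟨ solve 5 (λ c t s r p → c ⊕ t ⊗ s ⊖ (c ⊕ r ⊗ p) ⊜ t ⊗ (s ⊖ p) ⊕ (t ⊖ r) ⊗ p) refl c t (eval cs t) r (eval cs r) ⟩
      t * (eval cs t - eval cs r) + (t - r) * eval cs r
        ≡⟨ cong (λ s → t * s + (t - r) * eval cs r) (factor cs r t) ⟩
      t * ((t - r) * eval (deflate cs r) t) + (t - r) * eval cs r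
        ≡⟨ solve 4 (λ t r q p → t ⊗ ((t ⊖ r) ⊗ q) ⊕ (t ⊖ r) ⊗ p ⊜ (t ⊖ r) ⊗ (p ⊕ t ⊗ q)) refl t r (eval (deflate cs r) t) (eval cs r) ⟩
      (t - r) * (eval cs r + t * eval (deflate cs r) t) ∎

    eval-zero : ∀ {n} {cs : Vec Carrier n} → All (_≡ 0#) cs → ∀ t → eval cs t ≡ 0#
    eval-zero []          t = refl
    eval-zero (refl ∷ zs) t = trans (+-identityˡ _) (trans (cong (t *_) (eval-zero zs t)) (zeroʳ t))

    head-zero : ∀ {n} c {cs : Vec Carrier n} r → All (_≡ 0#) cs → eval (c ∷ cs) r ≡ 0# → c ≡ 0#
    head-zero c {cs} r zs eq = begin
      c                 ≡⟨ +-identityʳ c ⟨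
      c + 0#            ≡⟨ cong (c +_) (zeroʳ r) ⟨
      c + r * 0#        ≡⟨ cong (λ s → c + r * s) (eval-zero zs r) ⟨
      c + r * eval cs r ≡⟨ eq ⟩
      0#                ∎

    zero-deflated : ∀ {n} (cs : Vec Carrier (suc n)) r → All (_≡ 0#) (deflate cs r) →
      eval cs r ≡ 0# → All (_≡ 0#) cs
    zero-deflated (c ∷ [])          r _          eq = head-zero c r [] eq ∷ []
    zero-deflated (c ∷ cs@(_ ∷ _)) r (eq′ ∷ zs) eq =
      let zs′ = zero-deflated cs r zs eq′ in head-zero c r zs′ eq ∷ zs′

  -- Division by t - t₀ for the first root t₀ leaves one coefficient fewer, and the other roots are
  -- roots of the quotient. A zero quotient together with one zero value forces all coefficients to
  -- vanish.
  too-many-roots : ∀ {n} (cs : Vec Carrier n) (t : Fin n → Carrier) → Injective _≡_ _≡_ t →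
    (∀ i → eval cs (t i) ≡ 0#) → All (_≡ 0#) cs
  too-many-roots {zero}  []  t t-inj roots = []
  too-many-roots {suc n} cs  t t-inj roots =
    zero-deflated cs (t zero) (too-many-roots (deflate cs (t zero)) (t ∘ suc) (Fin.suc-injective ∘ t-inj) λ i →
      *-cancelˡ-0 (-≢0 λ eq → contradiction (t-inj eq) λ ()) (begin
        (t (suc i) - t zero) * eval (deflate cs (t zero)) (t (suc i))
          ≡⟨ factor cs (t zero) (t (suc i)) ⟨
        eval cs (t (suc i)) - eval cs (t zero)
          ≡⟨ cong₂ _-_ (roots (suc i)) (roots zero) ⟩
        0# - 0#
          ≡⟨ -‿inverseʳ 0# ⟩
        0# ∎)) (roots zero)

-- The torus, lines in its plane, and the independence of five points.

record CyclicSextic : Set₁ where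
  field
    K               : Field
  open Field K public
  field
    σ               : Carrier → Carrier
    isHomomorphism  : IsRingHomomorphism rawRing rawRing σ
    σ⁶              : ∀ x → σ (σ (σ (σ (σ (σ x))))) ≡ x

module Torus (S : CyclicSextic) where

  open CyclicSextic S
  open FieldProperties K
  open IsRingHomomorphism isHomomorphism using (+-homo; *-homo; -‿homo; 0#-homo; 1#-homo)

  σ² τ : Carrier → Carrier
  σ² x = σ (σ x)
  τ  x = σ (σ² x)

  private
    variable
      x y z u v : Carrier
      n : ℕ

  σ-injective : σ x ≡ σ y → x ≡ y
  σ-injective {x} {y} eq = begin
    x                          ≡⟨ σ⁶ x ⟨
    σ (σ (σ (σ (σ (σ x)))))    ≡⟨ cong (λ s → σ² (τ s)) eq ⟩
    σ (σ (σ (σ (σ (σ y)))))    ≡⟨ σ⁶ y ⟩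
    y                          ∎

  σ-≢0 : x ≢ 0# → σ x ≢ 0#
  σ-≢0 x≢0 eq = x≢0 (σ-injective (trans eq (sym 0#-homo)))

  σ-minus : ∀ x y → σ (x - y) ≡ σ x - σ y
  σ-minus x y = trans (+-homo x (- y)) (cong (σ x +_) (-‿homo y))

  σ-minus-1 : ∀ x → σ (x - 1#) ≡ σ x - 1#
  σ-minus-1 x = trans (σ-minus x 1#) (cong (λ s → σ x - s) 1#-homo)

  τ-+ : ∀ x y → τ (x + y) ≡ τ x + τ y
  τ-+ x y = trans (cong σ² (+-homo x y)) (trans (cong σ (+-homo _ _)) (+-homo _ _))

  τ-* : ∀ x y → τ (x * y) ≡ τ x * τ y
  τ-* x y = trans (cong σ² (*-homo x y)) (trans (cong σ (*-homo _ _)) (*-homo _ _))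

  τ-minus : ∀ x y → τ (x - y) ≡ τ x - τ y
  τ-minus x y = trans (cong σ² (σ-minus x y)) (trans (cong σ (σ-minus _ _)) (σ-minus _ _))

  τ-0 : τ 0# ≡ 0#
  τ-0 = trans (cong σ² 0#-homo) (trans (cong σ 0#-homo) 0#-homo)

  τ-≢0 : x ≢ 0# → τ x ≢ 0#
  τ-≢0 x≢0 = σ-≢0 (σ-≢0 (σ-≢0 x≢0))

  σ-sum : ∀ (f : Fin n → Carrier) → σ (sum f) ≡ sum (σ ∘ f)
  σ-sum {zero}  f = 0#-homo
  σ-sum {suc n} f = trans (+-homo _ _) (cong (σ (f zero) +_) (σ-sum (f ∘ suc)))

  record T (x : Carrier) : Set where
    field
      nonZero : x ≢ 0#
      twist   : x * σ² x ≡ σ x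

    τ-inverse : x * τ x ≡ 1#
    τ-inverse = *-cancelˡ (σ-≢0 (σ-≢0 nonZero)) (linear₂ (τ x) 1#
      (solve 4 (λ x x₁ x₂ x₃ → x₂ ⊗ (x ⊗ x₃) ⊖ x₂ ⊗ con 1 ⊜
        x₃ ⊗ (x ⊗ x₂ ⊖ x₁) ⊕ con 1 ⊗ (x₁ ⊗ x₃ ⊖ x₂)) refl x (σ x) (σ² x) (τ x))
      twist (trans (sym (*-homo x (σ² x))) (cong σ twist)))

    σ-τ-inverse : σ x * σ (τ x) ≡ 1#
    σ-τ-inverse = trans (sym (*-homo x (τ x))) (trans (cong σ τ-inverse) 1#-homo)

    x*στx : x * σ (τ x) ≡ σ² (τ x)
    x*στx = linear₂ (- x) (σ² (τ x))
      (solve 4 (λ x y y₁ y₂ → x ⊗ y₁ ⊖ y₂ ⊜ (⊝ x) ⊗ (y ⊗ y₂ ⊖ y₁) ⊕ y₂ ⊗ (x ⊗ y ⊖ con 1))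
        refl x (τ x) (σ (τ x)) (σ² (τ x)))
      (begin
        τ x * σ² (τ x)          ≡⟨ *-homo _ _ ⟨
        σ (σ² x * σ² (σ² x))    ≡⟨ cong σ (*-homo _ _) ⟨
        σ² (σ x * σ² (σ x))     ≡⟨ cong σ² (*-homo _ _) ⟨
        τ (x * σ² x)            ≡⟨ cong τ twist ⟩
        τ (σ x)                 ∎)
      τ-inverse

    σx*τx : σ x * τ x ≡ σ² x
    σx*τx = linear₂ (- τ x) (σ² x)
      (solve 4 (λ x x₁ x₂ x₃ → x₁ ⊗ x₃ ⊖ x₂ ⊜ (⊝ x₃) ⊗ (x ⊗ x₂ ⊖ x₁) ⊕ x₂ ⊗ (x ⊗ x₃ ⊖ con 1))
        refl x (σ x) (σ² x) (τ x))
      twist τ-inverse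

  open T

  T-1 : T 1#
  T-1 = record
    { nonZero = 1≢0
    ; twist   = trans (*-identityˡ _) (cong σ 1#-homo)
    }

  T-* : T x → T y → T (x * y)
  T-* {x} {y} tx ty = record
    { nonZero = *-≢0 (nonZero tx) (nonZero ty)
    ; twist   = begin
      x * y * σ² (x * y)          ≡⟨ cong (λ s → x * y * s) (trans (cong σ (*-homo x y)) (*-homo (σ x) (σ y))) ⟩
      x * y * (σ² x * σ² y)       ≡⟨ solve 4 (λ a b c d → a ⊗ b ⊗ (c ⊗ d) ⊜ a ⊗ c ⊗ (b ⊗ d)) refl x y (σ² x) (σ² y) ⟩
      x * σ² x * (y * σ² y)       ≡⟨ cong₂ _*_ (twist tx) (twist ty) ⟩
      σ x * σ y                   ≡⟨ *-homo x y ⟨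
      σ (x * y)                   ∎
    }

  T-σ : T x → T (σ x)
  T-σ {x} tx = record
    { nonZero = σ-≢0 (nonZero tx)
    ; twist   = trans (sym (*-homo x (σ² x))) (cong σ (twist tx))
    }

  T-τ : T x → T (τ x)
  T-τ tx = T-σ (T-σ (T-σ tx))

  -- The determinant of the points (1, u, σu), (1, v, σv) and (1, x, σx), which vanishes if they are
  -- collinear.
  line : Carrier → Carrier → Carrier → Carrier
  line u v x = (u - x) * σ (v - x) - (v - x) * σ (u - x)

  line-left : ∀ u v → line u v u ≡ 0#
  line-left u v = begin
    (u - u) * σ (v - u) - (v - u) * σ (u - u)
      ≡⟨ cong (λ s → (u - u) * σ (v - u) - (v - u) * s) (trans (cong σ (-‿inverseʳ u)) 0#-homo) ⟩
    (u - u) * σ (v - u) - (v - u) * 0#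
      ≡⟨ solve 3 (λ u v w → (u ⊖ u) ⊗ w ⊖ (v ⊖ u) ⊗ con 0 ⊜ con 0) refl u v _ ⟩
    0# ∎

  line-right : ∀ u v → line u v v ≡ 0#
  line-right u v = begin
    (u - v) * σ (v - v) - (v - v) * σ (u - v)
      ≡⟨ cong (λ s → (u - v) * s - (v - v) * σ (u - v)) (trans (cong σ (-‿inverseʳ v)) 0#-homo) ⟩
    (u - v) * 0# - (v - v) * σ (u - v)
      ≡⟨ solve 3 (λ u v w → (u ⊖ v) ⊗ con 0 ⊖ (v ⊖ v) ⊗ w ⊜ con 0) refl u v _ ⟩
    0# ∎

  -- If (u - x) / (v - x) is fixed by σ, then it is fixed by τ, which inverts
  -- u, v and x.
  line-≢0 : T u → T v → T x → u ≢ v → u ≢ x → v ≢ x → line u v x ≢ 0#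
  line-≢0 {u} {v} {x} tu tv tx u≢v u≢x v≢x eq =
    *-≢0 (*-≢0 (-≢0 u≢x) (-≢0 v≢x)) (-≢0 (u≢v ∘ sym)) (linear₁ (u * v * x)
      (begin
        (u - x) * (v - x) * (v - u) - 0#
          ≡⟨ solve 3 (λ u v x → (u ⊖ x) ⊗ (v ⊖ x) ⊗ (v ⊖ u) ⊖ con 0 ⊜
               (u ⊖ x) ⊗ u ⊗ (con 1 ⊗ x ⊖ con 1 ⊗ v) ⊖ (v ⊖ x) ⊗ v ⊗ (con 1 ⊗ x ⊖ con 1 ⊗ u)) refl u v x ⟩
        (u - x) * u * (1# * x - 1# * v) - (v - x) * v * (1# * x - 1# * u)
          ≡⟨ cong₂ _-_
               (cong₂ (λ r s → (u - x) * u * (r * x - s * v)) (sym (τ-inverse tv)) (sym (τ-inverse tx)))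
               (cong₂ (λ r s → (v - x) * v * (r * x - s * u)) (sym (τ-inverse tu)) (sym (τ-inverse tx))) ⟩
        (u - x) * u * (v * τ v * x - x * τ x * v) - (v - x) * v * (u * τ u * x - x * τ x * u)
          ≡⟨ solve 6 (λ u v x U V X →
               (u ⊖ x) ⊗ u ⊗ (v ⊗ V ⊗ x ⊖ x ⊗ X ⊗ v) ⊖ (v ⊖ x) ⊗ v ⊗ (u ⊗ U ⊗ x ⊖ x ⊗ X ⊗ u) ⊜
               u ⊗ v ⊗ x ⊗ ((u ⊖ x) ⊗ (V ⊖ X) ⊖ (v ⊖ x) ⊗ (U ⊖ X))) refl u v x (τ u) (τ v) (τ x) ⟩
        u * v * x * ((u - x) * (τ v - τ x) - (v - x) * (τ u - τ x)) ∎)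
      (begin
        (u - x) * (τ v - τ x)  ≡⟨ cong ((u - x) *_) (τ-minus v x) ⟨
        A * τ B                ≡⟨ h₃ ⟩
        B * τ A                ≡⟨ cong ((v - x) *_) (τ-minus u x) ⟩
        (v - x) * (τ u - τ x)  ∎))
    where
    A = u - x
    B = v - x
    A≢0 = -≢0 u≢x
    B≢0 = -≢0 v≢x

    h₁ : A * σ B ≡ B * σ A
    h₁ = x-y≈0⇒x≈y _ _ eq

    σh : ∀ {a b c d} → a * b ≡ c * d → σ a * σ b ≡ σ c * σ d
    σh h = trans (sym (*-homo _ _)) (trans (cong σ h) (*-homo _ _))

    -- Transitivity for the ratios a / b, a′ / b′ and a″ / b″ without division, so that invariance
    -- of A / B under σ climbs to invariance under τ.
    chain : ∀ {a a′ a″ b b′ b″} → a′ ≢ 0# → b′ ≢ 0# →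
            a * b′ ≡ b * a′ → a′ * b″ ≡ b′ * a″ → a * b″ ≡ b * a″
    chain {a} {a′} {a″} {b} {b′} {b″} a′≢0 b′≢0 p q = *-cancelˡ (*-≢0 a′≢0 b′≢0)
      (linear₂ (a′ * b″) (b * a′)
        (solve 6 (λ a a′ a″ b b′ b″ → a′ ⊗ b′ ⊗ (a ⊗ b″) ⊖ a′ ⊗ b′ ⊗ (b ⊗ a″) ⊜
          a′ ⊗ b″ ⊗ (a ⊗ b′ ⊖ b ⊗ a′) ⊕ b ⊗ a′ ⊗ (a′ ⊗ b″ ⊖ b′ ⊗ a″)) refl a a′ a″ b b′ b″) p q)

    h₃ : A * τ B ≡ B * τ A
    h₃ = chain (σ-≢0 (σ-≢0 A≢0)) (σ-≢0 (σ-≢0 B≢0))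
           (chain (σ-≢0 A≢0) (σ-≢0 B≢0) h₁ (σh h₁)) (σh (σh h₁))

  -- For x in T these are 1, 1/x and 1/σx.

  V : Fin 3 → Carrier → Carrier
  V 0F x = 1#
  V 1F x = τ x
  V 2F x = σ (τ x)

  -- Multiplying a relation by a linear form in 1, x and σx gives a vector of this kind, ready to be
  -- paired with the second factor of a product of two linear forms.
  record Perp (x c : Fin n → Carrier) : Set where
    constructor perp
    field
      at : ∀ k → sum (λ i → c i * V k (x i)) ≡ 0#

  open Perp

  module _ {x : Fin n → Carrier} where

    perp-cong : ∀ {c d} → (∀ i → d i ≡ c i) → Perp x c → Perp x d
    perp-cong d≗c p .at k = trans (sum-cong-≗ λ i → cong (_* V k (x i)) (d≗c i)) (at p k)

    perp-+ : ∀ {c d} → Perp x c → Perp x d → Perp x (λ i → c i + d i)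
    perp-+ {c} {d} p q .at k = trans (sum-cong-≗ λ i → distribʳ (V k (x i)) (c i) (d i))
      (sum-+ {n} _ _ (at p k) (at q k))

    perp-* : ∀ {c} a → Perp x c → Perp x (λ i → a * c i)
    perp-* {c} a p .at k = trans (sum-cong-≗ λ i → *-assoc a (c i) _) (sum-* {n} a _ (at p k))

    perp-sum : ∀ {m} (c : Fin m → Fin n → Carrier) → (∀ k → Perp x (c k)) →
      Perp x (λ i → sum (λ k → c k i))
    perp-sum {zero}  c p .at k = sum-zero {n} _ λ i → zeroˡ (V k (x i))
    perp-sum {suc m} c p   = perp-+ (p zero) (perp-sum (c ∘ suc) (p ∘ suc))

    perp-combination : ∀ {a b c} p q r → Perp x a → Perp x b → Perp x c →
      Perp x (λ i → p * a i + q * b i + r * c i)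
    perp-combination p q r pa pb pc = perp-+ (perp-+ (perp-* p pa) (perp-* q pb)) (perp-* r pc)

    -- The image of a line under τ is a linear form in 1, τ x and σ (τ x): `k₀`, `k₁` and `k₂` are
    -- the images under τ of the coefficients of 1, x and σx in the determinant.
    perp-line : ∀ {c} → Perp x c → ∀ u v → sum (λ i → c i * τ (line u v (x i))) ≡ 0#
    perp-line {c} p u v = trans
      (sum-cong-≗ {n} λ i → begin
        c i * τ (line u v (x i))
          ≡⟨ cong (c i *_) (expand (x i)) ⟩
        c i * (k₀ * 1# + k₁ * τ (x i) + k₂ * σ (τ (x i)))
          ≡⟨ solve 6 (λ c a₀ a₁ a₂ v₁ v₂ → c ⊗ (a₀ ⊗ con 1 ⊕ a₁ ⊗ v₁ ⊕ a₂ ⊗ v₂) ⊜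
               (a₀ ⊗ (c ⊗ con 1) ⊕ a₁ ⊗ (c ⊗ v₁)) ⊕ a₂ ⊗ (c ⊗ v₂)) refl (c i) k₀ k₁ k₂ (τ (x i)) (σ (τ (x i))) ⟩
        k₀ * (c i * V 0F (x i)) + k₁ * (c i * V 1F (x i)) + k₂ * (c i * V 2F (x i)) ∎)
      (sum-+ {n} _ _ (sum-+ {n} _ _ (sum-* {n} k₀ _ (at p 0F)) (sum-* {n} k₁ _ (at p 1F))) (sum-* {n} k₂ _ (at p 2F)))
      where
      k₀ = τ (u * σ v - v * σ u)
      k₁ = τ (σ u - σ v)
      k₂ = τ (v - u)

      expand : ∀ x → τ (line u v x) ≡ k₀ * 1# + k₁ * τ x + k₂ * σ (τ x)
      expand x = begin
        τ ((u - x) * σ (v - x) - (v - x) * σ (u - x))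
          ≡⟨ cong₂ (λ r s → τ ((u - x) * r - (v - x) * s)) (σ-minus v x) (σ-minus u x) ⟩
        τ ((u - x) * (σ v - σ x) - (v - x) * (σ u - σ x))
          ≡⟨ cong τ (solve 6 (λ u v x u₁ v₁ x₁ → (u ⊖ x) ⊗ (v₁ ⊖ x₁) ⊖ (v ⊖ x) ⊗ (u₁ ⊖ x₁) ⊜
               (u ⊗ v₁ ⊖ v ⊗ u₁) ⊕ (u₁ ⊖ v₁) ⊗ x ⊕ (v ⊖ u) ⊗ x₁) refl u v x (σ u) (σ v) (σ x)) ⟩
        τ (u * σ v - v * σ u + (σ u - σ v) * x + (v - u) * σ x)
          ≡⟨ trans (τ-+ _ _) (cong (_+ τ ((v - u) * σ x)) (τ-+ _ _)) ⟩
        k₀ + τ ((σ u - σ v) * x) + τ ((v - u) * σ x)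
          ≡⟨ cong₂ _+_ (cong₂ _+_ (sym (*-identityʳ k₀)) (τ-* _ x)) (τ-* _ (σ x)) ⟩
        k₀ * 1# + k₁ * τ x + k₂ * σ (τ x) ∎

  -- A linear dependency of the vectors (1, x i) over the fixed field of σ. As the coefficients are
  -- fixed, applying σ to `combined` replaces each x i by its conjugate and changes nothing else.
  record Relation (a x : Fin n → Carrier) : Set where
    field
      fixed    : ∀ i → σ (a i) ≡ a i
      weights  : sum a ≡ 0#
      combined : sum (λ i → a i * x i) ≡ 0#

  module _ {a x : Fin n → Carrier} (rel : Relation a x) (tx : ∀ i → T (x i)) where

    open Relation rel

    private
      conjugate : ∀ (f : Carrier → Carrier) → sum (λ i → a i * f (x i)) ≡ 0# →
                  sum (λ i → a i * σ (f (x i))) ≡ 0#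
      conjugate f eq = begin
        sum (λ i → a i * σ (f (x i)))      ≡⟨ sum-cong-≗ (λ i → cong (_* σ (f (x i))) (fixed i)) ⟨
        sum (λ i → σ (a i) * σ (f (x i)))  ≡⟨ sum-cong-≗ (λ i → *-homo (a i) (f (x i))) ⟨
        sum (λ i → σ (a i * f (x i)))      ≡⟨ σ-sum (λ i → a i * f (x i)) ⟨
        σ (sum (λ i → a i * f (x i)))      ≡⟨ cong σ eq ⟩
        σ 0#                               ≡⟨ 0#-homo ⟩
        0#                                 ∎

      r₁ = conjugate (λ x → x) combined
      r₂ = conjugate σ r₁
      r₃ = conjugate σ² r₂
      r₄ = conjugate τ r₃
      r₅ = conjugate (σ ∘ τ) r₄

      rewrite-sum : ∀ (f : Carrier → Carrier) (b : Fin n → Carrier) (g : Carrier → Carrier) →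
        (∀ i → b i * g (x i) ≡ f (x i)) → sum (λ i → a i * f (x i)) ≡ 0# →
        sum (λ i → a i * b i * g (x i)) ≡ 0#
      rewrite-sum f b g bg≗f eq = trans
        (sum-cong-≗ λ i → trans (*-assoc (a i) (b i) (g (x i))) (cong (a i *_) (bg≗f i))) eq

      weights′ : sum (λ i → a i * 1#) ≡ 0#
      weights′ = trans (sum-cong-≗ (λ i → *-identityʳ (a i))) weights

    -- For x in T, every product of one of 1, x, σx with one of 1, 1/x, 1/σx is 1 or a conjugate of
    -- x: x / σx is the conjugate by the fifth power of σ, and σx / x is σ²x. So the conjugates of a
    -- relation supply all nine equations of this lemma and the next two.
    relation-perp : Perp x a
    relation-perp .at 0F = weights′
    relation-perp .at 1F = r₃
    relation-perp .at 2F = r₄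

    relation-perp-x : Perp x (λ i → a i * x i)
    relation-perp-x .at 0F = rewrite-sum (λ x → x) x (V 0F) (λ i → *-identityʳ (x i)) combined
    relation-perp-x .at 1F = rewrite-sum (λ _ → 1#) x (V 1F) (λ i → τ-inverse (tx i)) weights′
    relation-perp-x .at 2F = rewrite-sum (σ² ∘ τ) x (V 2F) (λ i → x*στx (tx i)) r₅

    relation-perp-σx : Perp x (λ i → a i * σ (x i))
    relation-perp-σx .at 0F = rewrite-sum σ (σ ∘ x) (V 0F) (λ i → *-identityʳ (σ (x i))) r₁
    relation-perp-σx .at 1F = rewrite-sum σ² (σ ∘ x) (V 1F) (λ i → σx*τx (tx i)) r₂
    relation-perp-σx .at 2F = rewrite-sum (λ _ → 1#) (σ ∘ x) (V 2F) (λ i → σ-τ-inverse (tx i)) weights′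

  -- The line through two of the other four points, times the image under τ of
  -- the line through the other two, vanishes at four points only.
  five-independent : ∀ {a x : Fin 5 → Carrier} → Relation a x → (∀ i → T (x i)) →
    Injective _≡_ _≡_ x → ∀ j → a j ≡ 0#
  five-independent {a} {x} rel tx x-inj j with a j ≟ 0#
  ... | yes aj≡0 = aj≡0
  ... | no  aj≢0 = contradiction total (*-≢0 (*-≢0 aj≢0 (≢0 0F 1F λ ())) (τ-≢0 (≢0 2F 3F λ ())))
    where
    w : Fin 4 → Carrier
    w i = x (punchIn j i)

    w≢ : ∀ i → w i ≢ x j
    w≢ i eq = Fin.punchInᵢ≢i j i (x-inj eq)

    ≢0 : ∀ p q → p ≢ q → line (w p) (w q) (x j) ≢ 0#
    ≢0 p q p≢q = line-≢0 (tx _) (tx _) (tx j) (λ eq → p≢q (Fin.punchIn-injective j p q (x-inj eq))) (w≢ p) (w≢ q)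

    c : Fin 5 → Carrier
    c i = a i * line (w 0F) (w 1F) (x i)

    c-perp : Perp x c
    c-perp = perp-cong
      (λ i → begin
        a i * line (w 0F) (w 1F) (x i)
          ≡⟨ cong₂ (λ r s → a i * ((w 0F - x i) * r - (w 1F - x i) * s)) (σ-minus (w 1F) (x i)) (σ-minus (w 0F) (x i)) ⟩
        a i * ((w 0F - x i) * (σ (w 1F) - σ (x i)) - (w 1F - x i) * (σ (w 0F) - σ (x i)))
          ≡⟨ solve 7 (λ a u v x u₁ v₁ x₁ → a ⊗ ((u ⊖ x) ⊗ (v₁ ⊖ x₁) ⊖ (v ⊖ x) ⊗ (u₁ ⊖ x₁)) ⊜
               (u ⊗ v₁ ⊖ v ⊗ u₁) ⊗ a ⊕ (u₁ ⊖ v₁) ⊗ (a ⊗ x) ⊕ (v ⊖ u) ⊗ (a ⊗ x₁))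
               refl (a i) (w 0F) (w 1F) (x i) (σ (w 0F)) (σ (w 1F)) (σ (x i)) ⟩
        (w 0F * σ (w 1F) - w 1F * σ (w 0F)) * a i + (σ (w 0F) - σ (w 1F)) * (a i * x i) + (w 1F - w 0F) * (a i * σ (x i)) ∎)
      (perp-combination _ _ _ (relation-perp rel tx) (relation-perp-x rel tx) (relation-perp-σx rel tx))

    first : ∀ i {s} → line (w 0F) (w 1F) (w i) ≡ 0# → a (punchIn j i) * line (w 0F) (w 1F) (w i) * s ≡ 0#
    first i {s} eq = trans (cong (λ l → a (punchIn j i) * l * s) eq) (trans (cong (_* s) (zeroʳ _)) (zeroˡ s))

    second : ∀ i {s} → line (w 2F) (w 3F) (w i) ≡ 0# → s * τ (line (w 2F) (w 3F) (w i)) ≡ 0#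
    second i {s} eq = trans (cong (λ l → s * τ l) eq)
      (trans (cong (s *_) τ-0) (zeroʳ s))

    zeros : ∀ i → c (punchIn j i) * τ (line (w 2F) (w 3F) (w i)) ≡ 0#
    zeros 0F = first 0F (line-left _ _)
    zeros 1F = first 1F (line-right _ _)
    zeros 2F = second 2F (line-left _ _)
    zeros 3F = second 3F (line-right _ _)

    total : c j * τ (line (w 2F) (w 3F) (x j)) ≡ 0#
    total = begin
      c j * τ (line (w 2F) (w 3F) (x j))
        ≡⟨ +-identityʳ _ ⟨
      c j * τ (line (w 2F) (w 3F) (x j)) + 0#
        ≡⟨ cong (c j * τ (line (w 2F) (w 3F) (x j)) +_) (sum-zero _ zeros) ⟨
      c j * τ (line (w 2F) (w 3F) (x j)) + sum (λ i → c (punchIn j i) * τ (line (w 2F) (w 3F) (w i)))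
        ≡⟨ sum-remove {i = j} (λ i → c i * τ (line (w 2F) (w 3F) (x i))) ⟨
      sum (λ i → c i * τ (line (w 2F) (w 3F) (x i)))
        ≡⟨ perp-line c-perp (w 2F) (w 3F) ⟩
      0# ∎

  σ-fixed-1 : ∀ {x} → T x → σ x ≡ x → x ≡ 1#
  σ-fixed-1 {x} tx fixed = *-cancelˡ (nonZero tx) (begin
    x * x       ≡⟨ cong (x *_) (trans (sym fixed) (cong σ (sym fixed))) ⟩
    x * σ² x    ≡⟨ twist tx ⟩
    σ x         ≡⟨ fixed ⟩
    x           ≡⟨ *-identityʳ x ⟨
    x * 1#      ∎)

  -- As τ inverts T, the square of x is 1. For x = - 1 the equation of T reads 1 = - 1, so that x =
  -- 1 in this case too.
  τ-fixed-1 : ∀ {x} → T x → τ x ≡ x → x ≡ 1#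
  τ-fixed-1 {x} tx fixed = [ x-y≈0⇒x≈y x 1# , (λ x+1≡0 → trans (x≡-1 x+1≡0) (sym (1≡-1 (x≡-1 x+1≡0)))) ]′ (*≡0 (linear₁ 1#
    (solve 1 (λ x → (x ⊖ con 1) ⊗ (x ⊕ con 1) ⊖ con 0 ⊜ con 1 ⊗ (x ⊗ x ⊖ con 1)) refl x)
    (trans (cong (x *_) (sym fixed)) (τ-inverse tx))))
    where
    x≡-1 : x + 1# ≡ 0# → x ≡ - 1#
    x≡-1 = linear₁ 1# (solve 1 (λ x → x ⊖ ⊝ con 1 ⊜ con 1 ⊗ (x ⊕ con 1 ⊖ con 0)) refl x)
    σ-1 : σ (- 1#) ≡ - 1#
    σ-1 = trans (-‿homo 1#) (cong -_ 1#-homo)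
    1≡-1 : x ≡ - 1# → 1# ≡ - 1#
    1≡-1 refl = trans (solve 0 (con 1 ⊜ ⊝ con 1 ⊗ ⊝ con 1) refl)
      (trans (cong (- 1# *_) (sym (trans (cong σ σ-1) σ-1))) (trans (twist tx) σ-1))

-- Binary linear and quadratic forms, and their roots on the projective line.

module BinaryForms (K : Field) where

  open Field K
  open FieldProperties K

  -- The form as + bt is represented by (a , b), so that W P Q is the value of
  -- P at the root of Q.
  Linear : Set
  Linear = Carrier × Carrier

  W : Linear → Linear → Carrier
  W (a , b) (c , d) = a * d - b * c

  at : Linear → Carrier → Carrier
  at (a , b) t = a + b * t

  Quadratic : Set
  Quadratic = Carrier × Carrier × Carrier

  at₂ : Quadratic → Carrier → Carrier
  at₂ (a , b , c) t = a + b * t + c * (t * t)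

  -- The form as² + bst + ct² at the root (e , - d) of ds + et.
  W₂ : Quadratic → Linear → Carrier
  W₂ (a , b , c) (d , e) = a * (e * e) - b * (e * d) + c * (d * d)

  -- Serves for certificates whose hypotheses say that all coefficients of a polynomial vanish; the
  -- second vector holds the cofactors.
  weighted : ∀ {n} → Vec Carrier n → Vec Carrier n → Carrier
  weighted []       []       = 0#
  weighted (c ∷ cs) (d ∷ ds) = c * d + weighted cs ds

  weighted-zero : ∀ {n} {cs : Vec Carrier n} ds → All (_≡ 0#) cs → weighted cs ds ≡ 0#
  weighted-zero []       []          = refl
  weighted-zero (d ∷ ds) (refl ∷ zs) = trans (cong₂ _+_ (zeroˡ d) (weighted-zero ds zs)) (+-identityˡ 0#)

  weighted-≡ : ∀ {n} {cs : Vec Carrier n} ds {x y} → x - y ≡ weighted cs ds → All (_≡ 0#) cs → x ≡ y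
  weighted-≡ ds eq zs = x-y≈0⇒x≈y _ _ (trans eq (weighted-zero ds zs))

  W-antisym : ∀ {P Q} → W P Q ≡ 0# → W Q P ≡ 0#
  W-antisym {a , b} {c , d} = linear₁ (- 1#)
    (solve 4 (λ a b c d → c ⊗ b ⊖ d ⊗ a ⊖ con 0 ⊜ (⊝ con 1) ⊗ (a ⊗ d ⊖ b ⊗ c ⊖ con 0)) refl a b c d)

  -- W P Q = 0 for nonzero P makes Q a multiple of P, and any two multiples of P are proportional.
  W-trans : ∀ {P Q R} → (proj₁ P ≢ 0# ⊎ proj₂ P ≢ 0#) → W P Q ≡ 0# → W P R ≡ 0# → W Q R ≡ 0#
  W-trans {a , b} {c , d} {e , f} (inj₁ a≢0) p q = *-cancelˡ-0 a≢0 (linear₂ (- e) c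
    (solve 6 (λ a b c d e f → a ⊗ (c ⊗ f ⊖ d ⊗ e) ⊖ con 0 ⊜
      (⊝ e) ⊗ (a ⊗ d ⊖ b ⊗ c ⊖ con 0) ⊕ c ⊗ (a ⊗ f ⊖ b ⊗ e ⊖ con 0)) refl a b c d e f) p q)
  W-trans {a , b} {c , d} {e , f} (inj₂ b≢0) p q = *-cancelˡ-0 b≢0 (linear₂ (- f) d
    (solve 6 (λ a b c d e f → b ⊗ (c ⊗ f ⊖ d ⊗ e) ⊖ con 0 ⊜
      (⊝ f) ⊗ (a ⊗ d ⊖ b ⊗ c ⊖ con 0) ⊕ d ⊗ (a ⊗ f ⊖ b ⊗ e ⊖ con 0)) refl a b c d e f) p q)

  W-zero : ∀ {P Q} → proj₁ Q ≡ 0# → proj₂ Q ≡ 0# → W P Q ≡ 0#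
  W-zero {a , b} refl refl = solve 2 (λ a b → a ⊗ con 0 ⊖ b ⊗ con 0 ⊜ con 0) refl a b

  nonzero : ∀ {P Q} → W P Q ≢ 0# → proj₁ Q ≢ 0# ⊎ proj₂ Q ≢ 0#
  nonzero {P} {c , d} W≢0 with c ≟ 0# | d ≟ 0#
  ... | no c≢0  | _       = inj₁ c≢0
  ... | yes _   | no d≢0  = inj₂ d≢0
  ... | yes c≡0 | yes d≡0 = contradiction (W-zero {P} c≡0 d≡0) W≢0

  -- The certificate is Lagrange interpolation with denominators cleared. Roots are given by linear
  -- forms in order to admit the point at infinity.
  three-roots : ∀ q {P Q R} → W P Q ≢ 0# → W P R ≢ 0# → W Q R ≢ 0# →
    W₂ q P ≡ 0# → W₂ q Q ≡ 0# → W₂ q R ≡ 0# → ∀ t → at₂ q t ≡ 0#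
  three-roots (u , v , w) {a , b} {c , d} {e , f} PQ PR QR p q r t =
    *-cancelˡ-0 (*-≢0 (*-≢0 PQ PR) QR) (linear₃
      ((c * f - d * e) * ((c + d * t) * (e + f * t)))
      (- ((a * f - b * e) * ((a + b * t) * (e + f * t))))
      ((a * d - b * c) * ((a + b * t) * (c + d * t)))
      (solve 10 (λ u v w a b c d e f t →
        (a ⊗ d ⊖ b ⊗ c) ⊗ (a ⊗ f ⊖ b ⊗ e) ⊗ (c ⊗ f ⊖ d ⊗ e) ⊗ (u ⊕ v ⊗ t ⊕ w ⊗ (t ⊗ t)) ⊖ con 0 ⊜
        (c ⊗ f ⊖ d ⊗ e) ⊗ ((c ⊕ d ⊗ t) ⊗ (e ⊕ f ⊗ t)) ⊗ (u ⊗ (b ⊗ b) ⊖ v ⊗ (b ⊗ a) ⊕ w ⊗ (a ⊗ a) ⊖ con 0)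
        ⊕ (⊝ ((a ⊗ f ⊖ b ⊗ e) ⊗ ((a ⊕ b ⊗ t) ⊗ (e ⊕ f ⊗ t)))) ⊗ (u ⊗ (d ⊗ d) ⊖ v ⊗ (d ⊗ c) ⊕ w ⊗ (c ⊗ c) ⊖ con 0)
        ⊕ (a ⊗ d ⊖ b ⊗ c) ⊗ ((a ⊕ b ⊗ t) ⊗ (c ⊕ d ⊗ t)) ⊗ (u ⊗ (f ⊗ f) ⊖ v ⊗ (f ⊗ e) ⊕ w ⊗ (e ⊗ e) ⊖ con 0))
        refl u v w a b c d e f t) p q r)

  infixl 7 _·_
  _·_ : Linear → Linear → Quadratic
  (a , b) · (c , d) = a * c , a * d + b * c , b * d

  infixl 6 _⊟_
  _⊟_ : Quadratic → Quadratic → Quadratic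
  (a , b , c) ⊟ (d , e , f) = a - d , b - e , c - f

  at₂-· : ∀ P Q t → at₂ (P · Q) t ≡ at P t * at Q t
  at₂-· (a , b) (c , d) t = solve 5 (λ a b c d t →
    a ⊗ c ⊕ (a ⊗ d ⊕ b ⊗ c) ⊗ t ⊕ b ⊗ d ⊗ (t ⊗ t) ⊜ (a ⊕ b ⊗ t) ⊗ (c ⊕ d ⊗ t)) refl a b c d t

  W₂-· : ∀ P Q R → W₂ (P · Q) R ≡ W P R * W Q R
  W₂-· (a , b) (c , d) (e , f) = solve 6 (λ a b c d e f →
    a ⊗ c ⊗ (f ⊗ f) ⊖ (a ⊗ d ⊕ b ⊗ c) ⊗ (f ⊗ e) ⊕ b ⊗ d ⊗ (e ⊗ e) ⊜ (a ⊗ f ⊖ b ⊗ e) ⊗ (c ⊗ f ⊖ d ⊗ e)) refl a b c d e f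

  at₂-⊟ : ∀ p q t → at₂ (p ⊟ q) t ≡ at₂ p t - at₂ q t
  at₂-⊟ (a , b , c) (d , e , f) t = solve 7 (λ a b c d e f t →
    (a ⊖ d) ⊕ (b ⊖ e) ⊗ t ⊕ (c ⊖ f) ⊗ (t ⊗ t) ⊜ a ⊕ b ⊗ t ⊕ c ⊗ (t ⊗ t) ⊖ (d ⊕ e ⊗ t ⊕ f ⊗ (t ⊗ t))) refl a b c d e f t

  W₂-⊟ : ∀ p q R → W₂ (p ⊟ q) R ≡ W₂ p R - W₂ q R
  W₂-⊟ (a , b , c) (d , e , f) (g , h) = solve 8 (λ a b c d e f g h →
    (a ⊖ d) ⊗ (h ⊗ h) ⊖ (b ⊖ e) ⊗ (h ⊗ g) ⊕ (c ⊖ f) ⊗ (g ⊗ g) ⊜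
    a ⊗ (h ⊗ h) ⊖ b ⊗ (h ⊗ g) ⊕ c ⊗ (g ⊗ g) ⊖ (d ⊗ (h ⊗ h) ⊖ e ⊗ (h ⊗ g) ⊕ f ⊗ (g ⊗ g))) refl a b c d e f g h

  W-self : ∀ P → W P P ≡ 0#
  W-self (a , b) = solve 2 (λ a b → a ⊗ b ⊖ b ⊗ a ⊜ con 0) refl a b

  quadratic-zero : ∀ q (t : Fin 3 → Carrier) → Injective _≡_ _≡_ t → (∀ i → at₂ q (t i) ≡ 0#) →
    let a , b , c = q in All (_≡ 0#) (a ∷ b ∷ c ∷ [])
  quadratic-zero (a , b , c) t t-inj zeros = too-many-roots (a ∷ b ∷ c ∷ []) t t-inj λ i → trans
    (solve 4 (λ a b c t → a ⊕ t ⊗ (b ⊕ t ⊗ (c ⊕ t ⊗ con 0)) ⊜ a ⊕ b ⊗ t ⊕ c ⊗ (t ⊗ t)) refl a b c (t i)) (zeros i)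

  quadratic-W-zero : ∀ q (t : Fin 3 → Carrier) → Injective _≡_ _≡_ t → (∀ i → at₂ q (t i) ≡ 0#) → ∀ R → W₂ q R ≡ 0#
  quadratic-W-zero q@(a , b , c) t t-inj zeros (d , e) = weighted-≡ (e * e ∷ - (e * d) ∷ d * d ∷ [])
    (solve 5 (λ a b c d e → a ⊗ (e ⊗ e) ⊖ b ⊗ (e ⊗ d) ⊕ c ⊗ (d ⊗ d) ⊖ con 0 ⊜
      a ⊗ (e ⊗ e) ⊕ (b ⊗ (⊝ (e ⊗ d)) ⊕ (c ⊗ (d ⊗ d) ⊕ con 0))) refl a b c d e)
    (quadratic-zero q t t-inj zeros)

  -- An equation of polynomials in t of degree at most four becomes one of
  -- quartic forms; the right-hand side, of degree three, gains a factor.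
  quartic-identity : ∀ q p k l n (t : Fin 5 → Carrier) → Injective _≡_ _≡_ t →
    (∀ i → at₂ q (t i) * at₂ p (t i) ≡ k * (at l (t i) * at₂ n (t i))) →
    ∀ R → W₂ q R * W₂ p R ≡ k * (proj₂ R * (W l R * W₂ n R))
  quartic-identity (q₀ , q₁ , q₂) (p₀ , p₁ , p₂) k (l₀ , l₁) (n₀ , n₁ , n₂) t t-inj eq (d , e) =
    weighted-≡ (e * e * (e * e) ∷ - (e * e * (e * d)) ∷ e * d * (e * d) ∷ - (d * d * (e * d)) ∷ d * d * (d * d) ∷ [])
      (solve 14 (λ q₀ q₁ q₂ p₀ p₁ p₂ k l₀ l₁ n₀ n₁ n₂ d e →
        (q₀ ⊗ (e ⊗ e) ⊖ q₁ ⊗ (e ⊗ d) ⊕ q₂ ⊗ (d ⊗ d)) ⊗ (p₀ ⊗ (e ⊗ e) ⊖ p₁ ⊗ (e ⊗ d) ⊕ p₂ ⊗ (d ⊗ d))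
        ⊖ k ⊗ (e ⊗ ((l₀ ⊗ e ⊖ l₁ ⊗ d) ⊗ (n₀ ⊗ (e ⊗ e) ⊖ n₁ ⊗ (e ⊗ d) ⊕ n₂ ⊗ (d ⊗ d)))) ⊜
        (q₀ ⊗ p₀ ⊖ k ⊗ (l₀ ⊗ n₀)) ⊗ (e ⊗ e ⊗ (e ⊗ e)) ⊕
        ((q₀ ⊗ p₁ ⊕ q₁ ⊗ p₀ ⊖ k ⊗ (l₀ ⊗ n₁ ⊕ l₁ ⊗ n₀)) ⊗ (⊝ (e ⊗ e ⊗ (e ⊗ d))) ⊕
        ((q₀ ⊗ p₂ ⊕ q₁ ⊗ p₁ ⊕ q₂ ⊗ p₀ ⊖ k ⊗ (l₀ ⊗ n₂ ⊕ l₁ ⊗ n₁)) ⊗ (e ⊗ d ⊗ (e ⊗ d)) ⊕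
        ((q₁ ⊗ p₂ ⊕ q₂ ⊗ p₁ ⊖ k ⊗ (l₁ ⊗ n₂)) ⊗ (⊝ (d ⊗ d ⊗ (e ⊗ d))) ⊕
        (q₂ ⊗ p₂ ⊗ (d ⊗ d ⊗ (d ⊗ d)) ⊕ con 0)))))
        refl q₀ q₁ q₂ p₀ p₁ p₂ k l₀ l₁ n₀ n₁ n₂ d e)
      (too-many-roots
        (q₀ * p₀ - k * (l₀ * n₀) ∷
         q₀ * p₁ + q₁ * p₀ - k * (l₀ * n₁ + l₁ * n₀) ∷
         q₀ * p₂ + q₁ * p₁ + q₂ * p₀ - k * (l₀ * n₂ + l₁ * n₁) ∷
         q₁ * p₂ + q₂ * p₁ - k * (l₁ * n₂) ∷
         q₂ * p₂ ∷ []) t t-inj λ i → linear₁ 1#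
        (solve 13 (λ q₀ q₁ q₂ p₀ p₁ p₂ k l₀ l₁ n₀ n₁ n₂ t →
          (q₀ ⊗ p₀ ⊖ k ⊗ (l₀ ⊗ n₀)) ⊕ t ⊗
          ((q₀ ⊗ p₁ ⊕ q₁ ⊗ p₀ ⊖ k ⊗ (l₀ ⊗ n₁ ⊕ l₁ ⊗ n₀)) ⊕ t ⊗
          ((q₀ ⊗ p₂ ⊕ q₁ ⊗ p₁ ⊕ q₂ ⊗ p₀ ⊖ k ⊗ (l₀ ⊗ n₂ ⊕ l₁ ⊗ n₁)) ⊕ t ⊗
          ((q₁ ⊗ p₂ ⊕ q₂ ⊗ p₁ ⊖ k ⊗ (l₁ ⊗ n₂)) ⊕ t ⊗ (q₂ ⊗ p₂ ⊕ t ⊗ con 0)))) ⊖ con 0 ⊜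
          con 1 ⊗ ((q₀ ⊕ q₁ ⊗ t ⊕ q₂ ⊗ (t ⊗ t)) ⊗ (p₀ ⊕ p₁ ⊗ t ⊕ p₂ ⊗ (t ⊗ t)) ⊖
            k ⊗ ((l₀ ⊕ l₁ ⊗ t) ⊗ (n₀ ⊕ n₁ ⊗ t ⊕ n₂ ⊗ (t ⊗ t)))))
          refl q₀ q₁ q₂ p₀ p₁ p₂ k l₀ l₁ n₀ n₁ n₂ (t i)) (eq i))

-- No conic through six points is parametrised over F.

module Conics (S : CyclicSextic) where

  open CyclicSextic S
  open FieldProperties K
  open BinaryForms K
  open Torus S
  open T
  open IsRingHomomorphism isHomomorphism using (+-homo; *-homo; -‿homo; 0#-homo; 1#-homo)

  module _ {x : Fin 6 → Carrier} (tx : ∀ i → T (x i)) (x-inj : Injective _≡_ _≡_ x) where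

    private
      -- Pairing a vector supported on the first three points with the image under τ of the line
      -- through two of them leaves only the term of the third.
      perp-supported : ∀ {e} → Perp x e → (∀ k → e (3 ↑ʳ k) ≡ 0#) → ∀ i → e i ≡ 0#
      perp-supported {e} p zeros = λ
        { 0F → single 0F 1F 2F (λ ()) (λ ()) (λ ()) λ
            { 0F 0≢0 → contradiction refl 0≢0 ; 1F _ → left 1F 2F ; 2F _ → right 1F 2F
            ; 3F _ → zero₃ 0F ; 4F _ → zero₃ 1F ; 5F _ → zero₃ 2F }
        ; 1F → single 1F 0F 2F (λ ()) (λ ()) (λ ()) λ
            { 1F 1≢1 → contradiction refl 1≢1 ; 0F _ → left 0F 2F ; 2F _ → right 0F 2F
            ; 3F _ → zero₃ 0F ; 4F _ → zero₃ 1F ; 5F _ → zero₃ 2F }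
        ; 2F → single 2F 0F 1F (λ ()) (λ ()) (λ ()) λ
            { 2F 2≢2 → contradiction refl 2≢2 ; 0F _ → left 0F 1F ; 1F _ → right 0F 1F
            ; 3F _ → zero₃ 0F ; 4F _ → zero₃ 1F ; 5F _ → zero₃ 2F }
        ; 3F → zeros 0F ; 4F → zeros 1F ; 5F → zeros 2F }
        where
        term : Fin 6 → Fin 6 → Fin 6 → Carrier
        term u v i = e i * τ (line (x u) (x v) (x i))

        τ0 : ∀ {y} → y ≡ 0# → τ y ≡ 0#
        τ0 refl = τ-0

        left : ∀ u v → term u v u ≡ 0#
        left u v = trans (cong (e u *_) (τ0 (line-left (x u) (x v)))) (zeroʳ (e u))

        right : ∀ u v → term u v v ≡ 0#
        right u v = trans (cong (e v *_) (τ0 (line-right (x u) (x v)))) (zeroʳ (e v))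

        zero₃ : ∀ k {s} → e (3 ↑ʳ k) * s ≡ 0#
        zero₃ k {s} = trans (cong (_* s) (zeros k)) (zeroˡ s)

        single : ∀ j u v → u ≢ v → u ≢ j → v ≢ j → (∀ i → i ≢ j → term u v i ≡ 0#) → e j ≡ 0#
        single j u v u≢v u≢j v≢j others =
          [ (λ ej≡0 → ej≡0)
          , (λ eq → contradiction eq (τ-≢0 (line-≢0 (tx u) (tx v) (tx j) (u≢v ∘ x-inj) (u≢j ∘ x-inj) (v≢j ∘ x-inj))))
          ]′ (*≡0 (trans (sym (sum-single (term u v) j others)) (perp-line p (x u) (x v))))

    -- Since 1, 1/x and 1/σx are independent on any three points, Perp x has
    -- dimension three.
    perp-dependent : (c : Fin 4 → Fin 6 → Carrier) → (∀ k → Perp x (c k)) → LinearlyDependent c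
    perp-dependent c p =
      let d , d≢0 , eq = linearlyDependent (s≤s (s≤s (s≤s (s≤s z≤n)))) (λ k i → c k (3 ↑ʳ i))
      in d , d≢0 , perp-supported (perp-sum (λ k i → d k * c k i) (λ k → perp-* (d k) (p k))) eq

  -- A Möbius transformation takes the parameters t i to the slopes z₁ i / z i
  -- of the lines joining the points x i to 1, and z i is the value at t i of
  -- a rational function of degree two. Comparing the zeros of the forms
  -- involved with their conjugates shows that this is impossible.
  no-conic : {x a t : Fin 6 → Carrier} → (∀ i → T (x i)) → Injective _≡_ _≡_ x → (∀ i → x i ≢ 1#) →
    (∀ i → a i ≢ 0#) → Injective _≡_ _≡_ t → (∀ i → σ (t i) ≡ t i) →
    Perp x a →
    Perp x (λ i → a i * (x i - 1#)) → Perp x (λ i → a i * σ (x i - 1#)) →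
    Perp x (λ i → a i * t i * (x i - 1#)) → Perp x (λ i → a i * t i * σ (x i - 1#)) → ⊥
  no-conic {x} {a} {t} tx x-inj x≢1 a≢0 t-inj σt pa pz pz₁ ptz ptz₁ = final
    where
    z z₁ z₂ : Fin 6 → Carrier
    z  i = x i - 1#
    z₁ i = σ (z i)
    z₂ i = σ (z₁ i)

    z≢0 : ∀ i → z i ≢ 0#
    z≢0 i = -≢0 (x≢1 i)

    σz : ∀ i → z₁ i ≡ σ (x i) - 1#
    σz i = σ-minus-1 (x i)

    σσz : ∀ i → z₂ i ≡ σ² (x i) - 1#
    σσz i = trans (cong σ (σz i)) (σ-minus-1 (σ (x i)))

    τz : ∀ i → σ (z₂ i) ≡ τ (x i) - 1#
    τz i = trans (cong σ (σσz i)) (σ-minus-1 (σ² (x i)))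

    -- This and `zz₃` are the equation of T and a consequence of it, rewritten in z = x - 1, whose
    -- ratio z₁ / z is the slope of a line through 1.
    zz₂ : ∀ i → z i * z₂ i ≡ z₁ i - z i - z₂ i
    zz₂ i = begin
      (x i - 1#) * z₂ i
        ≡⟨ cong ((x i - 1#) *_) (σσz i) ⟩
      (x i - 1#) * (σ² (x i) - 1#)
        ≡⟨ linear₁ 1# (solve 3 (λ x x₁ x₂ → (x ⊖ con 1) ⊗ (x₂ ⊖ con 1) ⊖ (x₁ ⊖ con 1 ⊖ (x ⊖ con 1) ⊖ (x₂ ⊖ con 1)) ⊜
             con 1 ⊗ (x ⊗ x₂ ⊖ x₁)) refl (x i) (σ (x i)) (σ² (x i))) (twist (tx i)) ⟩
      σ (x i) - 1# - (x i - 1#) - (σ² (x i) - 1#)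
        ≡⟨ cong₂ (λ r s → r - (x i - 1#) - s) (σz i) (σσz i) ⟨
      z₁ i - z i - z₂ i ∎

    zz₃ : ∀ i → z₂ i * z i ≡ σ (z₂ i) * (z i - z₁ i)
    zz₃ i = begin
      z₂ i * (x i - 1#)
        ≡⟨ cong (_* (x i - 1#)) (σσz i) ⟩
      (σ² (x i) - 1#) * (x i - 1#)
        ≡⟨ linear₃ 1# 1# (- 1#) (solve 4 (λ x x₁ x₂ x₃ → (x₂ ⊖ con 1) ⊗ (x ⊖ con 1) ⊖ (x₃ ⊖ con 1) ⊗ (x ⊖ con 1 ⊖ (x₁ ⊖ con 1)) ⊜
             con 1 ⊗ (x ⊗ x₂ ⊖ x₁) ⊕ con 1 ⊗ (x₁ ⊗ x₃ ⊖ x₂) ⊕ (⊝ con 1) ⊗ (x ⊗ x₃ ⊖ con 1)) refl (x i) (σ (x i)) (σ² (x i)) (τ (x i)))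
             (twist (tx i)) (σx*τx (tx i)) (τ-inverse (tx i)) ⟩
      (τ (x i) - 1#) * (x i - 1# - (σ (x i) - 1#))
        ≡⟨ cong₂ (λ r s → r * (x i - 1# - s)) (τz i) (σz i) ⟨
      σ (z₂ i) * (z i - z₁ i) ∎

    slopes-differ : ∀ i j → i ≢ j → z₁ i * z j ≢ z₁ j * z i
    slopes-differ i j i≢j eq = line-≢0 (tx i) (tx j) T-1 (i≢j ∘ x-inj) (x≢1 i) (x≢1 j)
      (linear₁ (- 1#) (solve 4 (λ a b c d → a ⊗ b ⊖ c ⊗ d ⊖ con 0 ⊜ (⊝ con 1) ⊗ (d ⊗ c ⊖ b ⊗ a)) refl (z i) (z₁ j) (z j) (z₁ i)) eq)

    -- A dependency of these four vectors, divided by a, reads (d₀ + d₁ t) z + (d₂ + d₃ t) z₁ = 0: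
    -- the slope z₁ / z is the quotient of two linear polynomials in t.
    dep₁ = perp-dependent tx x-inj
      (λ { 0F i → a i * z i ; 1F i → a i * t i * z i ; 2F i → a i * z₁ i ; 3F i → a i * t i * z₁ i })
      (λ { 0F → pz ; 1F → ptz ; 2F → pz₁ ; 3F → ptz₁ })

    d₁ = proj₁ dep₁

    μ ƛ μ₁ ƛ₁ μ₂ ƛ₂ : Linear
    μ = d₁ 0F , d₁ 1F
    ƛ = - d₁ 2F , - d₁ 3F

    σL : Linear → Linear
    σL (a , b) = σ a , σ b

    μ₁ = σL μ
    ƛ₁ = σL ƛ
    μ₂ = σL μ₁
    ƛ₂ = σL ƛ₁

    σ-W : ∀ P Q → σ (W P Q) ≡ W (σL P) (σL Q)
    σ-W (a , b) (c , d) = trans (σ-minus (a * d) (b * c)) (cong₂ _-_ (*-homo a d) (*-homo b c))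

    σ-W-≢0 : ∀ P Q → W P Q ≢ 0# → W (σL P) (σL Q) ≢ 0#
    σ-W-≢0 P Q WPQ≢0 eq = σ-≢0 WPQ≢0 (trans (σ-W P Q) eq)

    σ-W-≡0 : ∀ P Q → W P Q ≡ 0# → W (σL P) (σL Q) ≡ 0#
    σ-W-≡0 P Q WPQ≡0 = trans (sym (σ-W P Q)) (trans (cong σ WPQ≡0) 0#-homo)

    σ-at : ∀ P i → σ (at P (t i)) ≡ at (σL P) (t i)
    σ-at (a , b) i = trans (+-homo a (b * t i)) (cong (σ a +_) (trans (*-homo b (t i)) (cong (σ b *_) (σt i))))

    slope : ∀ i → at μ (t i) * z i ≡ at ƛ (t i) * z₁ i
    slope i = *-cancelˡ (a≢0 i) (linear₁ 1#
      (solve 8 (λ a t z z₁ α β γ δ →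
        a ⊗ ((α ⊕ β ⊗ t) ⊗ z) ⊖ a ⊗ ((⊝ γ ⊕ (⊝ δ) ⊗ t) ⊗ z₁) ⊜
        con 1 ⊗ (α ⊗ (a ⊗ z) ⊕ (β ⊗ (a ⊗ t ⊗ z) ⊕ (γ ⊗ (a ⊗ z₁) ⊕ (δ ⊗ (a ⊗ t ⊗ z₁) ⊕ con 0))) ⊖ con 0))
        refl (a i) (t i) (z i) (z₁ i) (d₁ 0F) (d₁ 1F) (d₁ 2F) (d₁ 3F))
      (proj₂ (proj₂ dep₁) i))

    σ-slope : ∀ P Q i {u v} → at P (t i) * u ≡ at Q (t i) * v → at (σL P) (t i) * σ u ≡ at (σL Q) (t i) * σ v
    σ-slope P Q i {u} {v} eq = begin
      at (σL P) (t i) * σ u   ≡⟨ cong (_* σ u) (σ-at P i) ⟨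
      σ (at P (t i)) * σ u    ≡⟨ *-homo _ _ ⟨
      σ (at P (t i) * u)      ≡⟨ cong σ eq ⟩
      σ (at Q (t i) * v)      ≡⟨ *-homo _ _ ⟩
      σ (at Q (t i)) * σ v    ≡⟨ cong (_* σ v) (σ-at Q i) ⟩
      at (σL Q) (t i) * σ v   ∎

    slope₁ : ∀ i → at μ₁ (t i) * z₁ i ≡ at ƛ₁ (t i) * z₂ i
    slope₁ i = σ-slope μ ƛ i (slope i)

    slope₂ : ∀ i → at μ₂ (t i) * z₂ i ≡ at ƛ₂ (t i) * σ (z₂ i)
    slope₂ i = σ-slope μ₁ ƛ₁ i (slope₁ i)

    two-zeros : ∀ P i j → i ≢ j → at P (t i) ≡ 0# → at P (t j) ≡ 0# → proj₁ P ≡ 0# × proj₂ P ≡ 0#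
    two-zeros (a , b) i j i≢j p q = a≡0 , b≡0
      where
      b≡0 : b ≡ 0#
      b≡0 = *-cancelˡ-0 (-≢0 (i≢j ∘ t-inj)) (linear₂ 1# (- 1#)
        (solve 4 (λ a b s t → (s ⊖ t) ⊗ b ⊖ con 0 ⊜ con 1 ⊗ (a ⊕ b ⊗ s ⊖ con 0) ⊕ (⊝ con 1) ⊗ (a ⊕ b ⊗ t ⊖ con 0)) refl a b (t i) (t j)) p q)
      a≡0 : a ≡ 0#
      a≡0 = linear₂ 1# (- t i)
        (solve 3 (λ a b s → a ⊖ con 0 ⊜ con 1 ⊗ (a ⊕ b ⊗ s ⊖ con 0) ⊕ (⊝ s) ⊗ (b ⊖ con 0)) refl a b (t i)) p b≡0

    at-≡0 : ∀ i → at ƛ (t i) ≡ 0# → at μ (t i) ≡ 0#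
    at-≡0 i eq = *-cancelˡ-0 (z≢0 i) (trans (*-comm _ _) (trans (slope i) (trans (cong (_* z₁ i) eq) (zeroˡ (z₁ i)))))

    -- If μ and ƛ were proportional, two of the slopes would agree.
    Wμƛ≢0 : W μ ƛ ≢ 0#
    Wμƛ≢0 eq = case-at
      where
      proportional : ∀ s u → at μ s * at ƛ u ≡ at μ u * at ƛ s
      proportional s u = linear₁ (u - s)
        (solve 6 (λ a b c d s u → (a ⊕ b ⊗ s) ⊗ (c ⊕ d ⊗ u) ⊖ (a ⊕ b ⊗ u) ⊗ (c ⊕ d ⊗ s) ⊜ (u ⊖ s) ⊗ (a ⊗ d ⊖ b ⊗ c ⊖ con 0))
          refl (proj₁ μ) (proj₂ μ) (proj₁ ƛ) (proj₂ ƛ) s u) eq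

      at-most-one : ∀ i j → i ≢ j → ¬ (at ƛ (t i) ≢ 0# × at ƛ (t j) ≢ 0#)
      at-most-one i j i≢j (p , q) = slopes-differ i j i≢j (*-cancelˡ (*-≢0 p q) (linear₃
        (- at ƛ (t j) * z j) (at ƛ (t i) * z i) (z i * z j)
        (solve 8 (λ l m μi μj zi zj wi wj →
          l ⊗ m ⊗ (wi ⊗ zj) ⊖ l ⊗ m ⊗ (wj ⊗ zi) ⊜
          (⊝ m) ⊗ zj ⊗ (μi ⊗ zi ⊖ l ⊗ wi) ⊕ l ⊗ zi ⊗ (μj ⊗ zj ⊖ m ⊗ wj) ⊕ zi ⊗ zj ⊗ (μi ⊗ m ⊖ μj ⊗ l))
          refl (at ƛ (t i)) (at ƛ (t j)) (at μ (t i)) (at μ (t j)) (z i) (z j) (z₁ i) (z₁ j))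
        (slope i) (slope j) (proportional (t i) (t j))))

      no-two-zeros : ∀ i j → i ≢ j → ¬ (at ƛ (t i) ≡ 0# × at ƛ (t j) ≡ 0#)
      no-two-zeros i j i≢j (p , q) =
        let ƛ₀ , ƛ₁ = two-zeros ƛ i j i≢j p q
            μ₀ , μ₁ = two-zeros μ i j i≢j (at-≡0 i p) (at-≡0 j q)
        in all-zero (proj₁ (proj₂ dep₁)) λ { 0F → μ₀ ; 1F → μ₁ ; 2F → neg-≡0 ƛ₀ ; 3F → neg-≡0 ƛ₁ }
        where
        all-zero : (∃ λ k → d₁ k ≢ 0#) → ¬ (∀ k → d₁ k ≡ 0#)
        all-zero (k , dk≢0) zeros = dk≢0 (zeros k)

      case-at : ⊥
      case-at with at ƛ (t 0F) ≟ 0# | at ƛ (t 1F) ≟ 0# | at ƛ (t 2F) ≟ 0#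
      ... | yes p | yes q | _     = no-two-zeros 0F 1F (λ ()) (p , q)
      ... | yes p | no _  | yes r = no-two-zeros 0F 2F (λ ()) (p , r)
      ... | yes _ | no q  | no r  = at-most-one 1F 2F (λ ()) (q , r)
      ... | no _  | yes q | yes r = no-two-zeros 1F 2F (λ ()) (q , r)
      ... | no p  | yes _ | no r  = at-most-one 0F 2F (λ ()) (p , r)
      ... | no p  | no q  | _     = at-most-one 0F 1F (λ ()) (p , q)

    Wƛμ≢0 : W ƛ μ ≢ 0#
    Wƛμ≢0 eq = Wμƛ≢0 (W-antisym {ƛ} {μ} eq)

    at-ƛ≢0 : ∀ i → at ƛ (t i) ≢ 0#
    at-ƛ≢0 i eq = Wμƛ≢0 (begin
      proj₁ μ * proj₂ ƛ - proj₂ μ * proj₁ ƛ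
        ≡⟨ linear₂ (proj₂ ƛ) (- proj₂ μ) (solve 5 (λ a b c d t → a ⊗ d ⊖ b ⊗ c ⊖ con 0 ⊜ d ⊗ (a ⊕ b ⊗ t ⊖ con 0) ⊕ (⊝ b) ⊗ (c ⊕ d ⊗ t ⊖ con 0))
             refl (proj₁ μ) (proj₂ μ) (proj₁ ƛ) (proj₂ ƛ) (t i)) (at-≡0 i eq) eq ⟩
      0# ∎)

    α = proj₁ μ
    β = proj₂ μ
    γ = proj₁ ƛ
    δ = proj₂ ƛ

    first-three : Fin 3 → Fin 6
    first-three k = inject≤ k (s≤s (s≤s (s≤s z≤n)))

    t₃ : Fin 3 → Carrier
    t₃ = t ∘ first-three

    t₃-inj : Injective _≡_ _≡_ t₃
    t₃-inj = Fin.inject≤-injective _ _ _ _ ∘ t-inj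

    -- By `slope`, the last three vectors are a z / ƛ(t) times 1, t and t², up to the factor W μ ƛ.
    -- Their dependency with a itself makes z a constant multiple of ƛ(t) / q(t) for a quadratic
    -- polynomial q.
    dep₂ = perp-dependent tx x-inj
      (λ { 0F i → a i
         ; 1F i → δ * (a i * z₁ i) + - β * (a i * z i)
         ; 2F i → δ * (a i * t i * z₁ i) + - β * (a i * t i * z i)
         ; 3F i → - γ * (a i * t i * z₁ i) + α * (a i * t i * z i) })
      (λ { 0F → pa
         ; 1F → perp-+ (perp-* δ pz₁) (perp-* (- β) pz)
         ; 2F → perp-+ (perp-* δ ptz₁) (perp-* (- β) ptz)
         ; 3F → perp-+ (perp-* (- γ) ptz₁) (perp-* α ptz) })

    d₂ = proj₁ dep₂

    q : Quadratic
    q = W μ ƛ * d₂ 1F , W μ ƛ * d₂ 2F , W μ ƛ * d₂ 3F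

    k : Carrier
    k = - d₂ 0F

    zq : ∀ i → z i * at₂ q (t i) ≡ k * at ƛ (t i)
    zq i = *-cancelˡ (a≢0 i) (linear₂ (at ƛ (t i))
      (a i * (d₂ 1F * δ + d₂ 2F * δ * t i - d₂ 3F * γ * t i))
      (solve 12 (λ a t z z₁ α β γ δ d₀ d₁ d₂ d₃ →
        a ⊗ (z ⊗ ((α ⊗ δ ⊖ β ⊗ γ) ⊗ d₁ ⊕ (α ⊗ δ ⊖ β ⊗ γ) ⊗ d₂ ⊗ t ⊕ (α ⊗ δ ⊖ β ⊗ γ) ⊗ d₃ ⊗ (t ⊗ t)))
          ⊖ a ⊗ ((⊝ d₀) ⊗ (γ ⊕ δ ⊗ t)) ⊜
        (γ ⊕ δ ⊗ t) ⊗ (d₀ ⊗ a ⊕ (d₁ ⊗ (δ ⊗ (a ⊗ z₁) ⊕ (⊝ β) ⊗ (a ⊗ z)) ⊕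
          (d₂ ⊗ (δ ⊗ (a ⊗ t ⊗ z₁) ⊕ (⊝ β) ⊗ (a ⊗ t ⊗ z)) ⊕
          (d₃ ⊗ ((⊝ γ) ⊗ (a ⊗ t ⊗ z₁) ⊕ α ⊗ (a ⊗ t ⊗ z)) ⊕ con 0))) ⊖ con 0) ⊕
        a ⊗ (d₁ ⊗ δ ⊕ d₂ ⊗ δ ⊗ t ⊖ d₃ ⊗ γ ⊗ t) ⊗ ((α ⊕ β ⊗ t) ⊗ z ⊖ (γ ⊕ δ ⊗ t) ⊗ z₁))
        refl (a i) (t i) (z i) (z₁ i) α β γ δ (d₂ 0F) (d₂ 1F) (d₂ 2F) (d₂ 3F))
      (proj₂ (proj₂ dep₂) i) (slope i))

    q≢0 : ¬ (∀ i → at₂ q (t i) ≡ 0#)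
    q≢0 zeros = contradiction-d (proj₁ (proj₂ dep₂))
      (quadratic-zero q t₃ t₃-inj (zeros ∘ first-three))
      where
      k≡0 : k ≡ 0#
      k≡0 = *-cancelˡ-0 (at-ƛ≢0 0F) (trans (*-comm _ k) (trans (sym (zq 0F)) (trans (cong (z 0F *_) (zeros 0F)) (zeroʳ (z 0F)))))
      contradiction-d : (∃ λ j → d₂ j ≢ 0#) → ¬ All (_≡ 0#) (W μ ƛ * d₂ 1F ∷ W μ ƛ * d₂ 2F ∷ W μ ƛ * d₂ 3F ∷ [])
      contradiction-d (0F , d≢0) _               = d≢0 (neg-≡0 k≡0)
      contradiction-d (1F , d≢0) (p ∷ _)         = d≢0 (*-cancelˡ-0 Wμƛ≢0 p)
      contradiction-d (2F , d≢0) (_ ∷ p ∷ _)     = d≢0 (*-cancelˡ-0 Wμƛ≢0 p)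
      contradiction-d (3F , d≢0) (_ ∷ _ ∷ p ∷ _) = d≢0 (*-cancelˡ-0 Wμƛ≢0 p)

    -- What remains of `zz₃` when z₁ / z and σ z₂ / z₂ are replaced by μ / ƛ and μ₂ / ƛ₂. It has
    -- degree two in t and vanishes at every t i, hence identically.
    F : Quadratic
    F = ƛ₂ · ƛ ⊟ (μ₂ · ƛ ⊟ μ₂ · μ)

    F-root : ∀ i → at₂ F (t i) ≡ 0#
    F-root i = begin
      at₂ F (t i)
        ≡⟨ trans (at₂-⊟ (ƛ₂ · ƛ) _ _) (cong₂ _-_ (at₂-· ƛ₂ ƛ _) (trans (at₂-⊟ (μ₂ · ƛ) (μ₂ · μ) _) (cong₂ _-_ (at₂-· μ₂ ƛ _) (at₂-· μ₂ μ _)))) ⟩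
      at ƛ₂ (t i) * at ƛ (t i) - (at μ₂ (t i) * at ƛ (t i) - at μ₂ (t i) * at μ (t i))
        ≡⟨ *-cancelˡ (*-≢0 (σ-≢0 (σ-≢0 (z≢0 i))) (z≢0 i)) (linear₃
             (- (at ƛ (t i) - at μ (t i)) * z i) (at ƛ₂ (t i) * σ (z₂ i)) (at ƛ₂ (t i) * at ƛ (t i))
             (solve 8 (λ l m l₂ m₂ z z₁ z₂ z₃ →
               z₂ ⊗ z ⊗ (l₂ ⊗ l ⊖ (m₂ ⊗ l ⊖ m₂ ⊗ m)) ⊖ z₂ ⊗ z ⊗ con 0 ⊜
               (⊝ (l ⊖ m)) ⊗ z ⊗ (m₂ ⊗ z₂ ⊖ l₂ ⊗ z₃) ⊕ l₂ ⊗ z₃ ⊗ (m ⊗ z ⊖ l ⊗ z₁) ⊕ l₂ ⊗ l ⊗ (z₂ ⊗ z ⊖ z₃ ⊗ (z ⊖ z₁)))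
               refl (at ƛ (t i)) (at μ (t i)) (at ƛ₂ (t i)) (at μ₂ (t i)) (z i) (z₁ i) (z₂ i) (σ (z₂ i)))
             (slope₂ i) (slope i) (zz₃ i)) ⟩
      0# ∎

    F-identity : ∀ R → W ƛ₂ R * W ƛ R ≡ W μ₂ R * (W ƛ R - W μ R)
    F-identity R = linear₁ 1#
      (begin
        W ƛ₂ R * W ƛ R - W μ₂ R * (W ƛ R - W μ R)
          ≡⟨ solve 4 (λ a b c d → a ⊗ b ⊖ c ⊗ (b ⊖ d) ⊜ con 1 ⊗ (a ⊗ b ⊖ (c ⊗ b ⊖ c ⊗ d) ⊖ con 0)) refl (W ƛ₂ R) (W ƛ R) (W μ₂ R) (W μ R) ⟩
        1# * (W ƛ₂ R * W ƛ R - (W μ₂ R * W ƛ R - W μ₂ R * W μ R) - 0#)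
          ≡⟨ cong (λ s → 1# * (s - 0#)) (trans (W₂-⊟ (ƛ₂ · ƛ) _ R) (cong₂ _-_ (W₂-· ƛ₂ ƛ R) (trans (W₂-⊟ (μ₂ · ƛ) (μ₂ · μ) R) (cong₂ _-_ (W₂-· μ₂ ƛ R) (W₂-· μ₂ μ R))))) ⟨
        1# * (W₂ F R - 0#) ∎)
      (quadratic-W-zero F t₃ t₃-inj (F-root ∘ first-three) R)

    -- The polynomial in t with values ƛ ƛ₁ z₂, obtained from `zz₂` on multiplication by ƛ ƛ₁ / z.
    E : Quadratic
    E = μ · ƛ₁ ⊟ ƛ · ƛ₁ ⊟ μ · μ₁

    E-at : ∀ i → at₂ E (t i) ≡ at ƛ (t i) * at ƛ₁ (t i) * z₂ i
    E-at i = begin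
      at₂ E (t i)
        ≡⟨ trans (at₂-⊟ (μ · ƛ₁ ⊟ ƛ · ƛ₁) (μ · μ₁) _) (cong₂ _-_ (trans (at₂-⊟ (μ · ƛ₁) (ƛ · ƛ₁) _) (cong₂ _-_ (at₂-· μ ƛ₁ _) (at₂-· ƛ ƛ₁ _))) (at₂-· μ μ₁ _)) ⟩
      at μ (t i) * at ƛ₁ (t i) - at ƛ (t i) * at ƛ₁ (t i) - at μ (t i) * at μ₁ (t i)
        ≡⟨ *-cancelˡ (z≢0 i) (linear₃ (at ƛ₁ (t i) - at μ₁ (t i)) (- at ƛ (t i)) (- (at ƛ (t i) * at ƛ₁ (t i)))
             (solve 7 (λ l m l₁ m₁ z z₁ z₂ →
               z ⊗ (m ⊗ l₁ ⊖ l ⊗ l₁ ⊖ m ⊗ m₁) ⊖ z ⊗ (l ⊗ l₁ ⊗ z₂) ⊜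
               (l₁ ⊖ m₁) ⊗ (m ⊗ z ⊖ l ⊗ z₁) ⊕ (⊝ l) ⊗ (m₁ ⊗ z₁ ⊖ l₁ ⊗ z₂) ⊕ (⊝ (l ⊗ l₁)) ⊗ (z ⊗ z₂ ⊖ (z₁ ⊖ z ⊖ z₂)))
               refl (at ƛ (t i)) (at μ (t i)) (at ƛ₁ (t i)) (at μ₁ (t i)) (z i) (z₁ i) (z₂ i))
             (slope i) (slope₁ i) (zz₂ i)) ⟩
      at ƛ (t i) * at ƛ₁ (t i) * z₂ i ∎

    E≢0 : ¬ (∀ s → at₂ E s ≡ 0#)
    E≢0 zeros = *-≢0 (*-≢0 (at-ƛ≢0 0F) (λ eq → σ-≢0 (at-ƛ≢0 0F) (trans (σ-at ƛ 0F) eq))) (σ-≢0 (σ-≢0 (z≢0 0F)))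
      (trans (sym (E-at 0F)) (zeros (t 0F)))

    W-E : ∀ R → W₂ E R ≡ W μ R * W ƛ₁ R - W ƛ R * W ƛ₁ R - W μ R * W μ₁ R
    W-E R = trans (W₂-⊟ (μ · ƛ₁ ⊟ ƛ · ƛ₁) (μ · μ₁) R)
      (cong₂ _-_ (trans (W₂-⊟ (μ · ƛ₁) (ƛ · ƛ₁) R) (cong₂ _-_ (W₂-· μ ƛ₁ R) (W₂-· ƛ ƛ₁ R))) (W₂-· μ μ₁ R))

    -- Since q = k ƛ / z and z₂ / z = μ μ₁ / (ƛ ƛ₁), the product of q and E agrees with k ƛ μ μ₁ at
    -- the parameters. Five of the six settle an identity of degree four.
    qE : ∀ R → W₂ q R * W₂ E R ≡ k * (proj₂ R * (W ƛ R * W₂ (μ · μ₁) R))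
    qE = quartic-identity q E k ƛ (μ · μ₁) (t ∘ suc) (Fin.suc-injective ∘ t-inj) λ i → let j = suc i in begin
      at₂ q (t j) * at₂ E (t j)
        ≡⟨ cong (at₂ q (t j) *_) (E-at j) ⟩
      at₂ q (t j) * (at ƛ (t j) * at ƛ₁ (t j) * z₂ j)
        ≡⟨ *-cancelˡ (z≢0 j) (linear₃ (at ƛ (t j) * at ƛ₁ (t j) * z₂ j) (- (k * at ƛ (t j) * at μ₁ (t j))) (- (k * at ƛ (t j) * at ƛ (t j)))
             (solve 9 (λ q k l m l₁ m₁ z z₁ z₂ →
               z ⊗ (q ⊗ (l ⊗ l₁ ⊗ z₂)) ⊖ z ⊗ (k ⊗ (l ⊗ (m ⊗ m₁))) ⊜
               l ⊗ l₁ ⊗ z₂ ⊗ (z ⊗ q ⊖ k ⊗ l) ⊕ (⊝ (k ⊗ l ⊗ m₁)) ⊗ (m ⊗ z ⊖ l ⊗ z₁) ⊕ (⊝ (k ⊗ l ⊗ l)) ⊗ (m₁ ⊗ z₁ ⊖ l₁ ⊗ z₂))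
               refl (at₂ q (t j)) k (at ƛ (t j)) (at μ (t j)) (at ƛ₁ (t j)) (at μ₁ (t j)) (z j) (z₁ j) (z₂ j))
             (zq j) (slope j) (slope₁ j)) ⟩
      k * (at ƛ (t j) * (at μ (t j) * at μ₁ (t j)))
        ≡⟨ cong (λ s → k * (at ƛ (t j) * s)) (at₂-· μ μ₁ (t j)) ⟨
      k * (at ƛ (t j) * at₂ (μ · μ₁) (t j)) ∎

    -- At the root of ƛ, the identity F = 0 leaves the product of W μ₂ ƛ and W μ ƛ. So μ₂ is
    -- proportional to ƛ, and the roots of μ, μ₁ and ƛ, which occur in `qE`, are those of three
    -- successive conjugates of μ.
    Wμ₂ƛ≡0 : W μ₂ ƛ ≡ 0#
    Wμ₂ƛ≡0 = *-cancelˡ-0 Wμƛ≢0 (linear₂ 1# (W μ₂ ƛ - W ƛ₂ ƛ)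
      (solve 4 (λ a b c d → a ⊗ b ⊖ con 0 ⊜ con 1 ⊗ (c ⊗ d ⊖ b ⊗ (d ⊖ a)) ⊕ (b ⊖ c) ⊗ (d ⊖ con 0)) refl (W μ ƛ) (W μ₂ ƛ) (W ƛ₂ ƛ) (W ƛ ƛ))
      (F-identity ƛ) (W-self ƛ))

    Wƛμ₂≡0 : W ƛ μ₂ ≡ 0#
    Wƛμ₂≡0 = W-antisym {μ₂} {ƛ} Wμ₂ƛ≡0

    Wμμ₂≢0 : W μ μ₂ ≢ 0#
    Wμμ₂≢0 eq = Wμƛ≢0 (W-trans {μ₂} {μ} {ƛ} (nonzero {ƛ₂} {μ₂} (σ-W-≢0 ƛ₁ μ₁ (σ-W-≢0 ƛ μ Wƛμ≢0))) (W-antisym {μ} {μ₂} eq) Wμ₂ƛ≡0)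

    Wμμ₁≢0 : W μ μ₁ ≢ 0#
    Wμμ₁≢0 eq = Wμμ₂≢0 (W-trans {μ₁} {μ} {μ₂} (nonzero {ƛ₁} {μ₁} (σ-W-≢0 ƛ μ Wƛμ≢0)) (W-antisym {μ} {μ₁} eq) (σ-W-≡0 μ μ₁ eq))

    Wμ₁μ₂≢0 : W μ₁ μ₂ ≢ 0#
    Wμ₁μ₂≢0 = σ-W-≢0 μ μ₁ Wμμ₁≢0

    Wƛμ₁≢0 : W ƛ μ₁ ≢ 0#
    Wƛμ₁≢0 eq = Wμ₁μ₂≢0 (W-trans {ƛ} {μ₁} {μ₂} (nonzero {μ} {ƛ} Wμƛ≢0) eq Wƛμ₂≡0)

    product-zero : ∀ {R} → W ƛ R * (W μ R * W μ₁ R) ≡ 0# → W₂ q R * W₂ E R ≡ 0#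
    product-zero {R} eq = trans (qE R) (trans (cong (λ s → k * (proj₂ R * s)) (trans (cong (W ƛ R *_) (W₂-· μ μ₁ R)) eq))
      (solve 2 (λ k r → k ⊗ (r ⊗ con 0) ⊜ con 0) refl k (proj₂ R)))

    root₀ : W₂ q μ * W₂ E μ ≡ 0#
    root₀ = product-zero {μ} (trans (cong (λ s → W ƛ μ * (s * W μ₁ μ)) (W-self μ)) (solve 2 (λ a b → a ⊗ (con 0 ⊗ b) ⊜ con 0) refl _ _))

    root₁ : W₂ q μ₁ * W₂ E μ₁ ≡ 0#
    root₁ = product-zero {μ₁} (trans (cong (λ s → W ƛ μ₁ * (W μ μ₁ * s)) (W-self μ₁)) (solve 2 (λ a b → a ⊗ (b ⊗ con 0) ⊜ con 0) refl _ _))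

    root₂ : W₂ q μ₂ * W₂ E μ₂ ≡ 0#
    root₂ = product-zero {μ₂} (trans (cong (λ s → s * (W μ μ₂ * W μ₁ μ₂)) Wƛμ₂≡0) (zeroˡ _))

    E₀ : W₂ E μ ≡ - (W ƛ μ * W ƛ₁ μ)
    E₀ = trans (W-E μ) (trans (cong (λ s → s * W ƛ₁ μ - W ƛ μ * W ƛ₁ μ - s * W μ₁ μ) (W-self μ))
      (solve 3 (λ a b c → con 0 ⊗ b ⊖ a ⊗ b ⊖ con 0 ⊗ c ⊜ ⊝ (a ⊗ b)) refl _ _ _))

    E₁ : W₂ E μ₁ ≡ - ((W ƛ μ₁ - W μ μ₁) * W ƛ₁ μ₁)
    E₁ = trans (W-E μ₁) (trans (cong (λ s → W μ μ₁ * W ƛ₁ μ₁ - W ƛ μ₁ * W ƛ₁ μ₁ - W μ μ₁ * s) (W-self μ₁))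
      (solve 3 (λ a b c → b ⊗ c ⊖ a ⊗ c ⊖ b ⊗ con 0 ⊜ ⊝ ((a ⊖ b) ⊗ c)) refl _ _ _))

    E₂ : W₂ E μ₂ ≡ W μ μ₂ * (W ƛ₁ μ₂ - W μ₁ μ₂)
    E₂ = trans (W-E μ₂) (trans (cong (λ s → W μ μ₂ * W ƛ₁ μ₂ - s * W ƛ₁ μ₂ - W μ μ₂ * W μ₁ μ₂) Wƛμ₂≡0)
      (solve 3 (λ a b c → a ⊗ b ⊖ con 0 ⊗ b ⊖ a ⊗ c ⊜ a ⊗ (b ⊖ c)) refl _ _ _))

    σ-difference : σ (W ƛ μ₁ - W μ μ₁) ≡ W ƛ₁ μ₂ - W μ₁ μ₂
    σ-difference = trans (σ-minus _ _) (cong₂ _-_ (σ-W ƛ μ₁) (σ-W μ μ₁))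

    -≡0 : ∀ {u} → u ≡ 0# → - u ≡ 0#
    -≡0 refl = -0#≈0#

    -- The product of q and E vanishes at the three different roots of μ, μ₁ and μ₂. By `F-identity`
    -- at μ₁, W ƛ₁ μ vanishes together with W ƛ μ₁ - W μ μ₁, so that E vanishes at all three roots
    -- or at none of them; in the second case q vanishes at all three.
    final : ⊥
    final with W ƛ₁ μ ≟ 0#
    ... | yes eq = E≢0 (three-roots E {μ} {μ₁} {μ₂} Wμμ₁≢0 Wμμ₂≢0 Wμ₁μ₂≢0
        (trans E₀ (-≡0 (trans (cong (W ƛ μ *_) eq) (zeroʳ _))))
        (trans E₁ (-≡0 (trans (cong (_* W ƛ₁ μ₁) difference) (zeroˡ _))))
        (trans E₂ (trans (cong (W μ μ₂ *_) (trans (sym σ-difference) (trans (cong σ difference) 0#-homo))) (zeroʳ _))))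
      where
      difference : W ƛ μ₁ - W μ μ₁ ≡ 0#
      difference = *-cancelˡ-0 (λ eq′ → Wμ₁μ₂≢0 (W-antisym {μ₂} {μ₁} eq′))
        (trans (sym (F-identity μ₁)) (trans (cong (_* W ƛ μ₁) (σ-W-≡0 ƛ₁ μ eq)) (zeroˡ _)))
    ... | no neq = q≢0 λ i → three-roots q {μ} {μ₁} {μ₂} Wμμ₁≢0 Wμμ₂≢0 Wμ₁μ₂≢0
        (q-root root₀ λ E≡0 → *-≢0 Wƛμ≢0 neq (neg-≡0 (trans (sym E₀) E≡0)))
        (q-root root₁ λ E≡0 → *-≢0 difference (σ-W-≢0 ƛ μ Wƛμ≢0) (neg-≡0 (trans (sym E₁) E≡0)))
        (q-root root₂ λ E≡0 → *-≢0 Wμμ₂≢0 (σ-≢0 difference) (trans (cong (W μ μ₂ *_) σ-difference) (trans (sym E₂) E≡0))) (t i)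
      where
      q-root : ∀ {u v} → u * v ≡ 0# → v ≢ 0# → u ≡ 0#
      q-root eq v≢0 = *-cancelˡ-0 v≢0 (trans (*-comm _ _) eq)
      difference : W ƛ μ₁ - W μ μ₁ ≢ 0#
      difference eq = *-≢0 (σ-W-≢0 ƛ₁ μ neq) Wƛμ₁≢0 (trans (F-identity μ₁) (trans (cong (W μ₂ μ₁ *_) eq) (zeroʳ _)))

-- Two relations between seven points.

module SevenPoints (S : CyclicSextic) where

  open CyclicSextic S
  open FieldProperties K
  open Torus S
  open Conics S
  open T
  open Perp
  open Relation
  open IsRingHomomorphism isHomomorphism using (+-homo; *-homo; -‿homo; 0#-homo; 1#-homo)

  private
    variable
      n : ℕ

  σ-⁻¹ : ∀ {x} → x ≢ 0# → σ x ≡ x → σ (x ⁻¹) ≡ x ⁻¹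
  σ-⁻¹ {x} x≢0 fix = *-cancelˡ x≢0 (begin
    x * σ (x ⁻¹)    ≡⟨ cong (_* σ (x ⁻¹)) fix ⟨
    σ x * σ (x ⁻¹)  ≡⟨ *-homo x (x ⁻¹) ⟨
    σ (x * x ⁻¹)    ≡⟨ cong σ (*-inverseʳ x≢0) ⟩
    σ 1#            ≡⟨ 1#-homo ⟩
    1#              ≡⟨ *-inverseʳ x≢0 ⟨
    x * x ⁻¹        ∎)

  sum-punchIn : ∀ (f : Fin (suc n) → Carrier) i → f i ≡ 0# → sum (f ∘ punchIn i) ≡ sum f
  sum-punchIn f i eq = sym (trans (sum-remove {i = i} f) (trans (cong (_+ sum (f ∘ punchIn i)) eq) (+-identityˡ _)))

  0-term : ∀ {u v} → u ≡ 0# → u * v ≡ 0#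
  0-term {v = v} refl = zeroˡ v

  relation-punchIn : ∀ {a x : Fin (suc n) → Carrier} i → a i ≡ 0# → Relation a x →
    Relation (a ∘ punchIn i) (x ∘ punchIn i)
  relation-punchIn {a = a} {x} i ai≡0 r = record
    { fixed    = fixed r ∘ punchIn i
    ; weights  = trans (sum-punchIn a i ai≡0) (weights r)
    ; combined = trans (sum-punchIn (λ j → a j * x j) i (0-term ai≡0)) (combined r)
    }

  relation-+* : ∀ {a b x : Fin n → Carrier} {s} → σ s ≡ s → Relation a x → Relation b x →
    Relation (λ i → b i + s * a i) x
  relation-+* {n} {a} {b} {x} {s} σs r r′ = record
    { fixed    = λ i → trans (+-homo _ _) (cong₂ _+_ (fixed r′ i) (trans (*-homo s (a i)) (cong₂ _*_ σs (fixed r i))))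
    ; weights  = sum-+ {n} _ _ (weights r′) (sum-* {n} s _ (weights r))
    ; combined = trans
        (sum-cong-≗ λ i → solve 4 (λ a b s x → (b ⊕ s ⊗ a) ⊗ x ⊜ b ⊗ x ⊕ s ⊗ (a ⊗ x)) refl (a i) (b i) s (x i))
        (sum-+ {n} _ _ (combined r′) (sum-* {n} s _ (combined r)))
    }

  relation-scale : ∀ {a x : Fin n → Carrier} y → Relation a x → Relation a (λ i → y * x i)
  relation-scale {n} {a} {x} y r = record
    { fixed    = fixed r
    ; weights  = weights r
    ; combined = trans
        (sum-cong-≗ λ i → solve 3 (λ a x y → a ⊗ (y ⊗ x) ⊜ y ⊗ (a ⊗ x)) refl (a i) (x i) y)
        (sum-* {n} y _ (combined r))
    }

  perp-suc : ∀ {x c : Fin (suc n) → Carrier} → Perp x c → c zero ≡ 0# → Perp (x ∘ suc) (c ∘ suc)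
  perp-suc {x = x} {c} p c₀≡0 .at k = trans (sum-punchIn (λ i → c i * V k (x i)) zero (0-term c₀≡0)) (at p k)

  module _ {x : Fin n → Carrier} {a : Fin n → Carrier} (r : Relation a x) (tx : ∀ i → T (x i)) where

    perp-z : Perp x (λ i → a i * (x i - 1#))
    perp-z = perp-cong
      (λ i → solve 2 (λ a x → a ⊗ (x ⊖ con 1) ⊜ a ⊗ x ⊕ (⊝ con 1) ⊗ a) refl (a i) (x i))
      (perp-+ (relation-perp-x r tx) (perp-* (- 1#) (relation-perp r tx)))

    perp-σz : Perp x (λ i → a i * σ (x i - 1#))
    perp-σz = perp-cong
      (λ i → trans (cong (a i *_) (σ-minus-1 (x i)))
        (solve 2 (λ a x → a ⊗ (x ⊖ con 1) ⊜ a ⊗ x ⊕ (⊝ con 1) ⊗ a) refl (a i) (σ (x i))))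
      (perp-+ (relation-perp-σx r tx) (perp-* (- 1#) (relation-perp r tx)))

  module _ {x : Fin 7 → Carrier} (tx : ∀ i → T (x i)) (x-inj : Injective _≡_ _≡_ x) where

    -- What is left is a relation between five points.
    two-zeros⇒zero : ∀ {c i j} → Relation c x → i ≢ j → c i ≡ 0# → c j ≡ 0# → ∀ k → c k ≡ 0#
    two-zeros⇒zero {c} {i} {j} r i≢j ci≡0 cj≡0 k with i Fin.≟ k
    ... | yes refl = ci≡0
    ... | no i≢k = trans (cong c (sym (Fin.punchIn-punchOut i≢k))) (inner (punchOut i≢k))
      where
      j′ = punchOut i≢j

      cj′≡0 : c (punchIn i j′) ≡ 0#
      cj′≡0 = trans (cong c (Fin.punchIn-punchOut i≢j)) cj≡0

      inner : ∀ k → c (punchIn i k) ≡ 0#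
      inner k with j′ Fin.≟ k
      ... | yes refl = cj′≡0
      ... | no j′≢k  = trans (cong (c ∘ punchIn i) (sym (Fin.punchIn-punchOut j′≢k)))
        (five-independent (relation-punchIn j′ cj′≡0 (relation-punchIn i ci≡0 r)) (λ _ → tx _)
          (λ eq → Fin.punchIn-injective j′ _ _ (Fin.punchIn-injective i _ _ (x-inj eq))) (punchOut j′≢k))

    -- The parameter t is b / a on the six points other than x₀, where a has no zero. If two of its
    -- values agreed, b - t a would have two zeros and vanish, and b would be zero at x₀ as well as
    -- at x₁. The factors x - 1 and σ (x - 1) kill the term of x₀ = 1; this restricts b to the same
    -- six points although it need not vanish at x₀.
    normalised-contradiction : ∀ {a b} → x 0F ≡ 1# → Relation a x → Relation b x → a 0F ≡ 0# → b 1F ≡ 0# →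
      (∃ λ i → a i ≢ 0#) → (∃ λ i → b i ≢ 0#) → ⊥
    normalised-contradiction {a} {b} x₀≡1 ra rb a₀≡0 b₁≡0 (i₁ , ai₁≢0) (i₂ , bi₂≢0) =
      no-conic (tx ∘ suc) (Fin.suc-injective ∘ x-inj) (λ i eq → contradiction (x-inj (trans eq (sym x₀≡1))) λ ())
        a≢0 t-inj σt
        (relation-perp ra′ (tx ∘ suc))
        (perp-z ra′ (tx ∘ suc)) (perp-σz ra′ (tx ∘ suc))
        (perp-cong (λ i → cong (_* (x (suc i) - 1#)) (at≡b i))
          (perp-suc (perp-z rb tx) (trans (cong (b 0F *_) x₀-1≡0) (zeroʳ _))))
        (perp-cong (λ i → cong (_* σ (x (suc i) - 1#)) (at≡b i))
          (perp-suc (perp-σz rb tx) (trans (cong (b 0F *_) (trans (cong σ x₀-1≡0) 0#-homo)) (zeroʳ _))))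
      where
      ra′ = relation-punchIn 0F a₀≡0 ra

      x₀-1≡0 : x 0F - 1# ≡ 0#
      x₀-1≡0 = x≈y⇒x-y≈0 x₀≡1

      a≢0 : ∀ i → a (suc i) ≢ 0#
      a≢0 i ai≡0 = ai₁≢0 (two-zeros⇒zero ra (λ ()) a₀≡0 ai≡0 i₁)

      t : Fin 6 → Carrier
      t i = b (suc i) * a (suc i) ⁻¹

      at≡b : ∀ i → a (suc i) * t i ≡ b (suc i)
      at≡b i = trans (solve 3 (λ a b a⁻¹ → a ⊗ (b ⊗ a⁻¹) ⊜ b ⊗ (a ⊗ a⁻¹)) refl _ _ _)
        (trans (cong (b (suc i) *_) (*-inverseʳ (a≢0 i))) (*-identityʳ _))

      σt : ∀ i → σ (t i) ≡ t i
      σt i = trans (*-homo _ _) (cong₂ _*_ (fixed rb (suc i)) (σ-⁻¹ (a≢0 i) (fixed ra (suc i))))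

      t-inj : Injective _≡_ _≡_ t
      t-inj {i} {j} ti≡tj with i Fin.≟ j
      ... | yes i≡j = i≡j
      ... | no i≢j = contradiction (two-zeros⇒zero rb (λ ()) b₁≡0 b₀≡0 i₂) bi₂≢0
        where
        c-zero : ∀ k → t i ≡ t k → b (suc k) + - t i * a (suc k) ≡ 0#
        c-zero k eq = trans (cong (λ s → b (suc k) + - s * a (suc k)) eq)
          (linear₁ (- 1#) (solve 3 (λ a b t → b ⊕ (⊝ t) ⊗ a ⊖ con 0 ⊜ (⊝ con 1) ⊗ (a ⊗ t ⊖ b)) refl (a (suc k)) (b (suc k)) (t k)) (at≡b k))

        b₀≡0 : b 0F ≡ 0#
        b₀≡0 = linear₂ 1# (t i)
          (solve 3 (λ a b t → b ⊖ con 0 ⊜ con 1 ⊗ (b ⊕ (⊝ t) ⊗ a ⊖ con 0) ⊕ t ⊗ (a ⊖ con 0)) refl (a 0F) (b 0F) (t i))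
          (two-zeros⇒zero (relation-+* (trans (-‿homo (t i)) (cong -_ (σt i))) ra rb)
            (i≢j ∘ Fin.suc-injective) (c-zero i refl) (c-zero j ti≡tj) 0F)
          a₀≡0

  -- Relations survive multiplication of all points by one factor, and τ x₀, the inverse of the
  -- first point, moves that point to 1.
  seven-points : {x a b : Fin 7 → Carrier} → (∀ i → T (x i)) → Injective _≡_ _≡_ x →
    Relation a x → Relation b x → a 0F ≡ 0# → b 1F ≡ 0# → (∃ λ i → a i ≢ 0#) → (∃ λ i → b i ≢ 0#) → ⊥
  seven-points {x} tx x-inj ra rb = normalised-contradiction (λ i → T-* (T-τ (tx 0F)) (tx i))
    (λ eq → x-inj (*-cancelˡ (nonZero (T-τ (tx 0F))) eq)) (trans (*-comm _ _) (τ-inverse (tx 0F)))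
    (relation-scale _ ra) (relation-scale _ rb)

-- Construction of the cyclic extension of degree six.

mkIsCommutativeRing : {A : Set} (_+_ _*_ : Op₂ A) (-_ : Op₁ A) (0# 1# : A) →
  (∀ x y z → ((x + y) + z) ≡ (x + (y + z))) → (∀ x y → (x + y) ≡ (y + x)) →
  (∀ x → (0# + x) ≡ x) → (∀ x → ((- x) + x) ≡ 0#) →
  (∀ x y z → ((x * y) * z) ≡ (x * (y * z))) → (∀ x y → (x * y) ≡ (y * x)) →
  (∀ x → (1# * x) ≡ x) → (∀ x y z → (x * (y + z)) ≡ ((x * y) + (x * z))) →
  IsCommutativeRing _≡_ _+_ _*_ -_ 0# 1#
mkIsCommutativeRing _+_ _*_ -_ 0# 1# +-assoc +-comm +-identityˡ -‿inverseˡ *-assoc *-comm *-identityˡ distribˡ = record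
  { isRing = record
    { +-isAbelianGroup = record
      { isGroup = record
        { isMonoid = record
          { isSemigroup = record
            { isMagma = record { isEquivalence = ≡.isEquivalence ; ∙-cong = cong₂ _+_ }
            ; assoc = +-assoc }
          ; identity = +-identityˡ , λ x → trans (+-comm x 0#) (+-identityˡ x) }
        ; inverse = -‿inverseˡ , λ x → trans (+-comm x (- x)) (-‿inverseˡ x)
        ; ⁻¹-cong = cong -_ }
      ; comm = +-comm }
    ; *-cong = cong₂ _*_
    ; *-assoc = *-assoc
    ; *-identity = *-identityˡ , λ x → trans (*-comm x 1#) (*-identityˡ x)
    ; distrib = distribˡ , λ x y z → trans (*-comm (y + z) x)
        (trans (distribˡ x y z) (cong₂ _+_ (*-comm x y) (*-comm x z))) }
  ; *-comm = *-comm
  }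

module _ (R S : Field) {φ : Field.Carrier R → Field.Carrier S} where

  private
    module R = Field R
    module S = Field S

  mkIsRingHomomorphism : (∀ x y → φ (x R.+ y) ≡ φ x S.+ φ y) → (∀ x y → φ (x R.* y) ≡ φ x S.* φ y) →
    (∀ x → φ (R.- x) ≡ S.- φ x) → φ R.0# ≡ S.0# → φ R.1# ≡ S.1# → IsRingHomomorphism R.rawRing S.rawRing φ
  mkIsRingHomomorphism +-homo *-homo -‿homo 0#-homo 1#-homo = record
    { isSemiringHomomorphism = record
      { isNearSemiringHomomorphism = record
        { +-isMonoidHomomorphism = record
          { isMagmaHomomorphism = record { isRelHomomorphism = record { cong = cong φ } ; homo = +-homo }
          ; ε-homo = 0#-homo }
        ; *-homo = *-homo }
      ; 1#-homo = 1#-homo }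
    ; -‿homo = -‿homo }

record Triple (A : Set) : Set where
  constructor ⟨_,_,_⟩
  field
    c₀ c₁ c₂ : A

open Triple public

triple-≡ : {A : Set} {x y : Triple A} → c₀ x ≡ c₀ y → c₁ x ≡ c₁ y → c₂ x ≡ c₂ y → x ≡ y
triple-≡ refl refl refl = refl

-- The operations of R[θ] / (θ³ - aθ² - (a + 3)θ - 1), a "simplest cubic" of
-- Shanks: its roots are permuted by θ ↦ -1 / (1 + θ) = θ² - (a + 1)θ - 2.
module CubicOperations (R : RawRing 0ℓ 0ℓ) (a : RawRing.Carrier R) where

  open RawRing R

  a+3 : Carrier
  a+3 = a + 1# + 1# + 1#

  add mul : Op₂ (Triple Carrier)
  add ⟨ x₀ , x₁ , x₂ ⟩ ⟨ y₀ , y₁ , y₂ ⟩ = ⟨ x₀ + y₀ , x₁ + y₁ , x₂ + y₂ ⟩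

  mul ⟨ x₀ , x₁ , x₂ ⟩ ⟨ y₀ , y₁ , y₂ ⟩ =
    ⟨ x₀ * y₀ + d₃ + a * d₄
    , x₀ * y₁ + x₁ * y₀ + a+3 * d₃ + (a * a+3 + 1#) * d₄
    , x₀ * y₂ + x₁ * y₁ + x₂ * y₀ + a * d₃ + (a * a + a+3) * d₄ ⟩
    where
    -- The coefficients of θ³ = aθ² + (a + 3)θ + 1 and θ⁴ = (a² + a + 3)θ² + (a² + 3a + 1)θ + a.
    d₃ = x₁ * y₂ + x₂ * y₁
    d₄ = x₂ * y₂

  neg : Op₁ (Triple Carrier)
  neg ⟨ x₀ , x₁ , x₂ ⟩ = ⟨ - x₀ , - x₁ , - x₂ ⟩

  embed : Carrier → Triple Carrier
  embed x = ⟨ x , 0# , 0# ⟩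

  θ θ′ θ″ : Triple Carrier
  θ  = ⟨ 0# , 1# , 0# ⟩
  θ′ = ⟨ - (1# + 1#) , - (a + 1#) , 1# ⟩
  θ″ = ⟨ a + 1# + 1# , a , - 1# ⟩

  -- Substitution of θ′ for θ, written out in the basis 1, θ, θ².
  ς : Op₁ (Triple Carrier)
  ς ⟨ x₀ , x₁ , x₂ ⟩ =
    ⟨ x₀ - (1# + 1#) * x₁ + (1# + 1# - a) * x₂
    , - ((a + 1#) * x₁) - (a * a + a + 1#) * x₂
    , x₁ + a * x₂ ⟩
    where
    infixl 6 _-_
    _-_ : Op₂ Carrier
    x - y = x + - y

module _ (A : Field) where

  open Field A

  CubicHasNoRoot QuadraticHasNoRoot : Carrier → Set
  CubicHasNoRoot a     = ∀ r → r * r * r - a * (r * r) - (a + 1# + 1# + 1#) * r - 1# ≢ 0#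
  QuadraticHasNoRoot n = ∀ r → r * r - r + n ≢ 0#

-- The operations are generic in a raw ring so that, instantiated with expressions, they produce the
-- very polynomials that the ring solver has to compare.
exprRing : ℕ → RawRing 0ℓ 0ℓ
exprRing n = record { Carrier = Expr ℤ n ; _≈_ = _≡_ ; _+_ = _⊕_ ; _*_ = _⊗_ ; -_ = ⊝_ ; 0# = con 0 ; 1# = con 1 }

-- Equations in the components of triples. The variables are the parameter a
-- and the components of up to three triples x, y and z.
module Components (A : Field) (a : Field.Carrier A) where

  open Field A
  open FieldProperties A

  module C {n : ℕ} = CubicOperations (exprRing (suc n)) (Ι 0F)

  𝕩 : ∀ {n} → Triple (Expr ℤ (4 ℕ.+ n))
  𝕩 = ⟨ Ι 1F , Ι 2F , Ι 3F ⟩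

  𝕪 : ∀ {n} → Triple (Expr ℤ (7 ℕ.+ n))
  𝕪 = ⟨ Ι 4F , Ι 5F , Ι 6F ⟩

  𝕫 : ∀ {n} → Triple (Expr ℤ (10 ℕ.+ n))
  𝕫 = ⟨ Ι 7F , Ι 8F , Ι 9F ⟩

  ρ₁ : Triple Carrier → Vec Carrier 4
  ρ₁ x = a ∷ c₀ x ∷ c₁ x ∷ c₂ x ∷ []

  ρ₂ : Triple Carrier → Triple Carrier → Vec Carrier 7
  ρ₂ x y = a ∷ c₀ x ∷ c₁ x ∷ c₂ x ∷ c₀ y ∷ c₁ y ∷ c₂ y ∷ []

  ρ₃ : Triple Carrier → Triple Carrier → Triple Carrier → Vec Carrier 10
  ρ₃ x y z = a ∷ c₀ x ∷ c₁ x ∷ c₂ x ∷ c₀ y ∷ c₁ y ∷ c₂ y ∷ c₀ z ∷ c₁ z ∷ c₂ z ∷ []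

  prove₃ : ∀ {n} (ρ : Vec Carrier n) (x y : Triple (Expr ℤ n)) →
    ⟦ c₀ x ⇓⟧ ρ ≡ ⟦ c₀ y ⇓⟧ ρ → ⟦ c₁ x ⇓⟧ ρ ≡ ⟦ c₁ y ⇓⟧ ρ → ⟦ c₂ x ⇓⟧ ρ ≡ ⟦ c₂ y ⇓⟧ ρ →
    ⟨ ⟦ c₀ x ⟧ ρ , ⟦ c₁ x ⟧ ρ , ⟦ c₂ x ⟧ ρ ⟩ ≡ ⟨ ⟦ c₀ y ⟧ ρ , ⟦ c₁ y ⟧ ρ , ⟦ c₂ y ⟧ ρ ⟩
  prove₃ ρ x y p q r = triple-≡ (prove ρ (c₀ x) (c₀ y) p) (prove ρ (c₁ x) (c₁ y) q) (prove ρ (c₂ x) (c₂ y) r)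

module Cubic (A : Field) (a : Field.Carrier A) (irreducible : CubicHasNoRoot A a) where

  open Field A
  open FieldProperties A
  open CubicOperations rawRing a
  open Components A a

  isCommutativeRing₃ : IsCommutativeRing _≡_ add mul neg (embed 0#) (embed 1#)
  isCommutativeRing₃ = mkIsCommutativeRing add mul neg (embed 0#) (embed 1#)
    (λ _ _ _ → triple-≡ (+-assoc _ _ _) (+-assoc _ _ _) (+-assoc _ _ _))
    (λ _ _ → triple-≡ (+-comm _ _) (+-comm _ _) (+-comm _ _))
    (λ _ → triple-≡ (+-identityˡ _) (+-identityˡ _) (+-identityˡ _))
    (λ _ → triple-≡ (-‿inverseˡ _) (-‿inverseˡ _) (-‿inverseˡ _))
    (λ x y z → prove₃ (ρ₃ x y z) (C.mul (C.mul 𝕩 𝕪) 𝕫) (C.mul 𝕩 (C.mul 𝕪 𝕫)) refl refl refl)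
    (λ x y → prove₃ (ρ₂ x y) (C.mul 𝕩 𝕪) (C.mul 𝕪 𝕩) refl refl refl)
    (λ x → prove₃ (ρ₁ x) (C.mul (C.embed (con 1)) 𝕩) 𝕩 refl refl refl)
    (λ x y z → prove₃ (ρ₃ x y z) (C.mul 𝕩 (C.add 𝕪 𝕫)) (C.add (C.mul 𝕩 𝕪) (C.mul 𝕩 𝕫)) refl refl refl)

  _≟₃_ : DecidableEquality (Triple Carrier)
  ⟨ x₀ , x₁ , x₂ ⟩ ≟₃ ⟨ y₀ , y₁ , y₂ ⟩ = map′ (λ (p , q , r) → triple-≡ p q r)
    (λ { refl → refl , refl , refl }) (x₀ ≟ y₀ ×-dec x₁ ≟ y₁ ×-dec x₂ ≟ y₂)

  private
    module R = IsCommutativeRing isCommutativeRing₃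

    embed-* : ∀ s t → mul (embed s) (embed t) ≡ embed (s * t)
    embed-* s t = prove₃ (a ∷ s ∷ t ∷ []) (C.mul (C.embed (Ι 1F)) (C.embed (Ι 2F))) (C.embed (Ι 1F ⊗ Ι 2F)) refl refl refl

    scale-to-1 : ∀ {x y s} → mul x y ≡ embed s → s ≢ 0# → mul x (mul y (embed (s ⁻¹))) ≡ embed 1#
    scale-to-1 {x} {y} {s} eq s≢0 = trans (sym (R.*-assoc x y (embed (s ⁻¹)))) (trans (cong (λ z → mul z (embed (s ⁻¹))) eq)
      (trans (embed-* s (s ⁻¹)) (cong embed (*-inverseʳ s≢0))))

    f : Carrier → Carrier
    f r = r * r * r - a * (r * r) - (a + 1# + 1# + 1#) * r - 1#

    𝕗 : ∀ {n} → Expr ℤ (suc n) → Expr ℤ (suc n)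
    𝕗 r = r ⊗ r ⊗ r ⊖ Ι 0F ⊗ (r ⊗ r) ⊖ (Ι 0F ⊕ con 1 ⊕ con 1 ⊕ con 1) ⊗ r ⊖ con 1

    -- θ - r divides f θ - f r = - f r.
    linear-inverse : ∀ e g → e ≢ 0# ⊎ g ≢ 0# → ∃ λ y → mul ⟨ e , g , 0# ⟩ y ≡ embed 1#
    linear-inverse e g nz with g ≟ 0#
    linear-inverse e g (inj₂ g≢0) | yes g≡0  = contradiction g≡0 g≢0
    linear-inverse e g (inj₁ e≢0) | yes refl = _ , scale-to-1 (R.*-identityʳ (embed e)) e≢0
    linear-inverse e g _ | no g≢0 = _ , scale-to-1
      (subst (λ s → mul ⟨ s , g , 0# ⟩ ⟨ r * r - a * r - a+3 , r - a , 1# ⟩ ≡ embed (- (g * f r))) gr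
        (prove₃ (a ∷ r ∷ g ∷ [])
          (C.mul ⟨ ⊝ (Ι 2F ⊗ Ι 1F) , Ι 2F , con 0 ⟩ ⟨ Ι 1F ⊗ Ι 1F ⊖ Ι 0F ⊗ Ι 1F ⊖ C.a+3 , Ι 1F ⊖ Ι 0F , con 1 ⟩)
          (C.embed (⊝ (Ι 2F ⊗ 𝕗 (Ι 1F)))) refl refl refl))
      (λ eq → *-≢0 g≢0 (irreducible r) (neg-≡0 eq))
      where
      r : Carrier
      r = - (e * g ⁻¹)
      gr : - (g * r) ≡ e
      gr = linear₁ e (solve 3 (λ e g h → ⊝ (g ⊗ (⊝ (e ⊗ h))) ⊖ e ⊜ e ⊗ (g ⊗ h ⊖ con 1)) refl e g (g ⁻¹)) (*-inverseʳ g≢0)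

    -- A quadratic times a suitable linear polynomial is congruent to a linear
    -- one modulo f, which is nonzero as f has no linear factor.
    inverse : ∀ x → x ≢ embed 0# → ∃ λ y → mul x y ≡ embed 1#
    inverse x@(⟨ x₀ , x₁ , x₂ ⟩) x≢0 with x₂ ≟ 0#
    ... | yes refl = linear-inverse x₀ x₁ nz
      where
      nz : x₀ ≢ 0# ⊎ x₁ ≢ 0#
      nz with x₀ ≟ 0# | x₁ ≟ 0#
      ... | no p     | _        = inj₁ p
      ... | yes _    | no q     = inj₂ q
      ... | yes refl | yes refl = contradiction refl x≢0
    ... | no x₂≢0 = mul l (proj₁ rec) , (begin
      mul x (mul l (proj₁ rec))          ≡⟨ R.*-assoc x l (proj₁ rec) ⟨
      mul (mul x l) (proj₁ rec)          ≡⟨ cong (λ s → mul s (proj₁ rec)) xl ⟩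
      mul ⟨ e , g , 0# ⟩ (proj₁ rec)     ≡⟨ proj₂ rec ⟩
      embed 1#                           ∎)
      where
      d e g ρ : Carrier
      -- Chosen so that the product of x and l = d + x₂ θ has no term in θ²; that product is e + g
      -- θ.
      d = - (a * x₂ + x₁)
      e = x₀ * d + x₂ * x₂
      g = x₀ * x₂ + x₁ * d + a+3 * (x₂ * x₂)
      ρ = - d * x₂ ⁻¹
      l : Triple Carrier
      l = ⟨ d , x₂ , 0# ⟩
      𝕕 𝕖 𝕘 : ∀ {n} → Expr ℤ (4 ℕ.+ n)
      𝕕 = ⊝ (Ι 0F ⊗ Ι 3F ⊕ Ι 2F)
      𝕖 = Ι 1F ⊗ 𝕕 ⊕ Ι 3F ⊗ Ι 3F
      𝕘 = Ι 1F ⊗ Ι 3F ⊕ Ι 2F ⊗ 𝕕 ⊕ C.a+3 ⊗ (Ι 3F ⊗ Ι 3F)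
      xl : mul x l ≡ ⟨ e , g , 0# ⟩
      xl = prove₃ (ρ₁ x) (C.mul 𝕩 ⟨ 𝕕 , Ι 3F , con 0 ⟩) ⟨ 𝕖 , 𝕘 , con 0 ⟩ refl refl refl
      x₂ρ : x₂ * ρ ≡ - d
      x₂ρ = linear₁ (- d) (solve 3 (λ d x y → x ⊗ (⊝ d ⊗ y) ⊖ ⊝ d ⊜ (⊝ d) ⊗ (x ⊗ y ⊖ con 1)) refl d x₂ (x₂ ⁻¹)) (*-inverseʳ x₂≢0)
      -- As polynomials, the product of x and l is x₂² f + e + g θ, and ρ is the root of l.
      not-both : e ≡ 0# → g ≡ 0# → x₂ * x₂ * f ρ ≡ 0#
      not-both e≡0 g≡0 = linear₃ (x₂ * (ρ * ρ) + x₁ * ρ + x₀) (- 1#) (- ρ)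
        (let r = Ι 4F in prove (a ∷ x₀ ∷ x₁ ∷ x₂ ∷ ρ ∷ [])
          (Ι 3F ⊗ Ι 3F ⊗ 𝕗 r ⊖ con 0)
          ((Ι 3F ⊗ (r ⊗ r) ⊕ Ι 2F ⊗ r ⊕ Ι 1F) ⊗ (Ι 3F ⊗ r ⊖ ⊝ 𝕕) ⊕ (⊝ con 1) ⊗ (𝕖 ⊖ con 0) ⊕ (⊝ r) ⊗ (𝕘 ⊖ con 0)) refl)
        x₂ρ e≡0 g≡0
      nz : e ≢ 0# ⊎ g ≢ 0#
      nz with e ≟ 0# | g ≟ 0#
      ... | no p  | _     = inj₁ p
      ... | yes _ | no q  = inj₂ q
      ... | yes p | yes q = contradiction (not-both p q) (*-≢0 (*-≢0 x₂≢0 x₂≢0) (irreducible ρ))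
      rec : ∃ λ y → mul ⟨ e , g , 0# ⟩ y ≡ embed 1#
      rec = linear-inverse e g nz

    inv : Triple Carrier → Triple Carrier
    inv x with x ≟₃ embed 0#
    ... | yes _  = embed 0#
    ... | no x≢0 = proj₁ (inverse x x≢0)

    inv-inverse : ∀ {x} → x ≢ embed 0# → mul x (inv x) ≡ embed 1#
    inv-inverse {x} x≢0 with x ≟₃ embed 0#
    ... | yes x≡0 = contradiction x≡0 x≢0
    ... | no x≢0′ = proj₂ (inverse x x≢0′)

  cubicField : Field
  cubicField = record
    { Carrier = Triple Carrier ; _+_ = add ; _*_ = mul ; -_ = neg ; 0# = embed 0# ; 1# = embed 1#
    ; isCommutativeRing = isCommutativeRing₃ ; 1≢0 = 1≢0 ∘ cong c₀
    ; _⁻¹ = inv ; *-inverseʳ = inv-inverse ; _≟_ = _≟₃_ }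

  ς-embed : ∀ s → ς (embed s) ≡ embed s
  ς-embed s = prove₃ (a ∷ s ∷ []) (C.ς (C.embed (Ι 1F))) (C.embed (Ι 1F)) refl refl refl

  ς-homo : IsRingHomomorphism (Field.rawRing cubicField) (Field.rawRing cubicField) ς
  ς-homo = mkIsRingHomomorphism cubicField cubicField
    (λ x y → prove₃ (ρ₂ x y) (C.ς (C.add 𝕩 𝕪)) (C.add (C.ς 𝕩) (C.ς 𝕪)) refl refl refl)
    (λ x y → prove₃ (ρ₂ x y) (C.ς (C.mul 𝕩 𝕪)) (C.mul (C.ς 𝕩) (C.ς 𝕪)) refl refl refl)
    (λ x → prove₃ (ρ₁ x) (C.ς (C.neg 𝕩)) (C.neg (C.ς 𝕩)) refl refl refl)
    (ς-embed 0#) (ς-embed 1#)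

  ς³ : ∀ x → ς (ς (ς x)) ≡ x
  ς³ x = prove₃ (ρ₁ x) (C.ς (C.ς (C.ς 𝕩))) 𝕩 refl refl refl

  -- ς x - x is a multiple of θ′ - θ.
  ς-fixed : ∀ x → ς x ≡ x → x ≡ embed (c₀ x)
  ς-fixed x@(⟨ x₀ , x₁ , x₂ ⟩) eq = triple-≡ refl x₁≡0 x₂≡0
    where
    module P = FieldProperties cubicField
    d s : Triple Carrier
    d = ⟨ - (1# + 1#) , - (a + 1# + 1#) , 1# ⟩
    s = ⟨ x₁ - (1# + 1#) * x₂ , - (a * x₂) , x₂ ⟩

    ds : mul d s ≡ add (ς x) (neg x)
    ds = prove₃ (ρ₁ x)
      (C.mul ⟨ ⊝ (con 1 ⊕ con 1) , ⊝ (Ι 0F ⊕ con 1 ⊕ con 1) , con 1 ⟩ ⟨ Ι 2F ⊖ (con 1 ⊕ con 1) ⊗ Ι 3F , ⊝ (Ι 0F ⊗ Ι 3F) , Ι 3F ⟩)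
      (C.add (C.ς 𝕩) (C.neg 𝕩)) refl refl refl

    s≡0 : s ≡ embed 0#
    s≡0 = P.*-cancelˡ-0 (1≢0 ∘ cong c₂) (trans ds (P.x≈y⇒x-y≈0 eq))

    x₂≡0 : x₂ ≡ 0#
    x₂≡0 = cong c₂ s≡0

    x₁≡0 : x₁ ≡ 0#
    x₁≡0 = linear₂ 1# (1# + 1#) (solve 2 (λ x₁ x₂ → x₁ ⊖ con 0 ⊜ con 1 ⊗ (x₁ ⊖ (con 1 ⊕ con 1) ⊗ x₂ ⊖ con 0) ⊕ (con 1 ⊕ con 1) ⊗ (x₂ ⊖ con 0)) refl x₁ x₂)
      (cong c₀ s≡0) x₂≡0

-- The operations of R[w] / (w² - w + n); p , q stands for p + q w.
module QuadraticOperations (R : RawRing 0ℓ 0ℓ) (n : RawRing.Carrier R) where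

  open RawRing R

  Pair : Set
  Pair = Carrier × Carrier

  add mul : Op₂ Pair
  add (p , q) (r , s) = p + r , q + s
  mul (p , q) (r , s) = p * r + - (n * (q * s)) , p * s + q * r + q * s

  -- Conjugation exchanges w with the other root 1 - w. Polynomials of this shape define quadratic
  -- extensions in characteristic two as well as in odd characteristic.
  neg conjugate : Op₁ Pair
  neg (p , q) = - p , - q
  conjugate (p , q) = p + q , - q

  embed : Carrier → Pair
  embed p = p , 0#

module Quadratic (B : Field) (n : Field.Carrier B) (irreducible : QuadraticHasNoRoot B n) where

  open Field B
  open FieldProperties B
  open QuadraticOperations rawRing n

  isCommutativeRing₂ : IsCommutativeRing _≡_ add mul neg (embed 0#) (embed 1#)
  isCommutativeRing₂ = mkIsCommutativeRing add mul neg (embed 0#) (embed 1#)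
    (λ _ _ _ → cong₂ _,_ (+-assoc _ _ _) (+-assoc _ _ _))
    (λ _ _ → cong₂ _,_ (+-comm _ _) (+-comm _ _))
    (λ _ → cong₂ _,_ (+-identityˡ _) (+-identityˡ _))
    (λ _ → cong₂ _,_ (-‿inverseˡ _) (-‿inverseˡ _))
    (λ { (p , q) (r , s) (u , v) → cong₂ _,_
      (solve 7 (λ n p q r s u v → (p ⊗ r ⊖ n ⊗ (q ⊗ s)) ⊗ u ⊖ n ⊗ ((p ⊗ s ⊕ q ⊗ r ⊕ q ⊗ s) ⊗ v) ⊜
        p ⊗ (r ⊗ u ⊖ n ⊗ (s ⊗ v)) ⊖ n ⊗ (q ⊗ (r ⊗ v ⊕ s ⊗ u ⊕ s ⊗ v))) refl n p q r s u v)
      (solve 7 (λ n p q r s u v → (p ⊗ r ⊖ n ⊗ (q ⊗ s)) ⊗ v ⊕ (p ⊗ s ⊕ q ⊗ r ⊕ q ⊗ s) ⊗ u ⊕ (p ⊗ s ⊕ q ⊗ r ⊕ q ⊗ s) ⊗ v ⊜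
        p ⊗ (r ⊗ v ⊕ s ⊗ u ⊕ s ⊗ v) ⊕ q ⊗ (r ⊗ u ⊖ n ⊗ (s ⊗ v)) ⊕ q ⊗ (r ⊗ v ⊕ s ⊗ u ⊕ s ⊗ v)) refl n p q r s u v) })
    (λ { (p , q) (r , s) → cong₂ _,_
      (solve 5 (λ n p q r s → p ⊗ r ⊖ n ⊗ (q ⊗ s) ⊜ r ⊗ p ⊖ n ⊗ (s ⊗ q)) refl n p q r s)
      (solve 4 (λ p q r s → p ⊗ s ⊕ q ⊗ r ⊕ q ⊗ s ⊜ r ⊗ q ⊕ s ⊗ p ⊕ s ⊗ q) refl p q r s) })
    (λ { (p , q) → cong₂ _,_
      (solve 3 (λ n p q → con 1 ⊗ p ⊖ n ⊗ (con 0 ⊗ q) ⊜ p) refl n p q)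
      (solve 2 (λ p q → con 1 ⊗ q ⊕ con 0 ⊗ p ⊕ con 0 ⊗ q ⊜ q) refl p q) })
    (λ { (p , q) (r , s) (u , v) → cong₂ _,_
      (solve 7 (λ n p q r s u v → p ⊗ (r ⊕ u) ⊖ n ⊗ (q ⊗ (s ⊕ v)) ⊜ p ⊗ r ⊖ n ⊗ (q ⊗ s) ⊕ (p ⊗ u ⊖ n ⊗ (q ⊗ v))) refl n p q r s u v)
      (solve 6 (λ p q r s u v → p ⊗ (s ⊕ v) ⊕ q ⊗ (r ⊕ u) ⊕ q ⊗ (s ⊕ v) ⊜
        p ⊗ s ⊕ q ⊗ r ⊕ q ⊗ s ⊕ (p ⊗ v ⊕ q ⊗ u ⊕ q ⊗ v)) refl p q r s u v) })

  norm : Pair → Carrier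
  norm (p , q) = p * p + p * q + n * (q * q)

  -- For q nonzero, the norm of p + q w is q² times the value of the polynomial w² - w + n at - p /
  -- q.
  norm-≢0 : ∀ x → x ≢ embed 0# → norm x ≢ 0#
  norm-≢0 (p , q) x≢0 eq with q ≟ 0#
  ... | yes refl = [ p≢0 , p≢0 ]′ (*≡0 (linear₁ 1# (solve 2 (λ n p → p ⊗ p ⊖ con 0 ⊜ con 1 ⊗ (p ⊗ p ⊕ p ⊗ con 0 ⊕ n ⊗ (con 0 ⊗ con 0) ⊖ con 0)) refl n p) eq))
    where
    p≢0 : p ≢ 0#
    p≢0 p≡0 = x≢0 (cong (_, 0#) p≡0)
  ... | no q≢0 = irreducible r (*-cancelˡ-0 (*-≢0 q≢0 q≢0) (linear₂ 1# (q * r - q - p)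
      (solve 4 (λ n p q r → q ⊗ q ⊗ (r ⊗ r ⊖ r ⊕ n) ⊖ con 0 ⊜ con 1 ⊗ (p ⊗ p ⊕ p ⊗ q ⊕ n ⊗ (q ⊗ q) ⊖ con 0) ⊕ (q ⊗ r ⊖ q ⊖ p) ⊗ (q ⊗ r ⊖ ⊝ p)) refl n p q r)
      eq qr))
    where
    r : Carrier
    r = - p * q ⁻¹
    qr : q * r ≡ - p
    qr = linear₁ (- p) (solve 3 (λ p q y → q ⊗ (⊝ p ⊗ y) ⊖ ⊝ p ⊜ (⊝ p) ⊗ (q ⊗ y ⊖ con 1)) refl p q (q ⁻¹)) (*-inverseʳ q≢0)

  quadraticField : Field
  quadraticField = record
    { Carrier = Pair ; _+_ = add ; _*_ = mul ; -_ = neg ; 0# = embed 0# ; 1# = embed 1#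
    ; isCommutativeRing = isCommutativeRing₂ ; 1≢0 = 1≢0 ∘ cong proj₁
    ; _⁻¹ = λ x → proj₁ (conjugate x) * norm x ⁻¹ , proj₂ (conjugate x) * norm x ⁻¹
    ; *-inverseʳ = λ { {p , q} x≢0 → cong₂ _,_
        (linear₁ 1# (solve 4 (λ n p q y → p ⊗ ((p ⊕ q) ⊗ y) ⊖ n ⊗ (q ⊗ (⊝ q ⊗ y)) ⊖ con 1 ⊜
          con 1 ⊗ ((p ⊗ p ⊕ p ⊗ q ⊕ n ⊗ (q ⊗ q)) ⊗ y ⊖ con 1)) refl n p q (norm (p , q) ⁻¹)) (*-inverseʳ (norm-≢0 (p , q) x≢0)))
        (solve 3 (λ p q y → p ⊗ (⊝ q ⊗ y) ⊕ q ⊗ ((p ⊕ q) ⊗ y) ⊕ q ⊗ (⊝ q ⊗ y) ⊜ con 0) refl p q (norm (p , q) ⁻¹)) }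
    ; _≟_ = ≡-dec _≟_ _≟_ }

-- A cyclic extension of degree six of A, with a basis, a generator w of its
-- quadratic subfield Fix σ² and an element e of trace zero of its cubic
-- subfield Fix τ.
record Extension (A : Field) : Set₁ where
  field
    cyclicSextic : CyclicSextic
  open CyclicSextic cyclicSextic public
  private module A = Field A
  open Torus cyclicSextic public using (σ²; τ)
  field
    ι            : A.Carrier → Carrier
    ι-homo       : IsRingHomomorphism A.rawRing rawRing ι
    σ-ι          : ∀ x → σ (ι x) ≡ ι x
    w            : Carrier
    τ-w          : τ w ≡ 1# - w
    σ²-w         : σ² w ≡ w
    σ²-fixed     : ∀ x → σ² x ≡ x → ∃₂ λ u v → x ≡ ι u + ι v * w
    ι-w-unique   : ∀ {u v u′ v′} → ι u + ι v * w ≡ ι u′ + ι v′ * w → u ≡ u′ × v ≡ v′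
    e            : Carrier
    τ-e          : τ e ≡ e
    trace-e      : e + σ e + σ² e ≡ 0#
    -- Given `trace-e`, this is e² - σe σ²e, the determinant that makes e and σe linearly
    -- independent over Fix σ².
    form-e       : e * e + e * σ e + σ e * σ e ≢ 0#
    coordinate   : Carrier → Fin 6 → A.Carrier
    element      : (Fin 6 → A.Carrier) → Carrier
    coordinate-+ : ∀ x y k → coordinate (x + y) k ≡ coordinate x k A.+ coordinate y k
    coordinate-* : ∀ s x k → coordinate (ι s * x) k ≡ s A.* coordinate x k
    coordinate-element : ∀ f k → coordinate (element f) k ≡ f k
    coordinate-injective : ∀ x y → (∀ k → coordinate x k ≡ coordinate y k) → x ≡ y
    -- A linear map with kernel in the cubic subfield. It replaces x - τ x, which ranges over a
    -- space of dimension three but has six coordinates.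
    skew         : Carrier → Fin 3 → A.Carrier
    skew-+       : ∀ x y k → skew (x + y) k ≡ skew x k A.+ skew y k
    skew-*       : ∀ s x k → skew (ι s * x) k ≡ s A.* skew x k
    skew-zero    : ∀ x → (∀ k → skew x k ≡ A.0#) → τ x ≡ x

module Construction (A : Field) (a n : Field.Carrier A)
  (irreducible₃ : CubicHasNoRoot A a) (irreducible₂ : QuadraticHasNoRoot A n) where


  private
    module A = Field A
    module AP = FieldProperties A
    module C₃ = Cubic A a irreducible₃
    open CubicOperations A.rawRing a using (ς; θ; θ′; θ″) renaming (embed to embed₃; mul to mul₃)
    module B = Field C₃.cubicField
    module BP = FieldProperties C₃.cubicField
    module ς-homo = IsRingHomomorphism C₃.ς-homo
    open Components A a

    embed₃-* : ∀ x y → embed₃ (x A.* y) ≡ embed₃ x B.* embed₃ y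
    embed₃-* x y = prove₃ (a ∷ x ∷ y ∷ []) (C.embed (Ι 1F ⊗ Ι 2F)) (C.mul (C.embed (Ι 1F)) (C.embed (Ι 2F))) refl refl refl

    embed₃-scale : ∀ s x → embed₃ s B.* x ≡ ⟨ s A.* c₀ x , s A.* c₁ x , s A.* c₂ x ⟩
    embed₃-scale s x = prove₃ (a ∷ c₀ x ∷ c₁ x ∷ c₂ x ∷ s ∷ []) (C.mul (C.embed (Ι 4F)) 𝕩) ⟨ Ι 4F ⊗ Ι 1F , Ι 4F ⊗ Ι 2F , Ι 4F ⊗ Ι 3F ⟩ refl refl refl

    -- As ς has odd order, it fixes the roots of a quadratic polynomial over A
    -- that lie in the cubic extension.
    irreducible : QuadraticHasNoRoot C₃.cubicField (embed₃ n)
    irreducible r root = [ fixed , swapped ]′ (BP.*≡0 factored)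
      where
      ς-root : ς r B.* ς r B.- ς r B.+ embed₃ n ≡ B.0#
      ς-root = begin
        ς r B.* ς r B.- ς r B.+ embed₃ n
          ≡⟨ cong₂ B._+_ (cong₂ B._+_ (ς-homo.*-homo r r) (ς-homo.-‿homo r)) (C₃.ς-embed n) ⟨
        ς (r B.* r) B.+ ς (B.- r) B.+ ς (embed₃ n)
          ≡⟨ cong (B._+ ς (embed₃ n)) (ς-homo.+-homo (r B.* r) (B.- r)) ⟨
        ς (r B.* r B.- r) B.+ ς (embed₃ n)
          ≡⟨ ς-homo.+-homo (r B.* r B.- r) (embed₃ n) ⟨
        ς (r B.* r B.- r B.+ embed₃ n)
          ≡⟨ cong ς root ⟩
        ς B.0#
          ≡⟨ ς-homo.0#-homo ⟩
        B.0# ∎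

      factored : (ς r B.- r) B.* (ς r B.+ r B.- B.1#) ≡ B.0#
      factored = BP.linear₂ B.1# (B.- B.1#) (BP.solve 3 (λ r s n → (s ⊖ r) ⊗ (s ⊕ r ⊖ con 1) ⊖ con 0 ⊜
        con 1 ⊗ (s ⊗ s ⊖ s ⊕ n ⊖ con 0) ⊕ (⊝ con 1) ⊗ (r ⊗ r ⊖ r ⊕ n ⊖ con 0)) refl r (ς r) (embed₃ n)) ς-root root

      impossible : ς r ≡ r → embed₃ A.1# ≡ embed₃ A.0#
      impossible ςr≡r = contradiction
        (begin
          c₀ r A.* c₀ r A.- c₀ r A.+ n
            ≡⟨ cong (λ s → c₀ s A.- c₀ r A.+ n) (embed₃-* (c₀ r) (c₀ r)) ⟩
          c₀ (embed₃ (c₀ r) B.* embed₃ (c₀ r) B.- embed₃ (c₀ r) B.+ embed₃ n)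
            ≡⟨ cong (λ s → c₀ (s B.* s B.- s B.+ embed₃ n)) (C₃.ς-fixed r ςr≡r) ⟨
          c₀ (r B.* r B.- r B.+ embed₃ n)
            ≡⟨ cong c₀ root ⟩
          A.0# ∎)
        (irreducible₂ (c₀ r))

      fixed : ς r B.- r ≢ B.0#
      fixed eq = B.1≢0 (impossible (BP.x-y≈0⇒x≈y _ _ eq))

      swapped : ς r B.+ r B.- B.1# ≢ B.0#
      swapped eq = B.1≢0 (impossible (begin
        ς r           ≡⟨ cong ς ς²r ⟨
        ς (ς (ς r))   ≡⟨ C₃.ς³ r ⟩
        r             ∎))
        where
        ςr : ς r ≡ B.1# B.- r
        ςr = BP.linear₁ B.1# (BP.solve 2 (λ r s → s ⊖ (con 1 ⊖ r) ⊜ con 1 ⊗ (s ⊕ r ⊖ con 1 ⊖ con 0)) refl r (ς r)) eq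
        ς²r : ς (ς r) ≡ r
        ς²r = begin
          ς (ς r)              ≡⟨ cong ς ςr ⟩
          ς (B.1# B.- r)       ≡⟨ ς-homo.+-homo B.1# (B.- r) ⟩
          ς B.1# B.+ ς (B.- r) ≡⟨ cong₂ B._+_ ς-homo.1#-homo (ς-homo.-‿homo r) ⟩
          B.1# B.- ς r         ≡⟨ cong (λ s → B.1# B.- s) ςr ⟩
          B.1# B.- (B.1# B.- r) ≡⟨ BP.solve 1 (λ r → con 1 ⊖ (con 1 ⊖ r) ⊜ r) refl r ⟩
          r                    ∎

    module Q = Quadratic C₃.cubicField (embed₃ n) irreducible
    open QuadraticOperations B.rawRing (embed₃ n)
    module K = Field Q.quadraticField

    -- The product of commuting automorphisms of orders three and two: its square is that of ς on
    -- both components, and its cube is conjugation.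
    σ : Pair → Pair
    σ (p , q) = conjugate (ς p , ς q)

    σ-homo : IsRingHomomorphism K.rawRing K.rawRing σ
    σ-homo = mkIsRingHomomorphism Q.quadraticField Q.quadraticField
      (λ { (p , q) (r , s) → trans (cong₂ (λ x y → conjugate (x , y)) (ς-homo.+-homo p r) (ς-homo.+-homo q s))
        (cong₂ _,_
          (BP.solve 4 (λ p q r s → p ⊕ r ⊕ (q ⊕ s) ⊜ p ⊕ q ⊕ (r ⊕ s)) refl (ς p) (ς q) (ς r) (ς s))
          (BP.solve 2 (λ q s → ⊝ (q ⊕ s) ⊜ (⊝ q) ⊕ (⊝ s)) refl (ς q) (ς s))) })
      (λ { (p , q) (r , s) → trans
        (cong₂ (λ x y → conjugate (x , y))
          (begin
            ς (p B.* r B.- embed₃ n B.* (q B.* s))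
              ≡⟨ ς-homo.+-homo (p B.* r) _ ⟩
            ς (p B.* r) B.+ ς (B.- (embed₃ n B.* (q B.* s)))
              ≡⟨ cong₂ B._+_ (ς-homo.*-homo p r) (trans (ς-homo.-‿homo _) (cong B.-_ (trans (ς-homo.*-homo (embed₃ n) (q B.* s)) (cong₂ B._*_ (C₃.ς-embed n) (ς-homo.*-homo q s))))) ⟩
            ς p B.* ς r B.- embed₃ n B.* (ς q B.* ς s) ∎)
          (begin
            ς (p B.* s B.+ q B.* r B.+ q B.* s)
              ≡⟨ trans (ς-homo.+-homo _ _) (cong (B._+ ς (q B.* s)) (ς-homo.+-homo _ _)) ⟩
            ς (p B.* s) B.+ ς (q B.* r) B.+ ς (q B.* s)
              ≡⟨ cong₂ B._+_ (cong₂ B._+_ (ς-homo.*-homo p s) (ς-homo.*-homo q r)) (ς-homo.*-homo q s) ⟩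
            ς p B.* ς s B.+ ς q B.* ς r B.+ ς q B.* ς s ∎))
        (cong₂ _,_
          (BP.solve 5 (λ n p q r s → p ⊗ r ⊖ n ⊗ (q ⊗ s) ⊕ (p ⊗ s ⊕ q ⊗ r ⊕ q ⊗ s) ⊜
            (p ⊕ q) ⊗ (r ⊕ s) ⊖ n ⊗ (⊝ q ⊗ ⊝ s)) refl (embed₃ n) (ς p) (ς q) (ς r) (ς s))
          (BP.solve 4 (λ p q r s → ⊝ (p ⊗ s ⊕ q ⊗ r ⊕ q ⊗ s) ⊜
            (p ⊕ q) ⊗ ⊝ s ⊕ ⊝ q ⊗ (r ⊕ s) ⊕ ⊝ q ⊗ ⊝ s) refl (ς p) (ς q) (ς r) (ς s))) })
      (λ { (p , q) → trans (cong₂ (λ x y → conjugate (x , y)) (ς-homo.-‿homo p) (ς-homo.-‿homo q))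
        (cong (_, (B.- (B.- ς q))) (BP.solve 2 (λ p q → ⊝ p ⊖ q ⊜ ⊝ (p ⊕ q)) refl (ς p) (ς q))) })
      (trans (cong (λ x → conjugate (x , x)) ς-homo.0#-homo) (cong₂ _,_ (B.+-identityˡ B.0#) BP.-0#≈0#))
      (trans (cong₂ (λ x y → conjugate (x , y)) ς-homo.1#-homo ς-homo.0#-homo) (cong₂ _,_ (B.+-identityʳ B.1#) BP.-0#≈0#))

    σσ : ∀ p q → σ (σ (p , q)) ≡ (ς (ς p) , ς (ς q))
    σσ p q = cong₂ _,_
      (trans (cong₂ B._+_ (ς-homo.+-homo (ς p) (ς q)) (ς-homo.-‿homo (ς q)))
        (BP.solve 2 (λ p q → p ⊕ q ⊖ q ⊜ p) refl (ς (ς p)) (ς (ς q))))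
      (trans (cong B.-_ (ς-homo.-‿homo (ς q))) (BP.solve 1 (λ q → ⊝ ⊝ q ⊜ q) refl (ς (ς q))))

    τ-conjugate : ∀ p q → σ (σ (σ (p , q))) ≡ conjugate (p , q)
    τ-conjugate p q = trans (cong σ (σσ p q)) (cong₂ (λ x y → conjugate (x , y)) (C₃.ς³ p) (C₃.ς³ q))

    σ⁶ : ∀ x → σ (σ (σ (σ (σ (σ x))))) ≡ x
    σ⁶ (p , q) = trans (cong (λ x → σ (σ (σ x))) (τ-conjugate p q)) (trans (τ-conjugate (p B.+ q) (B.- q))
      (cong₂ _,_ (BP.solve 2 (λ p q → p ⊕ q ⊖ q ⊜ p) refl p q) (BP.solve 1 (λ q → ⊝ ⊝ q ⊜ q) refl q)))

    ς²-fixed : ∀ x → ς (ς x) ≡ x → x ≡ embed₃ (c₀ x)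
    ς²-fixed x eq = C₃.ς-fixed x (trans (cong ς (sym eq)) (C₃.ς³ x))

    ι : A.Carrier → Pair
    ι x = embed (embed₃ x)

    w e : Pair
    w = B.0# , B.1#
    e = embed (θ B.- θ′)

    embed-* : ∀ p q → embed (p B.* q) ≡ embed p K.* embed q
    embed-* p q = cong₂ _,_
      (BP.solve 3 (λ n p q → p ⊗ q ⊜ p ⊗ q ⊖ n ⊗ (con 0 ⊗ con 0)) refl (embed₃ n) p q)
      (BP.solve 2 (λ p q → con 0 ⊜ p ⊗ con 0 ⊕ con 0 ⊗ q ⊕ con 0 ⊗ con 0) refl p q)

    embed-+ : ∀ p q → embed (p B.+ q) ≡ embed p K.+ embed q
    embed-+ p q = cong (p B.+ q ,_) (sym (B.+-identityˡ B.0#))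

    ι-scale : ∀ s p q → ι s K.* (p , q) ≡ (embed₃ s B.* p , embed₃ s B.* q)
    ι-scale s p q = cong₂ _,_
      (BP.solve 4 (λ n s p q → s ⊗ p ⊖ n ⊗ (con 0 ⊗ q) ⊜ s ⊗ p) refl (embed₃ n) (embed₃ s) p q)
      (BP.solve 3 (λ s p q → s ⊗ q ⊕ con 0 ⊗ p ⊕ con 0 ⊗ q ⊜ s ⊗ q) refl (embed₃ s) p q)

    ι-w : ∀ u v → ι u K.+ ι v K.* w ≡ (embed₃ u , embed₃ v)
    ι-w u v = trans (cong (ι u K.+_) (ι-scale v B.0# B.1#))
      (cong₂ _,_ (BP.solve 2 (λ u v → u ⊕ v ⊗ con 0 ⊜ u) refl (embed₃ u) (embed₃ v))
        (BP.solve 1 (λ v → con 0 ⊕ v ⊗ con 1 ⊜ v) refl (embed₃ v)))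

    embed-injective : ∀ {p q} → embed p ≡ embed q → p ≡ q
    embed-injective = cong proj₁

    σ-embed : ∀ p → σ (embed p) ≡ embed (ς p)
    σ-embed p = trans (cong (λ x → conjugate (ς p , x)) ς-homo.0#-homo)
      (cong₂ _,_ (B.+-identityʳ (ς p)) BP.-0#≈0#)

    e₁ e₂ e₃ : Triple A.Carrier
    e₁ = θ B.- θ′
    e₂ = θ′ B.- θ″
    e₃ = θ″ B.- θ

    𝕖₁ 𝕖₂ 𝕖₃ : Triple (Expr _ 1)
    𝕖₁ = C.add C.θ (C.neg C.θ′)
    𝕖₂ = C.add C.θ′ (C.neg C.θ″)
    𝕖₃ = C.add C.θ″ (C.neg C.θ)

    ςe₁ : ς e₁ ≡ e₂
    ςe₁ = prove₃ (a ∷ []) (C.ς 𝕖₁) 𝕖₂ refl refl refl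

    ςe₂ : ς e₂ ≡ e₃
    ςe₂ = prove₃ (a ∷ []) (C.ς 𝕖₂) 𝕖₃ refl refl refl

    σe : σ e ≡ embed e₂
    σe = trans (σ-embed e₁) (cong embed ςe₁)

    σ²e : σ (σ e) ≡ embed e₃
    σ²e = trans (cong σ σe) (trans (σ-embed e₂) (cong embed ςe₂))

    -- Both sides square to the discriminant of the cubic.
    product-e : e₁ B.* e₂ B.* e₃ ≡ B.- (e₁ B.* e₁ B.+ e₁ B.* e₂ B.+ e₂ B.* e₂)
    product-e = prove₃ (a ∷ []) (C.mul (C.mul 𝕖₁ 𝕖₂) 𝕖₃)
      (C.neg (C.add (C.add (C.mul 𝕖₁ 𝕖₁) (C.mul 𝕖₁ 𝕖₂)) (C.mul 𝕖₂ 𝕖₂))) refl refl refl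

    e₁≢0 : e₁ ≢ B.0#
    e₁≢0 eq = A.1≢0 (AP.linear₁ (A.- A.1#) (AP.solve 0 (con 1 ⊖ con 0 ⊜ (⊝ con 1) ⊗ (con 0 ⊖ con 1 ⊖ con 0)) refl) (cong c₂ eq))

    ς-≢0 : ∀ {x} → x ≢ B.0# → ς x ≢ B.0#
    ς-≢0 {x} x≢0 eq = x≢0 (trans (sym (C₃.ς³ x)) (trans (cong (ς ∘ ς) eq) (trans (cong ς ς-homo.0#-homo) ς-homo.0#-homo)))

    e₂≢0 : e₂ ≢ B.0#
    e₂≢0 eq = ς-≢0 e₁≢0 (trans ςe₁ eq)

    form-e : e K.* e K.+ e K.* σ e K.+ σ e K.* σ e ≢ K.0#
    form-e eq = BP.*-≢0 (BP.*-≢0 e₁≢0 e₂≢0) (λ e₃≡0 → ς-≢0 e₂≢0 (trans ςe₂ e₃≡0))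
      (trans product-e (trans (cong B.-_ (embed-injective (begin
        embed (e₁ B.* e₁ B.+ e₁ B.* e₂ B.+ e₂ B.* e₂)
          ≡⟨ trans (embed-+ _ _) (cong₂ K._+_ (trans (embed-+ _ _) (cong₂ K._+_ (embed-* e₁ e₁) (embed-* e₁ e₂))) (embed-* e₂ e₂)) ⟩
        e K.* e K.+ e K.* embed e₂ K.+ embed e₂ K.* embed e₂
          ≡⟨ cong (λ x → e K.* e K.+ e K.* x K.+ x K.* x) σe ⟨
        e K.* e K.+ e K.* σ e K.+ σ e K.* σ e
          ≡⟨ eq ⟩
        K.0# ∎))) BP.-0#≈0#))

    coordinate : Pair → Fin 6 → A.Carrier
    coordinate (p , q) 0F = c₀ p
    coordinate (p , q) 1F = c₁ p
    coordinate (p , q) 2F = c₂ p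
    coordinate (p , q) 3F = c₀ q
    coordinate (p , q) 4F = c₁ q
    coordinate (p , q) 5F = c₂ q

    skew : Pair → Fin 3 → A.Carrier
    skew (p , q) 0F = c₀ q
    skew (p , q) 1F = c₁ q
    skew (p , q) 2F = c₂ q

  extension : Extension A
  extension = record
    { cyclicSextic = record { K = Q.quadraticField ; σ = σ ; isHomomorphism = σ-homo ; σ⁶ = σ⁶ }
    ; ι = ι
    ; ι-homo = mkIsRingHomomorphism A Q.quadraticField
        (λ x y → cong₂ _,_ (triple-≡ refl (sym (A.+-identityˡ A.0#)) (sym (A.+-identityˡ A.0#))) (sym (B.+-identityˡ B.0#)))
        (λ x y → trans (cong embed (embed₃-* x y)) (embed-* (embed₃ x) (embed₃ y)))
        (λ x → cong₂ _,_ (triple-≡ refl (sym AP.-0#≈0#) (sym AP.-0#≈0#)) (sym BP.-0#≈0#))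
        refl refl
    ; σ-ι = λ x → trans (σ-embed (embed₃ x)) (cong embed (C₃.ς-embed x))
    ; w = w
    ; τ-w = trans (τ-conjugate B.0# B.1#) (cong₂ _,_
        (BP.solve 0 (con 0 ⊕ con 1 ⊜ con 1 ⊖ con 0) refl) (BP.solve 0 (⊝ con 1 ⊜ con 0 ⊖ con 1) refl))
    ; σ²-w = trans (σσ B.0# B.1#) (cong₂ _,_
        (trans (cong ς ς-homo.0#-homo) ς-homo.0#-homo) (trans (cong ς ς-homo.1#-homo) ς-homo.1#-homo))
    ; σ²-fixed = λ { (p , q) eq → c₀ p , c₀ q , trans
        (cong₂ _,_ (ς²-fixed p (cong proj₁ (trans (sym (σσ p q)) eq))) (ς²-fixed q (cong proj₂ (trans (sym (σσ p q)) eq))))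
        (sym (ι-w (c₀ p) (c₀ q))) }
    ; ι-w-unique = λ {u} {v} {u′} {v′} eq → let eq′ = trans (sym (ι-w u v)) (trans eq (ι-w u′ v′)) in
        cong (c₀ ∘ proj₁) eq′ , cong (c₀ ∘ proj₂) eq′
    ; e = e
    ; τ-e = trans (τ-conjugate e₁ B.0#) (cong₂ _,_ (B.+-identityʳ e₁) BP.-0#≈0#)
    ; trace-e = trans (cong₂ (λ x y → e K.+ x K.+ y) σe σ²e) (cong₂ _,_
        (BP.solve 3 (λ x y z → x ⊖ y ⊕ (y ⊖ z) ⊕ (z ⊖ x) ⊜ con 0) refl θ θ′ θ″)
        (BP.solve 0 (con 0 ⊕ con 0 ⊕ con 0 ⊜ con 0) refl))
    ; form-e = form-e
    ; coordinate = coordinate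
    ; element = λ f → ⟨ f 0F , f 1F , f 2F ⟩ , ⟨ f 3F , f 4F , f 5F ⟩
    ; coordinate-+ = λ { x y 0F → refl ; x y 1F → refl ; x y 2F → refl ; x y 3F → refl ; x y 4F → refl ; x y 5F → refl }
    ; coordinate-* = λ { s (p , q) k → trans (cong (λ x → coordinate x k)
          (trans (ι-scale s p q) (cong₂ _,_ (embed₃-scale s p) (embed₃-scale s q)))) (scaled s p q k) }
    ; coordinate-element = λ { f 0F → refl ; f 1F → refl ; f 2F → refl ; f 3F → refl ; f 4F → refl ; f 5F → refl }
    ; coordinate-injective = λ x y eq → cong₂ _,_ (triple-≡ (eq 0F) (eq 1F) (eq 2F)) (triple-≡ (eq 3F) (eq 4F) (eq 5F))
    ; skew = skew
    ; skew-+ = λ { x y 0F → refl ; x y 1F → refl ; x y 2F → refl }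
    ; skew-* = λ { s (p , q) k → trans (cong (λ x → skew x k)
          (trans (ι-scale s p q) (cong₂ _,_ (embed₃-scale s p) (embed₃-scale s q)))) (skew-scaled s p q k) }
    ; skew-zero = λ { (p , q) eq → trans (τ-conjugate p q)
        (trans (cong (λ q → conjugate (p , q)) (q≡0 q p eq)) (trans (cong₂ _,_ (B.+-identityʳ p) BP.-0#≈0#) (cong (p ,_) (sym (q≡0 q p eq))))) }
    }
    where
    scaled : ∀ s p q k → coordinate (⟨ s A.* c₀ p , s A.* c₁ p , s A.* c₂ p ⟩ , ⟨ s A.* c₀ q , s A.* c₁ q , s A.* c₂ q ⟩) k ≡ s A.* coordinate (p , q) k
    scaled s p q 0F = refl
    scaled s p q 1F = refl
    scaled s p q 2F = refl
    scaled s p q 3F = refl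
    scaled s p q 4F = refl
    scaled s p q 5F = refl

    skew-scaled : ∀ s p q k → skew (⟨ s A.* c₀ p , s A.* c₁ p , s A.* c₂ p ⟩ , ⟨ s A.* c₀ q , s A.* c₁ q , s A.* c₂ q ⟩) k ≡ s A.* skew (p , q) k
    skew-scaled s p q 0F = refl
    skew-scaled s p q 1F = refl
    skew-scaled s p q 2F = refl

    q≡0 : ∀ q p → (∀ k → skew (p , q) k ≡ A.0#) → q ≡ B.0#
    q≡0 q p eq = triple-≡ (eq 0F) (eq 1F) (eq 2F)

-- Parametrisation and enumeration of the torus.

module FiniteScalars (A : Field) {q-1 : ℕ} (A↔Fin : Fin (suc q-1) ↔ Field.Carrier A) where

  open Field A
  open Inverse A↔Fin using (to; from; strictlyInverseˡ; strictlyInverseʳ)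

  from-injective : ∀ {x y} → from x ≡ from y → x ≡ y
  from-injective {x} {y} eq = trans (sym (strictlyInverseˡ x)) (trans (cong to eq) (strictlyInverseˡ y))

  to-injective : ∀ {i j} → to i ≡ to j → i ≡ j
  to-injective {i} {j} eq = trans (sym (strictlyInverseʳ i)) (trans (cong from eq) (strictlyInverseʳ j))

  nonzero : Fin q-1 → Carrier
  nonzero i = to (punchIn (from 0#) i)

  nonzero-≢0 : ∀ i → nonzero i ≢ 0#
  nonzero-≢0 i eq = Fin.punchInᵢ≢i (from 0#) i (trans (sym (strictlyInverseʳ _)) (cong from eq))

  nonzero-surjective : ∀ {v} → v ≢ 0# → ∃ λ i → nonzero i ≡ v
  nonzero-surjective {v} v≢0 = punchOut 0≢v , trans (cong to (Fin.punchIn-punchOut 0≢v)) (strictlyInverseˡ v)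
    where
    0≢v : from 0# ≢ from v
    0≢v eq = v≢0 (trans (sym (strictlyInverseˡ v)) (trans (cong to (sym eq)) (strictlyInverseˡ 0#)))

  nonzero-injective : ∀ {i j} → nonzero i ≡ nonzero j → i ≡ j
  nonzero-injective eq = Fin.punchIn-injective _ _ _ (to-injective eq)

module Parametrisation {A : Field} (E : Extension A) where

  private module A = Field A
  open Extension E hiding (σ²; τ)
  open FieldProperties K
  open Torus cyclicSextic
  open T
  open IsRingHomomorphism isHomomorphism using (+-homo; *-homo; -‿homo; 0#-homo; 1#-homo)
  private
    module ι = IsRingHomomorphism ι-homo
    module AP = FieldProperties A

  private
    e₁ e₂ e₃ : Carrier
    e₁ = e
    e₂ = σ e
    e₃ = σ² e

    form≢0 : e₁ * e₁ - e₂ * e₃ ≢ 0#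
    form≢0 eq = form-e (linear₂ 1# e₂
      (solve 3 (λ x y z → x ⊗ x ⊕ x ⊗ y ⊕ y ⊗ y ⊖ con 0 ⊜ con 1 ⊗ (x ⊗ x ⊖ y ⊗ z ⊖ con 0) ⊕ y ⊗ (x ⊕ y ⊕ z ⊖ con 0)) refl e₁ e₂ e₃)
      eq trace-e)

    e≢0 : e ≢ 0#
    e≢0 e≡0 = form≢0 (trans (cong (λ x → x * x - σ x * σ² x) e≡0) (trans (cong (λ x → 0# * 0# - x * σ x) 0#-homo)
      (trans (cong (λ x → 0# * 0# - 0# * x) 0#-homo) (solve 0 (con 0 ⊗ con 0 ⊖ con 0 ⊗ con 0 ⊜ con 0) refl))))

    σ-equation : ∀ {x y u v} → x * y ≡ u * v → σ x * σ y ≡ σ u * σ v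
    σ-equation eq = trans (sym (*-homo _ _)) (trans (cong σ eq) (*-homo _ _))

    σ-+-* : ∀ x y z → σ (x + y * z) ≡ σ x + σ y * σ z
    σ-+-* x y z = trans (+-homo _ _) (cong (σ x +_) (*-homo _ _))

  -- Hilbert's Theorem 90: x = τ(a σa) / (a σa) is in the torus.
  Represents : Carrier → Carrier → Set
  Represents a x = x * (a * σ a) ≡ τ a * σ (τ a)

  represented-T : ∀ {a x} → a ≢ 0# → Represents a x → T x
  represented-T {a} {x} a≢0 eq = record
    { nonZero = λ x≡0 → *-≢0 (τ-≢0 a≢0) (σ-≢0 (τ-≢0 a≢0)) (trans (sym eq) (trans (cong (_* (a * σ a)) x≡0) (zeroˡ _)))
    ; twist   = *-cancelˡ (*-≢0 (*-≢0 a≢0 (σ-≢0 a≢0)) (*-≢0 (σ-≢0 (σ-≢0 a≢0)) (τ-≢0 a≢0))) (linear₃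
        (σ² x * (a₂ * a₃)) (a₃ * a₄) (- (a * a₃))
        (solve 9 (λ x x₁ x₂ a a₁ a₂ a₃ a₄ a₅ →
          a ⊗ a₁ ⊗ (a₂ ⊗ a₃) ⊗ (x ⊗ x₂) ⊖ a ⊗ a₁ ⊗ (a₂ ⊗ a₃) ⊗ x₁ ⊜
          x₂ ⊗ (a₂ ⊗ a₃) ⊗ (x ⊗ (a ⊗ a₁) ⊖ a₃ ⊗ a₄) ⊕ a₃ ⊗ a₄ ⊗ (x₂ ⊗ (a₂ ⊗ a₃) ⊖ a₅ ⊗ a)
          ⊕ (⊝ (a ⊗ a₃)) ⊗ (x₁ ⊗ (a₁ ⊗ a₂) ⊖ a₄ ⊗ a₅)) refl x (σ x) (σ² x) a a₁ a₂ a₃ a₄ a₅)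
        eq eq₂ eq₁)
    }
    where
    a₁ = σ a
    a₂ = σ² a
    a₃ = τ a
    a₄ = σ (τ a)
    a₅ = σ² (τ a)

    eq₁ : σ x * (a₁ * a₂) ≡ a₄ * a₅
    eq₁ = trans (cong (σ x *_) (sym (*-homo a a₁))) (σ-equation eq)

    eq₂ : σ² x * (a₂ * a₃) ≡ a₅ * a
    eq₂ = trans (cong (σ² x *_) (sym (*-homo a₁ a₂))) (trans (σ-equation eq₁) (cong (a₅ *_) (σ⁶ a)))

  module _ (s : Carrier) (σ²s : σ² s ≡ s) where

    -- The element represented by a is unchanged when a is multiplied by an element of Fix σ². The a
    -- in use lie in the plane spanned by e and σe over Fix σ², where the trace to Fix σ² is zero,
    -- and s is an affine coordinate on its projective line. All s in F, and the omitted σe,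
    -- represent 1.
    numerator : Carrier
    numerator = e₁ + s * e₂

    private
      n₁ : σ numerator ≡ e₂ + σ s * e₃
      n₁ = σ-+-* e₁ s e₂

      n₂ : σ² numerator ≡ e₃ + s * e₁
      n₂ = trans (cong σ n₁) (trans (σ-+-* e₂ (σ s) e₃) (cong₂ (λ r t → e₃ + r * t) σ²s τ-e))

      n₃ : τ numerator ≡ e₁ + σ s * e₂
      n₃ = trans (cong σ n₂) (trans (σ-+-* e₃ s e₁) (cong (_+ σ s * e₂) τ-e))

      n₄ : σ (τ numerator) ≡ e₂ + s * e₃
      n₄ = trans (cong σ n₃) (trans (σ-+-* e₁ (σ s) e₂) (cong (λ r → e₂ + r * e₃) σ²s))

    numerator-≢0 : numerator ≢ 0#
    numerator-≢0 eq = form≢0 (linear₂ e₁ (- e₂)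
      (solve 4 (λ s x y z → x ⊗ x ⊖ y ⊗ z ⊖ con 0 ⊜ x ⊗ (x ⊕ s ⊗ y ⊖ con 0) ⊕ (⊝ y) ⊗ (z ⊕ s ⊗ x ⊖ con 0)) refl s e₁ e₂ e₃)
      eq (trans (sym n₂) (trans (cong σ² eq) (trans (cong σ 0#-homo) 0#-homo))))

    trace-numerator : numerator + σ² numerator + σ (τ numerator) ≡ 0#
    trace-numerator = trans (cong₂ (λ r t → numerator + r + t) n₂ n₄) (linear₁ (1# + s)
      (solve 4 (λ s x y z → x ⊕ s ⊗ y ⊕ (z ⊕ s ⊗ x) ⊕ (y ⊕ s ⊗ z) ⊖ con 0 ⊜ (con 1 ⊕ s) ⊗ (x ⊕ y ⊕ z ⊖ con 0)) refl s e₁ e₂ e₃) trace-e)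

    point : Carrier
    point = τ numerator * σ (τ numerator) * (numerator * σ numerator) ⁻¹

    point-represented : Represents numerator point
    point-represented = linear₁ (τ numerator * σ (τ numerator))
      (solve 3 (λ p b b⁻¹ → p ⊗ b⁻¹ ⊗ b ⊖ p ⊜ p ⊗ (b ⊗ b⁻¹ ⊖ con 1)) refl (τ numerator * σ (τ numerator)) (numerator * σ numerator) ((numerator * σ numerator) ⁻¹))
      (*-inverseʳ (*-≢0 numerator-≢0 (σ-≢0 numerator-≢0)))

    represented-unique : ∀ {x} → Represents numerator x → x ≡ point
    represented-unique {x} eq = *-cancelˡ (*-≢0 numerator-≢0 (σ-≢0 numerator-≢0))
      (trans (*-comm _ x) (trans eq (trans (sym point-represented) (*-comm point _))))

    represented-1 : Represents numerator 1# → σ s ≡ s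
    represented-1 eq = x-y≈0⇒x≈y _ _ (*-cancelˡ-0 form≢0 (linear₂ 1# ((σ s - s) * (e₁ - e₂))
      (solve 5 (λ s s̄ x y z → (x ⊗ x ⊖ y ⊗ z) ⊗ (s̄ ⊖ s) ⊖ con 0 ⊜
        con 1 ⊗ ((x ⊕ s̄ ⊗ y) ⊗ (y ⊕ s ⊗ z) ⊖ con 1 ⊗ ((x ⊕ s ⊗ y) ⊗ (y ⊕ s̄ ⊗ z)))
        ⊕ (s̄ ⊖ s) ⊗ (x ⊖ y) ⊗ (x ⊕ y ⊕ z ⊖ con 0)) refl s (σ s) e₁ e₂ e₃)
      (trans (cong₂ _*_ (sym n₃) (sym n₄)) (trans (sym eq) (cong (λ r → 1# * (numerator * r)) n₁)))
      trace-e))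

    -- As a has trace zero over Fix σ², the slope (σx - 1) / (x - 1) is - a / σ²a, a Möbius function
    -- of s. So x determines s, and a given slope shows which s to take.
    slope-equation : ∀ {x} → Represents numerator x → (σ x - 1#) * (e₃ + s * e₁) + (x - 1#) * (e₁ + s * e₂) ≡ 0#
    slope-equation {x} eq = trans (cong (λ r → (σ x - 1#) * r + (x - 1#) * numerator) (sym n₂))
      (*-cancelˡ-0 (σ-≢0 numerator-≢0) (begin
        a₁ * ((σ x - 1#) * a₂ + (x - 1#) * a)
          ≡⟨ solve 5 (λ x x₁ a a₁ a₂ → a₁ ⊗ ((x₁ ⊖ con 1) ⊗ a₂ ⊕ (x ⊖ con 1) ⊗ a) ⊜ x₁ ⊗ (a₁ ⊗ a₂) ⊕ x ⊗ (a ⊗ a₁) ⊖ a₁ ⊗ (a ⊕ a₂)) refl x (σ x) a a₁ a₂ ⟩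
        σ x * (a₁ * a₂) + x * (a * a₁) - a₁ * (a + a₂)
          ≡⟨ cong₂ (λ r t → r + t - a₁ * (a + a₂)) (trans (cong (σ x *_) (sym (*-homo a a₁))) (σ-equation eq)) eq ⟩
        a₄ * a₅ + a₃ * a₄ - a₁ * (a + a₂)
          ≡⟨ linear₂ a₄ (- a₁) (solve 6 (λ a a₁ a₂ a₃ a₄ a₅ → a₄ ⊗ a₅ ⊕ a₃ ⊗ a₄ ⊖ a₁ ⊗ (a ⊕ a₂) ⊖ con 0 ⊜
               a₄ ⊗ (a₁ ⊕ a₃ ⊕ a₅ ⊖ con 0) ⊕ (⊝ a₁) ⊗ (a ⊕ a₂ ⊕ a₄ ⊖ con 0)) refl a a₁ a₂ a₃ a₄ a₅) trace₁ trace-numerator ⟩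
        0# ∎))
      where
      a = numerator
      a₁ = σ a
      a₂ = σ² a
      a₃ = τ a
      a₄ = σ (τ a)
      a₅ = σ² (τ a)

      trace₁ : a₁ + a₃ + a₅ ≡ 0#
      trace₁ = trans (cong (_+ a₅) (sym (+-homo a a₂))) (trans (sym (+-homo _ _)) (trans (cong σ trace-numerator) 0#-homo))

  represented-injective : ∀ {s t} (σ²s : σ² s ≡ s) (σ²t : σ² t ≡ t) {x} → x ≢ 1# →
    Represents (numerator s σ²s) x → Represents (numerator t σ²t) x → s ≡ t
  represented-injective {s} {t} σ²s σ²t {x} x≢1 p q = x-y≈0⇒x≈y _ _ (*-cancelˡ-0 den≢0 (linear₂ 1# (- 1#)
    (solve 7 (λ s t X Y x y z → (Y ⊗ x ⊕ X ⊗ y) ⊗ (s ⊖ t) ⊖ con 0 ⊜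
      con 1 ⊗ (Y ⊗ (z ⊕ s ⊗ x) ⊕ X ⊗ (x ⊕ s ⊗ y) ⊖ con 0) ⊕ (⊝ con 1) ⊗ (Y ⊗ (z ⊕ t ⊗ x) ⊕ X ⊗ (x ⊕ t ⊗ y) ⊖ con 0))
      refl s t X Y e₁ e₂ e₃) eq (slope-equation t σ²t q)))
    where
    X = x - 1#
    Y = σ x - 1#

    eq : Y * (e₃ + s * e₁) + X * (e₁ + s * e₂) ≡ 0#
    eq = slope-equation s σ²s p

    den≢0 : Y * e₁ + X * e₂ ≢ 0#
    den≢0 den≡0 = *-≢0 (-≢0 x≢1) form≢0 (linear₂ e₁ (- (e₃ + e₁ * s))
      (solve 6 (λ s X Y x y z → X ⊗ (x ⊗ x ⊖ y ⊗ z) ⊖ con 0 ⊜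
        x ⊗ (Y ⊗ (z ⊕ s ⊗ x) ⊕ X ⊗ (x ⊕ s ⊗ y) ⊖ con 0) ⊕ (⊝ (z ⊕ x ⊗ s)) ⊗ (Y ⊗ x ⊕ X ⊗ y ⊖ con 0)) refl s X Y e₁ e₂ e₃)
      eq den≡0)

  -- The slope equation is solved for s. Under σ² both `num` and `den` are multiplied by - (τ x - 1)
  -- / (x - 1), so that their quotient is fixed.
  represented-surjective : ∀ {x} → T x → x ≢ 1# →
    ∃₂ λ s (σ²s : σ² s ≡ s) → Represents (numerator s σ²s) x × σ s ≢ s
  represented-surjective {x} tx x≢1 = s , σ²s , represents , σs≢s
    where
    X = x - 1#
    Y = σ x - 1#
    Y₁ = σ² x - 1#
    Y₂ = τ x - 1#

    X≢0 : X ≢ 0#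
    X≢0 = -≢0 x≢1

    σX : σ X ≡ Y
    σX = σ-minus-1 x

    σY : σ Y ≡ Y₁
    σY = σ-minus-1 (σ x)

    σY₁ : σ Y₁ ≡ Y₂
    σY₁ = σ-minus-1 (σ² x)

    Y≢0 : Y ≢ 0#
    Y≢0 eq = σ-≢0 X≢0 (trans σX eq)

    Y₁≢0 : Y₁ ≢ 0#
    Y₁≢0 eq = σ-≢0 Y≢0 (trans σY eq)

    Y₂≢0 : Y₂ ≢ 0#
    Y₂≢0 eq = σ-≢0 Y₁≢0 (trans σY₁ eq)

    XY₁ : X * Y₁ ≡ Y - X - Y₁
    XY₁ = linear₁ 1# (solve 3 (λ x x₁ x₂ → (x ⊖ con 1) ⊗ (x₂ ⊖ con 1) ⊖ (x₁ ⊖ con 1 ⊖ (x ⊖ con 1) ⊖ (x₂ ⊖ con 1)) ⊜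
      con 1 ⊗ (x ⊗ x₂ ⊖ x₁)) refl x (σ x) (σ² x)) (twist tx)

    xY₁ : x * Y₁ ≡ Y - X
    xY₁ = linear₁ 1# (solve 3 (λ x x₁ x₂ → x ⊗ (x₂ ⊖ con 1) ⊖ (x₁ ⊖ con 1 ⊖ (x ⊖ con 1)) ⊜ con 1 ⊗ (x ⊗ x₂ ⊖ x₁)) refl x (σ x) (σ² x)) (twist tx)

    Y₁X : Y₁ * X ≡ Y₂ * (X - Y)
    Y₁X = linear₃ 1# 1# (- 1#) (solve 4 (λ x x₁ x₂ x₃ → (x₂ ⊖ con 1) ⊗ (x ⊖ con 1) ⊖ (x₃ ⊖ con 1) ⊗ (x ⊖ con 1 ⊖ (x₁ ⊖ con 1)) ⊜
      con 1 ⊗ (x ⊗ x₂ ⊖ x₁) ⊕ con 1 ⊗ (x₁ ⊗ x₃ ⊖ x₂) ⊕ (⊝ con 1) ⊗ (x ⊗ x₃ ⊖ con 1)) refl x (σ x) (σ² x) (τ x))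
      (twist tx) (σx*τx tx) (τ-inverse tx)

    num den : Carrier
    num = Y * e₃ + X * e₁
    den = Y * e₁ + X * e₂

    -- If `den` and therefore σ den vanished, the equation of T would give X² σe σ²e = - X σe (e +
    -- σe + σ²e) = 0.
    den≢0 : den ≢ 0#
    den≢0 den≡0 = *-≢0 (*-≢0 X≢0 X≢0) (*-≢0 (σ-≢0 e≢0) (σ-≢0 (σ-≢0 e≢0)))
      (trans (linear₃ (X * e₃ + e₂ + e₃) (- (X * e₁ + e₁)) (e₁ * e₂)
        (solve 6 (λ X Y Y₁ x y z → X ⊗ X ⊗ (y ⊗ z) ⊖ (⊝ X ⊗ y) ⊗ (x ⊕ y ⊕ z) ⊜
          (X ⊗ z ⊕ y ⊕ z) ⊗ (Y ⊗ x ⊕ X ⊗ y ⊖ con 0) ⊕ (⊝ (X ⊗ x ⊕ x)) ⊗ (Y₁ ⊗ y ⊕ Y ⊗ z ⊖ con 0) ⊕ x ⊗ y ⊗ (X ⊗ Y₁ ⊖ (Y ⊖ X ⊖ Y₁)))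
          refl X Y Y₁ e₁ e₂ e₃)
        den≡0 σden XY₁) (trans (cong (- X * e₂ *_) trace-e) (zeroʳ _)))
      where
      σden : Y₁ * e₂ + Y * e₃ ≡ 0#
      σden = begin
        Y₁ * e₂ + Y * e₃        ≡⟨ cong₂ (λ r t → r * e₂ + t * e₃) σY σX ⟨
        σ Y * e₂ + σ X * e₃     ≡⟨ cong₂ _+_ (*-homo Y e₁) (*-homo X e₂) ⟨
        σ (Y * e₁) + σ (X * e₂) ≡⟨ +-homo _ _ ⟨
        σ den                   ≡⟨ cong σ den≡0 ⟩
        σ 0#                    ≡⟨ 0#-homo ⟩
        0#                      ∎

    s : Carrier
    s = - num * den ⁻¹

    s-den : s * den ≡ - num
    s-den = linear₁ (- num) (solve 3 (λ n d d⁻¹ → ⊝ n ⊗ d⁻¹ ⊗ d ⊖ ⊝ n ⊜ (⊝ n) ⊗ (d ⊗ d⁻¹ ⊖ con 1)) refl num den (den ⁻¹)) (*-inverseʳ den≢0)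

    σ²-two : ∀ u v → σ² (Y * u + X * v) ≡ Y₂ * σ² u + Y₁ * σ² v
    σ²-two u v = begin
      σ² (Y * u + X * v)
        ≡⟨ cong σ (trans (+-homo _ _) (cong₂ _+_ (*-homo Y u) (*-homo X v))) ⟩
      σ (σ Y * σ u + σ X * σ v)
        ≡⟨ cong₂ (λ r t → σ (r * σ u + t * σ v)) σY σX ⟩
      σ (Y₁ * σ u + Y * σ v)
        ≡⟨ trans (+-homo _ _) (cong₂ _+_ (*-homo Y₁ (σ u)) (*-homo Y (σ v))) ⟩
      σ Y₁ * σ² u + σ Y * σ² v
        ≡⟨ cong₂ (λ r t → r * σ² u + t * σ² v) σY₁ σY ⟩
      Y₂ * σ² u + Y₁ * σ² v ∎

    Xσ²den : X * σ² den ≡ - Y₂ * den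
    Xσ²den = trans (cong (X *_) (trans (σ²-two e₁ e₂) (cong (λ r → Y₂ * e₃ + Y₁ * r) τ-e)))
      (linear₂ e₁ (X * Y₂) (solve 7 (λ X Y Y₁ Y₂ x y z → X ⊗ (Y₂ ⊗ z ⊕ Y₁ ⊗ x) ⊖ ⊝ Y₂ ⊗ (Y ⊗ x ⊕ X ⊗ y) ⊜
        x ⊗ (Y₁ ⊗ X ⊖ Y₂ ⊗ (X ⊖ Y)) ⊕ X ⊗ Y₂ ⊗ (x ⊕ y ⊕ z ⊖ con 0)) refl X Y Y₁ Y₂ e₁ e₂ e₃) Y₁X trace-e)

    Xσ²num : X * σ² num ≡ - Y₂ * num
    Xσ²num = trans (cong (X *_) (trans (σ²-two e₃ e₁) (cong (λ r → Y₂ * r + Y₁ * e₃) (cong σ τ-e))))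
      (linear₂ e₃ (X * Y₂) (solve 7 (λ X Y Y₁ Y₂ x y z → X ⊗ (Y₂ ⊗ y ⊕ Y₁ ⊗ z) ⊖ ⊝ Y₂ ⊗ (Y ⊗ z ⊕ X ⊗ x) ⊜
        z ⊗ (Y₁ ⊗ X ⊖ Y₂ ⊗ (X ⊖ Y)) ⊕ X ⊗ Y₂ ⊗ (x ⊕ y ⊕ z ⊖ con 0)) refl X Y Y₁ Y₂ e₁ e₂ e₃) Y₁X trace-e)

    σ²s : σ² s ≡ s
    σ²s = *-cancelˡ (*-≢0 Y₂≢0 den≢0) (begin
      Y₂ * den * σ² s
        ≡⟨ solve 3 (λ y d s → y ⊗ d ⊗ s ⊜ ⊝ ((⊝ y ⊗ d) ⊗ s)) refl Y₂ den (σ² s) ⟩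
      - (- Y₂ * den * σ² s)
        ≡⟨ cong (λ r → - (r * σ² s)) Xσ²den ⟨
      - (X * σ² den * σ² s)
        ≡⟨ solve 3 (λ x d s → ⊝ (x ⊗ d ⊗ s) ⊜ ⊝ (x ⊗ (s ⊗ d))) refl X (σ² den) (σ² s) ⟩
      - (X * (σ² s * σ² den))
        ≡⟨ cong (λ r → - (X * r)) (trans (cong σ (*-homo s den)) (*-homo (σ s) (σ den))) ⟨
      - (X * σ² (s * den))
        ≡⟨ cong (λ r → - (X * r)) (trans (cong σ² s-den) (trans (cong σ (-‿homo num)) (-‿homo (σ num)))) ⟩
      - (X * - σ² num)
        ≡⟨ solve 2 (λ x n → ⊝ (x ⊗ ⊝ n) ⊜ x ⊗ n) refl X (σ² num) ⟩
      X * σ² num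
        ≡⟨ Xσ²num ⟩
      - Y₂ * num
        ≡⟨ solve 2 (λ y n → ⊝ y ⊗ n ⊜ y ⊗ ⊝ n) refl Y₂ num ⟩
      Y₂ * - num
        ≡⟨ cong (Y₂ *_) s-den ⟨
      Y₂ * (s * den)
        ≡⟨ solve 3 (λ y s d → y ⊗ (s ⊗ d) ⊜ y ⊗ d ⊗ s) refl Y₂ s den ⟩
      Y₂ * den * s ∎)

    a a₁ a₂ a₃ a₄ : Carrier
    a = numerator s σ²s
    a₁ = σ a
    a₂ = σ² a
    a₃ = τ a
    a₄ = σ (τ a)

    a₂≡ : a₂ ≡ e₃ + s * e₁
    a₂≡ = trans (cong σ (σ-+-* e₁ s e₂)) (trans (σ-+-* e₂ (σ s) e₃) (cong₂ (λ r t → e₃ + r * t) σ²s τ-e))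

    Ya₂ : Y * a₂ ≡ - X * a
    Ya₂ = trans (cong (Y *_) a₂≡) (linear₁ 1#
      (solve 6 (λ s X Y x y z → Y ⊗ (z ⊕ s ⊗ x) ⊖ ⊝ X ⊗ (x ⊕ s ⊗ y) ⊜ con 1 ⊗ (s ⊗ (Y ⊗ x ⊕ X ⊗ y) ⊖ ⊝ (Y ⊗ z ⊕ X ⊗ x))) refl s X Y e₁ e₂ e₃) s-den)

    Y₁a₃ : Y₁ * a₃ ≡ - Y * a₁
    Y₁a₃ = trans (cong (_* a₃) (sym σY)) (trans (σ-equation Ya₂) (cong (_* a₁) (trans (-‿homo X) (cong -_ σX))))

    represents : Represents a x
    represents = *-cancelˡ (*-≢0 Y≢0 Y₁≢0) (begin
      Y * Y₁ * (x * (a * a₁))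
        ≡⟨ linear₁ (Y * (a * a₁)) (solve 6 (λ x X Y Y₁ a a₁ → Y ⊗ Y₁ ⊗ (x ⊗ (a ⊗ a₁)) ⊖ Y ⊗ (a ⊗ a₁) ⊗ (Y ⊖ X) ⊜
             Y ⊗ (a ⊗ a₁) ⊗ (x ⊗ Y₁ ⊖ (Y ⊖ X))) refl x X Y Y₁ a a₁) xY₁ ⟩
      Y * (a * a₁) * (Y - X)
        ≡⟨ linear₃ (- (a₁ * Y)) (- (Y * a₄)) (- (a₁ * (- Y * Y)))
             (solve 8 (λ X Y Y₁ a a₁ a₂ a₃ a₄ → Y ⊗ (a ⊗ a₁) ⊗ (Y ⊖ X) ⊖ Y ⊗ Y₁ ⊗ (a₃ ⊗ a₄) ⊜
               (⊝ (a₁ ⊗ Y)) ⊗ (Y ⊗ a₂ ⊖ ⊝ X ⊗ a) ⊕ (⊝ (Y ⊗ a₄)) ⊗ (Y₁ ⊗ a₃ ⊖ ⊝ Y ⊗ a₁) ⊕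
               (⊝ (a₁ ⊗ (⊝ Y ⊗ Y))) ⊗ (a ⊕ a₂ ⊕ a₄ ⊖ con 0)) refl X Y Y₁ a a₁ a₂ a₃ a₄)
             Ya₂ Y₁a₃ (trace-numerator s σ²s) ⟩
      Y * Y₁ * (a₃ * a₄) ∎)

    σs≢s : σ s ≢ s
    σs≢s σs≡s = x≢1 (*-cancelˡ (*-≢0 (numerator-≢0 s σ²s) (σ-≢0 (numerator-≢0 s σ²s))) (begin
      a * a₁ * x    ≡⟨ *-comm _ x ⟩
      x * (a * a₁)  ≡⟨ represents ⟩
      a₃ * σ a₃     ≡⟨ cong (λ r → r * σ r) a₃≡a ⟩
      a * a₁        ≡⟨ *-identityʳ _ ⟨
      a * a₁ * 1#   ∎))
      where
      a₃≡a : a₃ ≡ a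
      a₃≡a = trans (cong σ a₂≡) (trans (σ-+-* e₃ s e₁) (cong₂ (λ r t → r + t * e₂) τ-e σs≡s))

  ι-sum : ∀ {n} (f : Fin n → A.Carrier) → ι (AP.sum f) ≡ sum (ι ∘ f)
  ι-sum {zero}  f = ι.0#-homo
  ι-sum {suc n} f = trans (ι.+-homo _ _) (cong (ι (f zero) +_) (ι-sum (f ∘ suc)))

  parameter : A.Carrier → A.Carrier → Carrier
  parameter u v = ι u + ι v * w

  σ²-parameter : ∀ u v → σ² (parameter u v) ≡ parameter u v
  σ²-parameter u v = begin
    σ² (ι u + ι v * w)
      ≡⟨ cong σ (trans (σ-+-* (ι u) (ι v) w) (cong₂ (λ r t → r + t * σ w) (σ-ι u) (σ-ι v))) ⟩
    σ (ι u + ι v * σ w)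
      ≡⟨ trans (σ-+-* (ι u) (ι v) (σ w)) (cong₂ _+_ (σ-ι u) (cong₂ _*_ (σ-ι v) σ²-w)) ⟩
    ι u + ι v * w ∎


  σ-parameter-fixed : ∀ u v → σ (parameter u v) ≡ parameter u v → v ≡ A.0#
  σ-parameter-fixed u v eq = AP.linear₁ A.1# (AP.solve 2 (λ u v → v ⊖ con 0 ⊜ con 1 ⊗ (u ⊕ v ⊖ u)) refl u v)
    (proj₁ (ι-w-unique (begin
      ι (u A.+ v) + ι (A.- v) * w
        ≡⟨ cong₂ (λ r t → r + t * w) (ι.+-homo u v) (ι.-‿homo v) ⟩
      ι u + ι v + - ι v * w
        ≡⟨ solve 3 (λ u v w → u ⊕ v ⊕ ⊝ v ⊗ w ⊜ u ⊕ v ⊗ (con 1 ⊖ w)) refl (ι u) (ι v) w ⟩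
      ι u + ι v * (1# - w)
        ≡⟨ cong (λ r → ι u + ι v * r) (trans (sym τ-w) (cong σ σ²-w)) ⟩
      ι u + ι v * σ w
        ≡⟨ trans (σ-+-* (ι u) (ι v) w) (cong₂ (λ r t → r + t * σ w) (σ-ι u) (σ-ι v)) ⟨
      σ (ι u + ι v * w)
        ≡⟨ eq ⟩
      ι u + ι v * w ∎)))

  σ-fixed : ∀ x → σ x ≡ x → ∃ λ u → x ≡ ι u
  σ-fixed x σx≡x with σ²-fixed x (trans (cong σ σx≡x) σx≡x)
  ... | u , v , refl = u , trans (cong (λ r → ι u + ι r * w) (σ-parameter-fixed u v σx≡x))
    (trans (cong (λ r → ι u + r * w) ι.0#-homo) (trans (cong (ι u +_) (zeroˡ w)) (+-identityʳ (ι u))))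

  module Enumeration {q-1 : ℕ} (A↔Fin : Fin (suc q-1) ↔ A.Carrier) where

    open Inverse A↔Fin using (to; from; strictlyInverseˡ; strictlyInverseʳ)

    open FiniteScalars A A↔Fin

    -- One for the element 1 and one for each s = u + v w with v nonzero, that is q² - q + 1.
    size : ℕ
    size = suc (q-1 ℕ.* suc q-1)

    private
      v : Fin (q-1 ℕ.* suc q-1) → A.Carrier
      v k = nonzero (quotient {q-1} (suc q-1) k)

      u : Fin (q-1 ℕ.* suc q-1) → A.Carrier
      u k = to (remainder {q-1} (suc q-1) k)

      s : Fin (q-1 ℕ.* suc q-1) → Carrier
      s k = parameter (u k) (v k)

      σ²s : ∀ k → σ² (s k) ≡ s k
      σ²s k = σ²-parameter (u k) (v k)

    torus : Fin size → Carrier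
    torus zero    = 1#
    torus (suc k) = point (s k) (σ²s k)

    torus-T : ∀ i → T (torus i)
    torus-T zero    = T-1
    torus-T (suc k) = represented-T (numerator-≢0 (s k) (σ²s k)) (point-represented (s k) (σ²s k))

    private
      torus-suc-≢1 : ∀ k → torus (suc k) ≢ 1#
      torus-suc-≢1 k eq = nonzero-≢0 _ (σ-parameter-fixed (u k) (v k)
        (represented-1 (s k) (σ²s k) (subst (Represents _) eq (point-represented (s k) (σ²s k)))))

      s-injective : ∀ {k l} → s k ≡ s l → k ≡ l
      s-injective {k} {l} eq = let u≡ , v≡ = ι-w-unique eq in begin
        k
          ≡⟨ Fin.combine-remQuot {q-1} (suc q-1) k ⟨
        combine {q-1} {suc q-1} (quotient {q-1} (suc q-1) k) (remainder {q-1} (suc q-1) k)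
          ≡⟨ cong₂ (combine {q-1} {suc q-1}) (nonzero-injective v≡) (to-injective u≡) ⟩
        combine {q-1} {suc q-1} (quotient {q-1} (suc q-1) l) (remainder {q-1} (suc q-1) l)
          ≡⟨ Fin.combine-remQuot {q-1} (suc q-1) l ⟩
        l ∎

    torus-injective : Injective _≡_ _≡_ torus
    torus-injective {zero}  {zero}  eq = refl
    torus-injective {zero}  {suc l} eq = contradiction (sym eq) (torus-suc-≢1 l)
    torus-injective {suc k} {zero}  eq = contradiction eq (torus-suc-≢1 k)
    torus-injective {suc k} {suc l} eq = cong suc (s-injective (represented-injective (σ²s k) (σ²s l) (torus-suc-≢1 k)
      (point-represented (s k) (σ²s k))
      (subst (Represents _) (sym eq) (point-represented (s l) (σ²s l)))))

    private
      module Nontrivial {x} (tx : T x) (x≢1 : x ≢ 1#) where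

        representation = represented-surjective tx x≢1
        s′ = proj₁ representation
        σ²s′ = proj₁ (proj₂ representation)

        coefficients = σ²-fixed s′ σ²s′
        u′ = proj₁ coefficients
        v′ = proj₁ (proj₂ coefficients)

        s′≡ : s′ ≡ parameter u′ v′
        s′≡ = proj₂ (proj₂ coefficients)

        v′≢0 : v′ ≢ A.0#
        v′≢0 v′≡0 = proj₂ (proj₂ (proj₂ representation)) (trans (cong σ s′≡ιu′) (trans (σ-ι u′) (sym s′≡ιu′)))
          where
          s′≡ιu′ : s′ ≡ ι u′
          s′≡ιu′ = begin
            s′                  ≡⟨ s′≡ ⟩
            ι u′ + ι v′ * w     ≡⟨ cong (λ r → ι u′ + ι r * w) v′≡0 ⟩
            ι u′ + ι A.0# * w   ≡⟨ cong (λ r → ι u′ + r * w) ι.0#-homo ⟩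
            ι u′ + 0# * w       ≡⟨ cong (ι u′ +_) (zeroˡ w) ⟩
            ι u′ + 0#           ≡⟨ +-identityʳ (ι u′) ⟩
            ι u′                ∎

        i = proj₁ (nonzero-surjective v′≢0)

        k : Fin (q-1 ℕ.* suc q-1)
        k = combine i (from u′)

        s≡s′ : s k ≡ s′
        s≡s′ = trans (cong₂ (λ r t → ι r + ι t * w)
          (trans (cong (to ∘ proj₂) (Fin.remQuot-combine i (from u′))) (strictlyInverseˡ u′))
          (trans (cong (nonzero ∘ proj₁) (Fin.remQuot-combine i (from u′))) (proj₂ (nonzero-surjective v′≢0))))
          (sym s′≡)

        torus-k : torus (suc k) ≡ x
        torus-k = sym (represented-unique (s k) (σ²s k)
          (subst (λ r → Represents (e₁ + r * e₂) x) (sym s≡s′) (proj₁ (proj₂ (proj₂ representation)))))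

    torus-surjective : ∀ {x} → T x → ∃ λ i → torus i ≡ x
    torus-surjective {x} tx with x ≟ 1#
    ... | yes x≡1 = zero , sym x≡1
    ... | no x≢1  = suc (Nontrivial.k tx x≢1) , Nontrivial.torus-k tx x≢1

-- A section of f would be injective, and miss i or j.
not-surjective : ∀ {n} (f : Fin n → Fin n) {i j} → i ≢ j → f i ≡ f j → ∃ λ y → ∀ x → f x ≢ y
not-surjective {suc n} f {i} {j} i≢j fi≡fj with Fin.any? (λ y → Fin.all? (λ x → ¬? (f x Fin.≟ y)))
... | yes (y , missed) = y , missed
... | no onto = contradiction (Fin.injective⇒≤ {f = λ y → punchOut (m≢g y)} (λ eq → g-injective (Fin.punchOut-injective (m≢g _) (m≢g _) eq))) (ℕ.<⇒≱ ℕ.≤-refl)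
  where
  preimage : ∀ y → ∃ λ x → f x ≡ y
  preimage y with Fin.any? (λ x → f x Fin.≟ y)
  ... | yes found = found
  ... | no none   = contradiction (y , λ x eq → none (x , eq)) onto

  g : Fin (suc n) → Fin (suc n)
  g y = proj₁ (preimage y)

  f∘g : ∀ y → f (g y) ≡ y
  f∘g y = proj₂ (preimage y)

  g-injective : Injective _≡_ _≡_ g
  g-injective {y} {z} eq = trans (sym (f∘g y)) (trans (cong f eq) (f∘g z))

  missed : ∃ λ m → f m ≡ f i × m ≢ g (f i)
  missed with i Fin.≟ g (f i)
  ... | no  i≢g = i , refl , i≢g
  ... | yes i≡g = j , sym fi≡fj , λ j≡g → i≢j (trans i≡g (sym j≡g))

  m≢g : ∀ y → proj₁ missed ≢ g y
  m≢g y m≡gy = proj₂ (proj₂ missed) (trans m≡gy (cong g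
    (trans (sym (f∘g y)) (trans (cong f (sym m≡gy)) (proj₁ (proj₂ missed))))))

-- Irreducible polynomials over finite fields.

module FiniteField (A : Field) {q-1 : ℕ} (A↔Fin : Fin (suc q-1) ↔ Field.Carrier A) where

  open Field A
  open FieldProperties A
  open FiniteScalars A A↔Fin using (from-injective)
  open Inverse A↔Fin using (to; from; strictlyInverseˡ; strictlyInverseʳ)

  value-missed : (f : Carrier → Carrier) → ∀ {x y} → x ≢ y → f x ≡ f y → ∃ λ z → ∀ r → f r ≢ z
  value-missed f {x} {y} x≢y fx≡fy =
    let z , missed = not-surjective (from ∘ f ∘ to) {from x} {from y} (x≢y ∘ from-injective)
          (cong from (trans (cong f (strictlyInverseˡ x)) (trans fx≡fy (cong f (sym (strictlyInverseˡ y))))))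
    in to z , λ r eq → missed (from r) (trans (cong (from ∘ f) (strictlyInverseˡ r)) (trans (cong from eq) (strictlyInverseʳ z)))

  -- The function r - r² takes the same value at 0 and 1, so it misses some n.
  irreducible-quadratic : ∃ (QuadraticHasNoRoot A)
  irreducible-quadratic =
    let n , missed = value-missed (λ r → r - r * r) {0#} {1#} (1≢0 ∘ sym)
          (solve 0 (con 0 ⊖ con 0 ⊗ con 0 ⊜ con 1 ⊖ con 1 ⊗ con 1) refl)
    in n , λ r eq → missed r (linear₁ (- 1#) (solve 2 (λ r n → r ⊖ r ⊗ r ⊖ n ⊜ (⊝ con 1) ⊗ (r ⊗ r ⊖ r ⊕ n ⊖ con 0)) refl r n) eq)

  -- The cubic of parameter a vanishes at r if and only if a is the value at r
  -- of a rational function with poles at 0 and -1, which therefore cannot be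
  -- onto.
  irreducible-cubic : ∃ (CubicHasNoRoot A)
  irreducible-cubic =
    let a , missed = value-missed parameter {0#} { - 1#} (λ eq → 1≢0 (linear₁ 1# (solve 0 (con 1 ⊖ con 0 ⊜ con 1 ⊗ (con 0 ⊖ ⊝ con 1)) refl) eq))
          (trans (at-pole (solve 0 (con 0 ⊗ con 0 ⊕ con 0 ⊜ con 0) refl)) (sym (at-pole (solve 0 (⊝ con 1 ⊗ ⊝ con 1 ⊕ ⊝ con 1 ⊜ con 0) refl))))
    in a , λ r eq → missed r (value r a eq)
    where
    parameter : Carrier → Carrier
    parameter r with r * r + r ≟ 0#
    ... | yes _ = 0#
    ... | no  _ = (r * r * r - (1# + 1# + 1#) * r - 1#) * (r * r + r) ⁻¹

    at-pole : ∀ {r} → r * r + r ≡ 0# → parameter r ≡ 0#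
    at-pole {r} eq with r * r + r ≟ 0#
    ... | yes _  = refl
    ... | no neq = contradiction eq neq

    value : ∀ r a → r * r * r - a * (r * r) - (a + 1# + 1# + 1#) * r - 1# ≡ 0# → parameter r ≡ a
    value r a eq with r * r + r ≟ 0#
    ... | no neq = *-cancelˡ neq (linear₂ 1# (r * r * r - (1# + 1# + 1#) * r - 1#)
      (solve 3 (λ r a i → (r ⊗ r ⊕ r) ⊗ ((r ⊗ r ⊗ r ⊖ (con 1 ⊕ con 1 ⊕ con 1) ⊗ r ⊖ con 1) ⊗ i) ⊖ (r ⊗ r ⊕ r) ⊗ a ⊜
        con 1 ⊗ (r ⊗ r ⊗ r ⊖ a ⊗ (r ⊗ r) ⊖ (a ⊕ con 1 ⊕ con 1 ⊕ con 1) ⊗ r ⊖ con 1 ⊖ con 0)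
        ⊕ (r ⊗ r ⊗ r ⊖ (con 1 ⊕ con 1 ⊕ con 1) ⊗ r ⊖ con 1) ⊗ ((r ⊗ r ⊕ r) ⊗ i ⊖ con 1)) refl r a ((r * r + r) ⁻¹)) eq (*-inverseʳ neq))
    -- At a pole the cubic has the value - (2r + 1), and (2r + 1)² = 4 (r² + r) + 1 = 1.
    ... | yes pole = contradiction 1≡0 1≢0
      where
      2r+1 : r + r + 1# ≡ 0#
      2r+1 = linear₂ (- 1#) (r - a - 1#)
        (solve 2 (λ r a → r ⊕ r ⊕ con 1 ⊖ con 0 ⊜
          (⊝ con 1) ⊗ (r ⊗ r ⊗ r ⊖ a ⊗ (r ⊗ r) ⊖ (a ⊕ con 1 ⊕ con 1 ⊕ con 1) ⊗ r ⊖ con 1 ⊖ con 0)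
          ⊕ (r ⊖ a ⊖ con 1) ⊗ (r ⊗ r ⊕ r ⊖ con 0)) refl r a) eq pole
      1≡0 : 1# ≡ 0#
      1≡0 = linear₂ (r + r + 1#) (- (1# + 1# + 1# + 1#))
        (solve 1 (λ r → con 1 ⊖ con 0 ⊜ (r ⊕ r ⊕ con 1) ⊗ (r ⊕ r ⊕ con 1 ⊖ con 0) ⊕ (⊝ (con 1 ⊕ con 1 ⊕ con 1 ⊕ con 1)) ⊗ (r ⊗ r ⊕ r ⊖ con 0)) refl r) 2r+1 pole

  -- Adding 1 permutes the field, so it does not change the sum of all elements; the surplus of q
  -- ones is therefore zero.
  sum-1 : sum {suc q-1} (λ _ → 1#) ≡ 0#
  sum-1 = linear₁ 1# (solve 2 (λ s t → t ⊖ con 0 ⊜ con 1 ⊗ (s ⊕ t ⊖ s)) refl (sum to) (sum {suc q-1} (λ _ → 1#))) (begin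
    sum to + sum {suc q-1} (λ _ → 1#)      ≡⟨ ∑-distrib-+ to (λ _ → 1#) ⟨
    sum (λ i → to i + 1#)                  ≡⟨ sum-cong-≗ (λ i → strictlyInverseˡ (to i + 1#)) ⟨
    sum (λ i → to (shift ⟨$⟩ʳ i))          ≡⟨ sum-permute to shift ⟨
    sum to                                 ∎)
    where
    shift : Permutation (suc q-1) (suc q-1)
    shift = permutation (λ i → from (to i + 1#)) (λ i → from (to i - 1#))
      (λ i → trans (cong (λ r → from (r + 1#)) (strictlyInverseˡ _)) (trans (cong from (solve 1 (λ x → x ⊖ con 1 ⊕ con 1 ⊜ x) refl (to i))) (strictlyInverseʳ i)))
      (λ i → trans (cong (λ r → from (r - 1#)) (strictlyInverseˡ _)) (trans (cong from (solve 1 (λ x → x ⊕ con 1 ⊖ con 1 ⊜ x) refl (to i))) (strictlyInverseʳ i)))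

-- Characters of the torus and Fourier inversion.

module Fourier {A : Field} (E : Extension A) {q-1 : ℕ} (A↔Fin : Fin (suc q-1) ↔ Field.Carrier A)
  (3≤q-1 : 3 ℕ.≤ q-1) where

  private module A = Field A
  open Extension E hiding (σ²; τ)
  open FieldProperties K
  open Torus cyclicSextic
  open T
  open IsRingHomomorphism isHomomorphism using (+-homo; *-homo; -‿homo; 0#-homo; 1#-homo)
  open Parametrisation E using (σ-fixed; ι-sum)
  open Parametrisation.Enumeration E A↔Fin
  private
    module ι = IsRingHomomorphism ι-homo
    module AP = FieldProperties A
  open import Algebra.Properties.Semiring.Mult semiring using (×-assocˡ) renaming (_×_ to _·_)

  -- q is zero in K, so q² - q + 1 is 1, and the inversion formula has no denominator.
  size×1 : sum {size} (λ _ → 1#) ≡ 1#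
  size×1 = begin
    1# + sum {q-1 ℕ.* suc q-1} (λ _ → 1#)  ≡⟨ cong (1# +_) (sum-replicate (q-1 ℕ.* suc q-1)) ⟩
    1# + (q-1 ℕ.* suc q-1) · 1#            ≡⟨ cong (1# +_) (×-assocˡ 1# q-1 (suc q-1)) ⟨
    1# + q-1 · (suc q-1 · 1#)              ≡⟨ cong (λ r → 1# + q-1 · r) q×1 ⟩
    1# + q-1 · 0#                          ≡⟨ cong (1# +_) (trans (sym (sum-replicate q-1)) (sum-replicate-zero q-1)) ⟩
    1# + 0#                                ≡⟨ +-identityʳ 1# ⟩
    1#                                     ∎
    where
    q×1 : suc q-1 · 1# ≡ 0#
    q×1 = begin
      suc q-1 · 1#                    ≡⟨ sum-replicate (suc q-1) ⟨
      sum {suc q-1} (λ _ → 1#)        ≡⟨ sum-cong-≗ {suc q-1} (λ _ → ι.1#-homo) ⟨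
      sum {suc q-1} (λ _ → ι A.1#)    ≡⟨ ι-sum {suc q-1} (λ _ → A.1#) ⟨
      ι (AP.sum {suc q-1} (λ _ → A.1#)) ≡⟨ cong ι (FiniteField.sum-1 A A↔Fin) ⟩
      ι A.0#                          ≡⟨ ι.0#-homo ⟩
      0#                              ∎

  index : ∀ {x} → T x → Fin size
  index tx = proj₁ (torus-surjective tx)

  torus-index : ∀ {x} (tx : T x) → torus (index tx) ≡ x
  torus-index tx = proj₂ (torus-surjective tx)

  translation : ∀ {g} → T g → Permutation size size
  translation {g} tg = permutation
    (λ i → index (T-* tg (torus-T i)))
    (λ i → index (T-* (T-τ tg) (torus-T i)))
    (λ i → torus-injective (trans (torus-index _) (trans (cong (g *_) (torus-index _)) (cancel (τ-inverse tg)))))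
    (λ i → torus-injective (trans (torus-index _) (trans (cong (τ g *_) (torus-index _)) (cancel (trans (*-comm (τ g) g) (τ-inverse tg))))))
    where
    cancel : ∀ {g h x} → g * h ≡ 1# → g * (h * x) ≡ x
    cancel {x = x} eq = trans (sym (*-assoc _ _ x)) (trans (cong (_* x) eq) (*-identityˡ x))

  -- Multiplication by g permutes T and multiplies the sum by χ g.
  character-sum : (χ : Carrier → Carrier) → (∀ x y → χ (x * y) ≡ χ x * χ y) → ∀ {g} → T g → χ g ≢ 1# →
    sum (χ ∘ torus) ≡ 0#
  character-sum χ χ-* {g} tg χg≢1 = *-cancelˡ-0 (-≢0 χg≢1) (linear₁ 1#
    (solve 2 (λ c s → (c ⊖ con 1) ⊗ s ⊖ con 0 ⊜ con 1 ⊗ (c ⊗ s ⊖ s)) refl (χ g) (sum (χ ∘ torus)))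
    (begin
      χ g * sum (χ ∘ torus)                        ≡⟨ *-distribˡ-sum (χ g) (χ ∘ torus) ⟩
      sum (λ i → χ g * χ (torus i))                ≡⟨ sum-cong-≗ (λ i → χ-* g (torus i)) ⟨
      sum (λ i → χ (g * torus i))                  ≡⟨ sum-cong-≗ (λ i → cong χ (torus-index (T-* tg (torus-T i)))) ⟨
      sum (λ i → χ (torus (translation tg ⟨$⟩ʳ i)))  ≡⟨ sum-permute (χ ∘ torus) (translation tg) ⟨
      sum (χ ∘ torus)                              ∎))

  private
    -- Four elements are one more than t³ - 1 can have as roots.
    4≤size : 4 ℕ.≤ size
    4≤size = s≤s (ℕ.≤-trans 3≤q-1 (ℕ.m≤m*n q-1 (suc q-1)))

    g : Fin 4 → Carrier
    g i = torus (inject≤ i 4≤size)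

    g-T : ∀ i → T (g i)
    g-T i = torus-T (inject≤ i 4≤size)

    g-injective : Injective _≡_ _≡_ g
    g-injective = Fin.inject≤-injective 4≤size 4≤size _ _ ∘ torus-injective

    -- An element of T fixed by σ² has order dividing 3.
    σ²-moved : ∃ λ g → T g × σ² g ≢ g
    σ²-moved with Fin.any? (λ i → ¬? (σ² (g i) ≟ g i))
    ... | yes (i , moved) = g i , g-T i , moved
    ... | no none = contradiction (leading (too-many-roots (- 1# ∷ 0# ∷ 0# ∷ 1# ∷ []) g g-injective λ i →
        cube (g-T i) (decidable-stable (σ² (g i) ≟ g i) (λ moved → none (i , moved))))) 1≢0
      where
      leading : ∀ {a b c d : Carrier} → All (_≡ 0#) (a ∷ b ∷ c ∷ d ∷ []) → d ≡ 0#
      leading (_ ∷ _ ∷ _ ∷ p ∷ []) = p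
      cube : ∀ {x} → T x → σ² x ≡ x → - 1# + x * (0# + x * (0# + x * (1# + x * 0#))) ≡ 0#
      cube {x} tx fixed = linear₂ 1# (- x) (solve 2 (λ x y →
          ⊝ con 1 ⊕ x ⊗ (con 0 ⊕ x ⊗ (con 0 ⊕ x ⊗ (con 1 ⊕ x ⊗ con 0))) ⊖ con 0 ⊜
          con 1 ⊗ (x ⊗ y ⊖ con 1) ⊕ (⊝ x) ⊗ (y ⊖ x ⊗ x)) refl x (σ x))
        (trans (cong (λ r → x * r) (sym (trans (cong σ fixed) refl))) (τ-inverse tx))
        (trans (sym (twist tx)) (cong (x *_) fixed))

    g₁ : Carrier
    g₁ = g 1F

    g₁≢1 : g₁ ≢ 1#
    g₁≢1 eq = contradiction (g-injective {1F} {0F} eq) λ ()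

    sum-torus : sum torus ≡ 0#
    sum-torus = character-sum (λ x → x) (λ _ _ → refl) (g-T 1F) g₁≢1

    σ^ : ℕ → Carrier → Carrier
    σ^ zero    x = x
    σ^ (suc k) x = σ (σ^ k x)

    σ^-* : ∀ k x y → σ^ k (x * y) ≡ σ^ k x * σ^ k y
    σ^-* zero    x y = refl
    σ^-* (suc k) x y = trans (cong σ (σ^-* k x y)) (*-homo _ _)

    σ^-T : ∀ k {x} → T x → T (σ^ k x)
    σ^-T zero    tx = tx
    σ^-T (suc k) tx = T-σ (σ^-T k tx)

    sum-conjugates : ∀ k → sum (σ^ k ∘ torus) ≡ 0#
    sum-conjugates zero    = sum-torus
    sum-conjugates (suc k) = trans (sym (σ-sum (σ^ k ∘ torus))) (trans (cong σ (sum-conjugates k)) 0#-homo)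

    τσ^ : ∀ k x → τ (σ^ k x) ≡ σ^ k (τ x)
    τσ^ zero    x = refl
    τσ^ (suc k) x = cong σ (τσ^ k x)

    -- The character in question is y / σᵏy, which is 1 at x only if σᵏ fixes x. The witness depends
    -- on k: in T only 1 is fixed by σ or by τ, but σ² may also fix cube roots of unity.
    correlation : ∀ k {x} → T x → σ^ k x ≢ x → sum (λ i → torus i * σ^ k (τ (torus i))) ≡ 0#
    correlation k {x} tx moved = character-sum (λ y → y * σ^ k (τ y))
      (λ y z → trans (cong (y * z *_) (trans (cong (σ^ k) (τ-* y z)) (σ^-* k (τ y) (τ z))))
        (solve 4 (λ a b c d → a ⊗ b ⊗ (c ⊗ d) ⊜ a ⊗ c ⊗ (b ⊗ d)) refl y z (σ^ k (τ y)) (σ^ k (τ z))))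
      tx
      (λ eq → moved (sym (*-cancelˡ (nonZero (T-τ (σ^-T k tx))) (begin
        τ (σ^ k x) * x           ≡⟨ *-comm _ x ⟩
        x * τ (σ^ k x)           ≡⟨ cong (x *_) (τσ^ k x) ⟩
        x * σ^ k (τ x)           ≡⟨ eq ⟩
        1#                       ≡⟨ τ-inverse (σ^-T k tx) ⟨
        σ^ k x * τ (σ^ k x)      ≡⟨ *-comm _ _ ⟩
        τ (σ^ k x) * σ^ k x      ∎))))

    correlations : ∀ k → sum (λ i → torus i * σ^ (suc (toℕ {5} k)) (τ (torus i))) ≡ 0#
    correlations 0F = correlation 1 (g-T 1F) (λ eq → g₁≢1 (σ-fixed-1 (g-T 1F) eq))
    correlations 1F = let x , tx , moved = σ²-moved in correlation 2 tx moved
    correlations 2F = correlation 3 (g-T 1F) (λ eq → g₁≢1 (τ-fixed-1 (g-T 1F) eq))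
    correlations 3F = let x , tx , moved = σ²-moved in correlation 4 tx λ eq → moved (trans (cong σ² (sym eq)) (σ⁶ x))
    correlations 4F = correlation 5 (g-T 1F) (λ eq → g₁≢1 (σ-fixed-1 (g-T 1F) (trans (cong σ (sym eq)) (σ⁶ g₁))))

  trace : Carrier → Carrier
  trace y = y + σ y + σ² y + τ y + σ (τ y) + σ² (τ y)

  private
    σ-trace : ∀ y → σ (trace y) ≡ trace y
    σ-trace y = begin
      σ (trace y)
        ≡⟨ trans (+-homo _ _) (cong (_+ σ (σ² (τ y))) (trans (+-homo _ _) (cong (_+ σ² (τ y)) (trans (+-homo _ _) (cong (_+ σ (τ y))
             (trans (+-homo _ _) (cong (_+ τ y) (+-homo _ _)))))))) ⟩
      σ y + σ² y + τ y + σ (τ y) + σ² (τ y) + τ (τ y)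
        ≡⟨ cong (σ y + σ² y + τ y + σ (τ y) + σ² (τ y) +_) (σ⁶ y) ⟩
      σ y + σ² y + τ y + σ (τ y) + σ² (τ y) + y
        ≡⟨ solve 6 (λ a b c d e f → b ⊕ c ⊕ d ⊕ e ⊕ f ⊕ a ⊜ a ⊕ b ⊕ c ⊕ d ⊕ e ⊕ f) refl y (σ y) (σ² y) (τ y) (σ (τ y)) (σ² (τ y)) ⟩
      trace y ∎

  -- The function c + trace (b / x) on T. Its terms are the constant and the conjugates of 1/x; by
  -- orthogonality, summation against 1 extracts c and summation against x extracts b.
  coefficient : A.Carrier → Carrier → Fin size → A.Carrier
  coefficient c b i = c A.+ proj₁ (σ-fixed _ (σ-trace (b * τ (torus i))))

  private
    module _ (c : A.Carrier) (b : Carrier) where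

      conjugates : Fin 6 → Carrier → Carrier
      conjugates k x = σ^ (toℕ k) b * σ^ (toℕ k) (τ x)

      ι-coefficient : ∀ i → ι (coefficient c b i) ≡ ι c + sum (λ k → conjugates k (torus i))
      ι-coefficient i = trans (ι.+-homo c _) (cong (ι c +_) (trans (sym (proj₂ (σ-fixed _ (σ-trace (b * τ (torus i)))))) (begin
        y + σ y + σ² y + τ y + σ (τ y) + σ² (τ y)
          ≡⟨ solve 6 (λ a b c d e f → a ⊕ b ⊕ c ⊕ d ⊕ e ⊕ f ⊜ a ⊕ (b ⊕ (c ⊕ (d ⊕ (e ⊕ (f ⊕ con 0)))))) refl y (σ y) (σ² y) (τ y) (σ (τ y)) (σ² (τ y)) ⟩
        sum (λ k → σ^ (toℕ {6} k) y)
          ≡⟨ sum-cong-≗ {6} (λ k → σ^-* (toℕ k) b (τ (torus i))) ⟩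
        sum (λ k → conjugates k (torus i)) ∎)))
        where
        y = b * τ (torus i)

      expand : ∀ (f : Fin size → Carrier) → sum (λ i → ι (coefficient c b i) * f i) ≡
        ι c * sum f + sum {6} (λ k → σ^ (toℕ k) b * sum (λ i → f i * σ^ (toℕ k) (τ (torus i))))
      expand f = begin
        sum (λ i → ι (coefficient c b i) * f i)
          ≡⟨ sum-cong-≗ (λ i → trans (cong (_* f i) (ι-coefficient i)) (distribʳ (f i) (ι c) _)) ⟩
        sum (λ i → ι c * f i + sum (λ k → conjugates k (torus i)) * f i)
          ≡⟨ ∑-distrib-+ (λ i → ι c * f i) (λ i → sum (λ k → conjugates k (torus i)) * f i) ⟩
        sum (λ i → ι c * f i) + sum (λ i → sum (λ k → conjugates k (torus i)) * f i)
          ≡⟨ cong₂ _+_ (sym (*-distribˡ-sum (ι c) f)) (begin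
               sum (λ i → sum (λ k → conjugates k (torus i)) * f i)
                 ≡⟨ sum-cong-≗ (λ i → *-distribʳ-sum {6} (f i) (λ k → conjugates k (torus i))) ⟩
               sum (λ i → sum (λ k → conjugates k (torus i) * f i))
                 ≡⟨ ∑-comm {size} {6} (λ i k → conjugates k (torus i) * f i) ⟩
               sum (λ k → sum (λ i → conjugates k (torus i) * f i))
                 ≡⟨ sum-cong-≗ {6} (λ k → trans
                      (sum-cong-≗ (λ i → solve 3 (λ a b c → a ⊗ b ⊗ c ⊜ a ⊗ (c ⊗ b)) refl (σ^ (toℕ k) b) (σ^ (toℕ k) (τ (torus i))) (f i)))
                      (sym (*-distribˡ-sum (σ^ (toℕ k) b) (λ i → f i * σ^ (toℕ k) (τ (torus i)))))) ⟩
               sum {6} (λ k → σ^ (toℕ k) b * sum (λ i → f i * σ^ (toℕ k) (τ (torus i)))) ∎) ⟩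
        ι c * sum f + sum {6} (λ k → σ^ (toℕ k) b * sum (λ i → f i * σ^ (toℕ k) (τ (torus i)))) ∎

  -- Fourier inversion on T, whose order q² - q + 1 is 1 in K.
  fourier-weights : ∀ c b → sum (λ i → ι (coefficient c b i)) ≡ ι c
  fourier-weights c b = begin
    sum (λ i → ι (coefficient c b i))
      ≡⟨ sum-cong-≗ (λ i → *-identityʳ (ι (coefficient c b i))) ⟨
    sum (λ i → ι (coefficient c b i) * 1#)
      ≡⟨ expand c b (λ _ → 1#) ⟩
    ι c * sum {size} (λ _ → 1#) + sum {6} (λ k → σ^ (toℕ k) b * sum (λ i → 1# * σ^ (toℕ k) (τ (torus i))))
      ≡⟨ cong₂ _+_ (trans (cong (ι c *_) size×1) (*-identityʳ (ι c))) (sum-zero {6} _ λ k →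
           trans (cong (σ^ (toℕ k) b *_) (trans
             (sum-cong-≗ λ i → trans (*-identityˡ _) (σ^-3 (toℕ k) (torus i)))
             (sum-conjugates (toℕ k ℕ.+ 3)))) (zeroʳ _)) ⟩
    ι c + 0#
      ≡⟨ +-identityʳ (ι c) ⟩
    ι c ∎
    where
    σ^-3 : ∀ k x → σ^ k (τ x) ≡ σ^ (k ℕ.+ 3) x
    σ^-3 zero    x = refl
    σ^-3 (suc k) x = cong σ (σ^-3 k x)

  fourier-combined : ∀ c b → sum (λ i → ι (coefficient c b i) * torus i) ≡ b
  fourier-combined c b = begin
    sum (λ i → ι (coefficient c b i) * torus i)
      ≡⟨ expand c b torus ⟩
    ι c * sum torus + (b * sum (λ i → torus i * τ (torus i)) + sum {5} (λ k → σ^ (suc (toℕ k)) b * sum (λ i → torus i * σ^ (suc (toℕ k)) (τ (torus i)))))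
      ≡⟨ cong₂ _+_ (trans (cong (ι c *_) sum-torus) (zeroʳ (ι c)))
           (cong₂ _+_ (trans (cong (b *_) (trans (sum-cong-≗ λ i → τ-inverse (torus-T i)) size×1)) (*-identityʳ b))
             (sum-zero {5} _ λ k → trans (cong (σ^ (suc (toℕ k)) b *_) (correlations k)) (zeroʳ _))) ⟩
    0# + (b + 0#)
      ≡⟨ trans (+-identityˡ _) (+-identityʳ b) ⟩
    b ∎

-- The pigeonhole principle for vectors over a finite field.

complement : ∀ k {m n} → n ≡ k ℕ.+ m → (g : Fin k → Fin n) → Injective _≡_ _≡_ g →
  ∃ λ (h : Fin m → Fin n) → Injective _≡_ _≡_ h × (∀ i j → h i ≢ g j)
complement zero        refl g g-inj = id , id , λ i ()
complement (suc k) {m} refl g g-inj = h , h-injective , avoids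
  where
  0≢ : ∀ j → g zero ≢ g (suc j)
  0≢ j eq = contradiction (g-inj eq) λ ()

  rec : ∃ λ (h : Fin m → Fin (k ℕ.+ m)) → Injective _≡_ _≡_ h × (∀ i j → h i ≢ punchOut (0≢ j))
  rec = complement k refl (λ j → punchOut (0≢ j))
    (λ eq → Fin.suc-injective (g-inj (Fin.punchOut-injective (0≢ _) (0≢ _) eq)))

  h : Fin m → Fin (suc k ℕ.+ m)
  h = punchIn (g zero) ∘ proj₁ rec

  h-injective : Injective _≡_ _≡_ h
  h-injective eq = proj₁ (proj₂ rec) (Fin.punchIn-injective _ _ _ eq)

  avoids : ∀ i j → h i ≢ g j
  avoids i zero    eq = Fin.punchInᵢ≢i (g zero) _ eq
  avoids i (suc j) eq = proj₂ (proj₂ rec) i j (Fin.punchIn-injective (g zero) _ _ (trans eq (sym (Fin.punchIn-punchOut (0≢ j)))))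

funToFin-cong : ∀ {m n} {f g : Fin m → Fin n} → (∀ i → f i ≡ g i) → funToFin f ≡ funToFin g
funToFin-cong {zero}  f≗g = refl
funToFin-cong {suc m} f≗g = cong₂ combine (f≗g zero) (funToFin-cong (f≗g ∘ suc))

finToFun-injective : ∀ {m n} {k l : Fin (m ^ n)} → (∀ i → finToFun {m} {n} k i ≡ finToFun l i) → k ≡ l
finToFun-injective {m} {n} {k} {l} eq = trans (sym (Fin.funToFin-finToFin {n} {m} k)) (trans (funToFin-cong {n} {m} eq) (Fin.funToFin-finToFin {n} {m} l))

funToFin-injective : ∀ {m n} {f g : Fin m → Fin n} → funToFin f ≡ funToFin g → ∀ i → f i ≡ g i
funToFin-injective {f = f} {g} eq i = trans (sym (Fin.finToFun-funToFin f i))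
  (trans (cong (λ k → finToFun k i) eq) (Fin.finToFun-funToFin g i))

module Counting (A : Field) {q-1 : ℕ} (A↔Fin : Fin (suc q-1) ↔ Field.Carrier A) where

  open Field A
  open FieldProperties A
  open FiniteScalars A A↔Fin
  open Inverse A↔Fin using (to; from; strictlyInverseˡ; strictlyInverseʳ)

  private
    q = suc q-1

  -- The vectors d y j + Σ c v with d nonzero are too many to be different in
  -- F ^ n, even if they are coloured with b colours according to j.
  coincidence : ∀ {n k m b} (v : Fin k → Fin n → Carrier) (y : Fin m → Fin n → Carrier) (colour : Fin m → Fin b) →
    b ℕ.* q ^ n < m ℕ.* (q-1 ℕ.* q ^ k) →
    (∀ j d c → (∀ i → sum (λ l → c l * v l i) + d * y j i ≡ 0#) → d ≡ 0# × (∀ l → c l ≡ 0#)) →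
    ∃₂ λ j j′ → ∃₂ λ d d′ → ∃ λ (c : Fin k → Carrier) → j ≢ j′ × colour j ≡ colour j′ × d ≢ 0# × d′ ≢ 0# ×
      (∀ i → sum (λ l → c l * v l i) + (d * y j i - d′ * y j′ i) ≡ 0#)
  coincidence {n} {k} {m} {b} v y colour few independent = J p , J p′ , D p , D p′ , (λ l → C p l - C p′ l) ,
    j≢j′ , proj₁ images , nonzero-≢0 _ , nonzero-≢0 _ , relation
    where
    domain = m ℕ.* (q-1 ℕ.* q ^ k)

    rest : Fin domain → Fin (q-1 ℕ.* q ^ k)
    rest p = remainder {m} (q-1 ℕ.* q ^ k) p

    J : Fin domain → Fin m
    J p = quotient {m} (q-1 ℕ.* q ^ k) p

    D : Fin domain → Carrier
    D p = nonzero (quotient {q-1} (q ^ k) (rest p))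

    C : Fin domain → Fin k → Carrier
    C p l = to (finToFun (remainder {q-1} (q ^ k) (rest p)) l)

    vector : Fin domain → Fin n → Carrier
    vector p i = sum (λ l → C p l * v l i) + D p * y (J p) i

    image : Fin domain → Fin (b ℕ.* q ^ n)
    image p = combine (colour (J p)) (funToFin (λ i → from (vector p i)))

    collision = Fin.pigeonhole few image

    p  = proj₁ collision
    p′ = proj₁ (proj₂ collision)

    images : colour (J p) ≡ colour (J p′) × funToFin (λ i → from (vector p i)) ≡ funToFin (λ i → from (vector p′ i))
    images = Fin.combine-injective _ _ _ _ (proj₂ (proj₂ (proj₂ collision)))

    vectors : ∀ i → vector p i ≡ vector p′ i
    vectors i = trans (sym (strictlyInverseˡ _)) (trans (cong to (funToFin-injective (proj₂ images) i)) (strictlyInverseˡ _))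

    difference : ∀ i → sum (λ l → (C p l - C p′ l) * v l i) ≡ sum (λ l → C p l * v l i) - sum (λ l → C p′ l * v l i)
    difference i = begin
      sum (λ l → (C p l - C p′ l) * v l i)
        ≡⟨ sum-cong-≗ (λ l → solve 3 (λ a b v → (a ⊖ b) ⊗ v ⊜ a ⊗ v ⊕ ⊝ con 1 ⊗ (b ⊗ v)) refl (C p l) (C p′ l) (v l i)) ⟩
      sum (λ l → C p l * v l i + - 1# * (C p′ l * v l i))
        ≡⟨ ∑-distrib-+ (λ l → C p l * v l i) (λ l → - 1# * (C p′ l * v l i)) ⟩
      sum (λ l → C p l * v l i) + sum (λ l → - 1# * (C p′ l * v l i))
        ≡⟨ cong (sum (λ l → C p l * v l i) +_) (*-distribˡ-sum (- 1#) (λ l → C p′ l * v l i)) ⟨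
      sum (λ l → C p l * v l i) + - 1# * sum (λ l → C p′ l * v l i)
        ≡⟨ solve 2 (λ a b → a ⊕ ⊝ con 1 ⊗ b ⊜ a ⊖ b) refl _ _ ⟩
      sum (λ l → C p l * v l i) - sum (λ l → C p′ l * v l i) ∎

    relation : ∀ i → sum (λ l → (C p l - C p′ l) * v l i) + (D p * y (J p) i - D p′ * y (J p′) i) ≡ 0#
    relation i = trans (cong (_+ (D p * y (J p) i - D p′ * y (J p′) i)) (difference i)) (linear₁ 1#
      (solve 4 (λ s s′ u u′ → s ⊖ s′ ⊕ (u ⊖ u′) ⊖ con 0 ⊜ con 1 ⊗ (s ⊕ u ⊖ (s′ ⊕ u′))) refl
        (sum (λ l → C p l * v l i)) (sum (λ l → C p′ l * v l i)) (D p * y (J p) i) (D p′ * y (J p′) i)) (vectors i))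

    -- For equal indices, the difference of the two vectors is a relation of v with a single y,
    -- whose coefficients vanish by `independent`; then p and p′ agree in all components.
    j≢j′ : J p ≢ J p′
    j≢j′ J≡ = Fin.<⇒≢ (proj₁ (proj₂ (proj₂ collision))) (begin
      p                          ≡⟨ Fin.combine-remQuot {m} (q-1 ℕ.* q ^ k) p ⟨
      combine (J p) (rest p)     ≡⟨ cong₂ (combine {m}) J≡ rest≡ ⟩
      combine (J p′) (rest p′)   ≡⟨ Fin.combine-remQuot {m} (q-1 ℕ.* q ^ k) p′ ⟩
      p′                         ∎)
      where
      zeros = independent (J p) (D p - D p′) (λ l → C p l - C p′ l) λ i → trans
        (cong (sum (λ l → (C p l - C p′ l) * v l i) +_) (trans
          (solve 3 (λ a b y → (a ⊖ b) ⊗ y ⊜ a ⊗ y ⊖ b ⊗ y) refl (D p) (D p′) (y (J p) i))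
          (cong (λ j → D p * y (J p) i - D p′ * y j i) J≡)))
        (relation i)
      rest≡ : rest p ≡ rest p′
      rest≡ = begin
        rest p
          ≡⟨ Fin.combine-remQuot {q-1} (q ^ k) (rest p) ⟨
        combine (quotient {q-1} (q ^ k) (rest p)) (remainder {q-1} (q ^ k) (rest p))
          ≡⟨ cong₂ (combine {q-1})
               (nonzero-injective (x-y≈0⇒x≈y _ _ (proj₁ zeros)))
               (finToFun-injective {q} {k} (λ l → to-injective (x-y≈0⇒x≈y _ _ (proj₂ zeros l)))) ⟩
        combine (quotient {q-1} (q ^ k) (rest p′)) (remainder {q-1} (q ^ k) (rest p′))
          ≡⟨ Fin.combine-remQuot {q-1} (q ^ k) (rest p′) ⟩
        rest p′ ∎

open +-*-Solver using (_:=_; _:+_; _:*_) renaming (solve to solveℕ; con to conℕ)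

-- Relations between points in coordinates over F.

module Coordinates {A : Field} (E : Extension A) where

  private
    module A = Field A
    module AP = FieldProperties A
  open Extension E hiding (σ²; τ)
  open FieldProperties K
  open Torus cyclicSextic
  open T
  open Relation
  open SevenPoints cyclicSextic
  open Parametrisation E using (ι-sum)
  private module ι = IsRingHomomorphism ι-homo

  ι-≡0 : ∀ {s} → ι s ≡ 0# → s ≡ A.0#
  ι-≡0 {s} eq = proj₁ (ι-w-unique (cong (_+ ι A.0# * w) (trans eq (sym ι.0#-homo))))

  coordinate-0 : ∀ k → coordinate 0# k ≡ A.0#
  coordinate-0 k = trans (cong (λ x → coordinate x k) (trans (sym (zeroˡ 0#)) (cong (_* 0#) (sym ι.0#-homo))))
    (trans (coordinate-* A.0# 0# k) (A.zeroˡ _))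

  coordinate-sum : ∀ {n} (c : Fin n → A.Carrier) (x : Fin n → Carrier) k →
    coordinate (sum (λ i → ι (c i) * x i)) k ≡ AP.sum (λ i → c i A.* coordinate (x i) k)
  coordinate-sum {zero}  c x k = coordinate-0 k
  coordinate-sum {suc n} c x k = trans (coordinate-+ _ _ k)
    (cong₂ A._+_ (coordinate-* (c zero) (x zero) k) (coordinate-sum (c ∘ suc) (x ∘ suc) k))

  homogeneous : Carrier → Fin 7 → A.Carrier
  homogeneous x zero    = A.1#
  homogeneous x (suc k) = coordinate x k

  relation : ∀ {n} {c : Fin n → A.Carrier} {x : Fin n → Carrier} →
    (∀ k → AP.sum (λ i → c i A.* homogeneous (x i) k) ≡ A.0#) → Relation (ι ∘ c) x
  relation {c = c} {x} eq = record
    { fixed    = λ i → σ-ι (c i)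
    ; weights  = trans (sym (ι-sum c)) (trans (cong ι (trans (AP.sum-cong-≗ (λ i → sym (A.*-identityʳ (c i)))) (eq zero))) ι.0#-homo)
    ; combined = coordinate-injective _ _ λ k → trans (coordinate-sum c x k) (trans (eq (suc k)) (sym (coordinate-0 k)))
    }

  relation⁻¹ : ∀ {n} {c : Fin n → A.Carrier} {x : Fin n → Carrier} → Relation (ι ∘ c) x →
    ∀ k → AP.sum (λ i → c i A.* homogeneous (x i) k) ≡ A.0#
  relation⁻¹ {c = c} {x} r zero    = trans (AP.sum-cong-≗ (λ i → A.*-identityʳ (c i))) (ι-≡0 (trans (ι-sum c) (weights r)))
  relation⁻¹ {c = c} {x} r (suc k) = trans (sym (coordinate-sum c x k)) (trans (cong (λ y → coordinate y k) (combined r)) (coordinate-0 k))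

  InSpan : ∀ {n} → Carrier → (Fin n → Carrier) → Set
  InSpan {n} u p = ∃ λ (c : Fin n → A.Carrier) → ∀ k → homogeneous u k ≡ AP.sum (λ l → c l A.* homogeneous (p l) k)

  Independent : ∀ {n} → (Fin n → Carrier) → Set
  Independent {n} p = ∀ (c : Fin n → A.Carrier) → Relation (ι ∘ c) p → ∀ l → c l ≡ A.0#

  member-inSpan : ∀ {n} (p : Fin n → Carrier) l → InSpan (p l) p
  member-inSpan p l = δ , λ k → sym (trans
    (AP.sum-single (λ j → δ j A.* homogeneous (p j) k) l (λ j j≢l → trans (cong (A._* homogeneous (p j) k) (δ-off j j≢l)) (A.zeroˡ _)))
    (trans (cong (A._* homogeneous (p l) k) δ-on) (A.*-identityˡ _)))
    where
    δ : Fin _ → A.Carrier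
    δ j = if does (j Fin.≟ l) then A.1# else A.0#
    δ-off : ∀ j → j ≢ l → δ j ≡ A.0#
    δ-off j j≢l = cong (λ b → if b then A.1# else A.0#) (dec-false (j Fin.≟ l) j≢l)
    δ-on : δ l ≡ A.1#
    δ-on = cong (λ b → if b then A.1# else A.0#) (dec-true (l Fin.≟ l) refl)

  solved-inSpan : ∀ {n} {p : Fin n → Carrier} {u d} {c : Fin n → A.Carrier} → d ≢ A.0# →
    (∀ k → d A.* homogeneous u k A.+ AP.sum (λ l → c l A.* homogeneous (p l) k) ≡ A.0#) → InSpan u p
  solved-inSpan {p = p} {u} {d} {c} d≢0 eq = (λ l → A.- (d A.⁻¹) A.* c l) , λ k → AP.*-cancelˡ d≢0 (begin
    d A.* homogeneous u k
      ≡⟨ AP.linear₂ A.1# (AP.sum (λ l → c l A.* homogeneous (p l) k)) (AP.solve 3 (λ u s i → u ⊖ (⊝ i) ⊗ s ⊜ con 1 ⊗ (u ⊕ s ⊖ con 0) ⊕ s ⊗ (i ⊖ con 1)) refl _ _ _) (eq k) (A.*-inverseʳ d≢0) ⟩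
    A.- (d A.* d A.⁻¹) A.* AP.sum (λ l → c l A.* homogeneous (p l) k)
      ≡⟨ AP.solve 3 (λ d i s → ⊝ (d ⊗ i) ⊗ s ⊜ d ⊗ (⊝ i ⊗ s)) refl d (d A.⁻¹) _ ⟩
    d A.* (A.- (d A.⁻¹) A.* AP.sum (λ l → c l A.* homogeneous (p l) k))
      ≡⟨ cong (d A.*_) (trans (AP.*-distribˡ-sum (A.- (d A.⁻¹)) (λ l → c l A.* homogeneous (p l) k))
           (AP.sum-cong-≗ (λ l → sym (A.*-assoc (A.- (d A.⁻¹)) (c l) (homogeneous (p l) k))))) ⟩
    d A.* AP.sum (λ l → A.- (d A.⁻¹) A.* c l A.* homogeneous (p l) k) ∎)

  five-points : {x : Fin 5 → Carrier} → (∀ i → T (x i)) → Injective _≡_ _≡_ x → Independent x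
  five-points tx x-inj c r l = ι-≡0 (five-independent r tx x-inj l)

  record SixDependent : Set where
    field
      x           : Fin 6 → Carrier
      x-T         : ∀ i → T (x i)
      x-injective : Injective _≡_ _≡_ x
      a           : Fin 6 → A.Carrier
      a-relation  : Relation (ι ∘ a) x
      a-nonzero   : ∃ λ i → a i ≢ A.0#

    all-nonzero : ∀ i → a i ≢ A.0#
    all-nonzero i ai≡0 = proj₂ a-nonzero (zeros (proj₁ a-nonzero))
      where
      zeros : ∀ j → a j ≡ A.0#
      zeros j with i Fin.≟ j
      ... | yes refl = ai≡0
      ... | no i≢j   = trans (cong a (sym (Fin.punchIn-punchOut i≢j)))
        (five-points (x-T ∘ punchIn i) (λ eq → Fin.punchIn-injective i _ _ (x-injective eq))
          (a ∘ punchIn i) (relation-punchIn i (trans (cong ι ai≡0) ι.0#-homo) a-relation) (punchOut i≢j))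

    five-inSpan : ∀ i → InSpan (x i) (x ∘ suc)
    five-inSpan zero    = solved-inSpan {p = x ∘ suc} {x zero} {c = a ∘ suc} (all-nonzero 0F) (relation⁻¹ a-relation)
    five-inSpan (suc l) = member-inSpan (x ∘ suc) l

    -- Otherwise there would be two relations between y and the points x i.
    sixth-independent : ∀ {y} → T y → (∀ i → y ≢ x i) → Independent (y Vector.∷ x ∘ suc)
    sixth-independent {y} ty y≢x c r l = decidable-stable (c l A.≟ A.0#) λ cl≢0 →
      -- The relation of the six points is zero at y and the assumed relation is zero at x₀, as
      -- required of the first two positions.
      seven-points {y Vector.∷ x} {0# Vector.∷ ι ∘ a} {ι (c zero) Vector.∷ 0# Vector.∷ ι ∘ c ∘ suc}
        (λ { zero → ty ; (suc i) → x-T i }) (injective _ _)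
        (record
          { fixed    = λ { zero → 0-fixed ; (suc i) → σ-ι (a i) }
          ; weights  = trans (+-identityˡ _) (weights a-relation)
          ; combined = trans (cong (_+ sum (λ i → ι (a i) * x i)) (zeroˡ y)) (trans (+-identityˡ _) (combined a-relation)) })
        (record
          { fixed    = λ { zero → σ-ι _ ; (suc zero) → 0-fixed ; (suc (suc i)) → σ-ι _ }
          ; weights  = trans (cong (ι (c zero) +_) (+-identityˡ _)) (weights r)
          ; combined = trans (cong (λ s → ι (c zero) * y + s) (trans (cong (_+ sum (λ i → ι (c (suc i)) * x (suc i))) (zeroˡ (x zero))) (+-identityˡ _))) (combined r) })
        refl refl
        (1F , λ eq → all-nonzero 0F (ι-≡0 eq))
        (some l cl≢0)
      where
      0-fixed : σ 0# ≡ 0#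
      0-fixed = trans (cong σ (sym ι.0#-homo)) (trans (σ-ι A.0#) ι.0#-homo)

      injective : ∀ i j → (y Vector.∷ x) i ≡ (y Vector.∷ x) j → i ≡ j
      injective zero    zero    eq = refl
      injective zero    (suc j) eq = contradiction eq (y≢x j)
      injective (suc i) zero    eq = contradiction (sym eq) (y≢x i)
      injective (suc i) (suc j) eq = cong suc (x-injective eq)

      some : ∀ l → c l ≢ A.0# → ∃ λ i → (ι (c zero) Vector.∷ 0# Vector.∷ ι ∘ c ∘ suc) i ≢ 0#
      some zero    cl≢0 = 0F , λ eq → cl≢0 (ι-≡0 eq)
      some (suc l) cl≢0 = suc (suc l) , λ eq → cl≢0 (ι-≡0 eq)

  -- The witness for a (6,4)-set: 2 + 6 points in a subspace of projective dimension five, spanned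
  -- by six of its points.
  record EightPoints : Set where
    field
      basis             : Fin 6 → Carrier
      basis-T           : ∀ i → T (basis i)
      basis-independent : Independent basis
      points            : Fin 8 → Carrier
      points-T          : ∀ i → T (points i)
      points-injective  : Injective _≡_ _≡_ points
      points-inSpan     : ∀ i → InSpan (points i) basis

-- Eight points in a hyperplane.

module Hyperplane {A : Field} (E : Extension A) (r : ℕ) (A↔Fin : Fin (4 ℕ.+ r) ↔ Field.Carrier A) where

  private
    module A = Field A
    module AP = FieldProperties A
  open Extension E hiding (σ²; τ)
  open Torus cyclicSextic
  open Coordinates E
  open Parametrisation.Enumeration E A↔Fin
  open Counting A A↔Fin

  private
    m : ℕ
    m = 7 ℕ.+ 7 ℕ.* r ℕ.+ r ℕ.* r

    size≡6+m : size ≡ 6 ℕ.+ m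
    size≡6+m = solveℕ 1 (λ r → conℕ 1 :+ (conℕ 3 :+ r) :* (conℕ 4 :+ r) := conℕ 6 :+ (conℕ 7 :+ conℕ 7 :* r :+ r :* r)) refl r

    -- After division by the fifth power of q this is q² < (q² - q - 5)(q - 1), for q = 4 the
    -- inequality 16 < 21.
    few : 1 ℕ.* (4 ℕ.+ r) ^ 7 ℕ.< m ℕ.* ((3 ℕ.+ r) ℕ.* (4 ℕ.+ r) ^ 5)
    few = ≡.subst₂ ℕ._<_
      (solveℕ 2 (λ q p → q :* q :* p := conℕ 1 :* (q :* (q :* p))) refl (4 ℕ.+ r) ((4 ℕ.+ r) ^ 5))
      (ℕ.*-assoc m (3 ℕ.+ r) ((4 ℕ.+ r) ^ 5))
      (ℕ.*-monoˡ-< ((4 ℕ.+ r) ^ 5) {{ℕ.m^n≢0 (4 ℕ.+ r) 5}} (ℕ.≤-trans (ℕ.m≤m+n (suc ((4 ℕ.+ r) ℕ.* (4 ℕ.+ r))) (4 ℕ.+ 20 ℕ.* r ℕ.+ 9 ℕ.* (r ℕ.* r) ℕ.+ r ℕ.* r ℕ.* r))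
        (ℕ.≤-reflexive (solveℕ 1 (λ r → conℕ 1 :+ (conℕ 4 :+ r) :* (conℕ 4 :+ r) :+ (conℕ 4 :+ conℕ 20 :* r :+ conℕ 9 :* (r :* r) :+ r :* r :* r) :=
          (conℕ 7 :+ conℕ 7 :* r :+ r :* r) :* (conℕ 3 :+ r)) refl r))))

  -- Five of the six dependent points span the sixth. The coincidence between two further points y j
  -- and y j′ modulo these five puts y j′ into the hyperplane spanned by them and y j.
  eight-points : SixDependent → EightPoints
  eight-points six = record
    { basis             = y j Vector.∷ x ∘ suc
    ; basis-T           = λ { zero → y-T j ; (suc l) → x-T (suc l) }
    ; basis-independent = sixth-independent (y-T j) (y≢x j)
    ; points            = y j′ Vector.∷ x zero Vector.∷ y j Vector.∷ x ∘ suc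
    ; points-T          = λ { zero → y-T j′ ; (suc zero) → x-T zero ; (suc (suc zero)) → y-T j ; (suc (suc (suc l))) → x-T (suc l) }
    ; points-injective  = injective _ _
    ; points-inSpan     = λ
      { zero             → solved-inSpan {p = y j Vector.∷ x ∘ suc} {y j′} {c = d Vector.∷ c} (d′≢0 ∘ AP.neg-≡0) λ k → AP.linear₁ A.1#
          (AP.solve 5 (λ d′ y′ d y s → ⊝ d′ ⊗ y′ ⊕ (d ⊗ y ⊕ s) ⊖ con 0 ⊜ con 1 ⊗ (s ⊕ (d ⊗ y ⊖ d′ ⊗ y′) ⊖ con 0)) refl
            d′ (homogeneous (y j′) k) d (homogeneous (y j) k) (AP.sum (λ l → c l A.* homogeneous (x (suc l)) k)))
          (found k)
      ; (suc zero)       → solved-inSpan {p = y j Vector.∷ x ∘ suc} {x zero} {c = A.0# Vector.∷ a ∘ suc} (all-nonzero zero) λ k → AP.linear₁ A.1#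
          (AP.solve 3 (λ u h s → u ⊕ (con 0 ⊗ h ⊕ s) ⊖ con 0 ⊜ con 1 ⊗ (u ⊕ s ⊖ con 0)) refl
            (a zero A.* homogeneous (x zero) k) (homogeneous (y j) k) (AP.sum (λ l → a (suc l) A.* homogeneous (x (suc l)) k)))
          (relation⁻¹ a-relation k)
      ; (suc (suc l))    → member-inSpan (y j Vector.∷ x ∘ suc) l }
    }
    where
    open SixDependent six

    index : Fin 6 → Fin size
    index i = proj₁ (torus-surjective (x-T i))

    torus-index : ∀ i → torus (index i) ≡ x i
    torus-index i = proj₂ (torus-surjective (x-T i))

    others = complement 6 {m} size≡6+m index
      (λ {i} {j} eq → x-injective (trans (sym (torus-index i)) (trans (cong torus eq) (torus-index j))))

    y : Fin m → Carrier
    y j = torus (proj₁ others j)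

    y-T : ∀ j → T (y j)
    y-T j = torus-T (proj₁ others j)

    y≢x : ∀ j i → y j ≢ x i
    y≢x j i eq = proj₂ (proj₂ others) j i (torus-injective (trans eq (sym (torus-index i))))

    pair = coincidence {7} {5} {m} {1} (λ l → homogeneous (x (suc l))) (homogeneous ∘ y) (λ _ → zero) few
      λ j d c eq →
        let zeros = sixth-independent (y-T j) (y≢x j) (d Vector.∷ c) (relation λ k → trans (A.+-comm _ _) (eq k))
        in zeros zero , zeros ∘ suc

    j  = proj₁ pair
    j′ = proj₁ (proj₂ pair)
    d  = proj₁ (proj₂ (proj₂ pair))
    d′ = proj₁ (proj₂ (proj₂ (proj₂ pair)))
    c  = proj₁ (proj₂ (proj₂ (proj₂ (proj₂ pair))))
    facts = proj₂ (proj₂ (proj₂ (proj₂ (proj₂ pair))))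
    j≢j′ = proj₁ facts
    d′≢0 = proj₁ (proj₂ (proj₂ (proj₂ facts)))
    found = proj₂ (proj₂ (proj₂ (proj₂ facts)))

    y≢y′ : y j ≢ y j′
    y≢y′ eq = j≢j′ (proj₁ (proj₂ others) (torus-injective eq))

    injective : ∀ i i′ → (y j′ Vector.∷ x zero Vector.∷ y j Vector.∷ x ∘ suc) i ≡ (y j′ Vector.∷ x zero Vector.∷ y j Vector.∷ x ∘ suc) i′ → i ≡ i′
    injective zero zero eq = refl
    injective zero (suc zero) eq = contradiction eq (y≢x j′ zero)
    injective zero (suc (suc zero)) eq = contradiction (sym eq) y≢y′
    injective zero (suc (suc (suc l))) eq = contradiction eq (y≢x j′ (suc l))
    injective (suc zero) zero eq = contradiction (sym eq) (y≢x j′ zero)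
    injective (suc zero) (suc zero) eq = refl
    injective (suc zero) (suc (suc zero)) eq = contradiction (sym eq) (y≢x j zero)
    injective (suc zero) (suc (suc (suc l))) eq = contradiction (x-injective eq) λ ()
    injective (suc (suc zero)) zero eq = contradiction eq y≢y′
    injective (suc (suc zero)) (suc zero) eq = contradiction eq (y≢x j zero)
    injective (suc (suc zero)) (suc (suc zero)) eq = refl
    injective (suc (suc zero)) (suc (suc (suc l))) eq = contradiction eq (y≢x j (suc l))
    injective (suc (suc (suc l))) zero eq = contradiction (sym eq) (y≢x j′ (suc l))
    injective (suc (suc (suc l))) (suc zero) eq = contradiction (x-injective eq) λ ()
    injective (suc (suc (suc l))) (suc (suc zero)) eq = contradiction (sym eq) (y≢x j (suc l))
    injective (suc (suc (suc l))) (suc (suc (suc l′))) eq = cong (λ i → suc (suc i)) (x-injective eq)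

-- Six dependent points for q > 4.

module Pairs {A : Field} (E : Extension A) (r : ℕ) (A↔Fin : Fin (5 ℕ.+ r) ↔ Field.Carrier A) where

  private
    module A = Field A
    module AP = FieldProperties A
  open Extension E hiding (σ²; τ)
  open FieldProperties K
  open Torus cyclicSextic
  open T
  open Relation
  open Coordinates E
  open Parametrisation E using (ι-sum)
  open Parametrisation.Enumeration E A↔Fin
  open Counting A A↔Fin
  private module ι = IsRingHomomorphism ι-homo
  open IsRingHomomorphism isHomomorphism using (+-homo; *-homo; -‿homo; 0#-homo; 1#-homo)

  private
    m : ℕ
    m = 18 ℕ.+ 9 ℕ.* r ℕ.+ r ℕ.* r

    size≡3+m : size ≡ 3 ℕ.+ m
    size≡3+m = solveℕ 1 (λ r → conℕ 1 :+ (conℕ 4 :+ r) :* (conℕ 5 :+ r) := conℕ 3 :+ (conℕ 18 :+ conℕ 9 :* r :+ r :* r)) refl r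

    -- After division by q this is 2q² < (q² - q - 2)(q - 1), for q = 5 the inequality 50 < 72.
    few : 2 ℕ.* (5 ℕ.+ r) ^ 3 ℕ.< m ℕ.* ((4 ℕ.+ r) ℕ.* (5 ℕ.+ r) ^ 1)
    few = ≡.subst₂ ℕ._<_
      (solveℕ 1 (λ q → conℕ 2 :* (q :* q) :* (q :* conℕ 1) := conℕ 2 :* (q :* (q :* (q :* conℕ 1)))) refl (5 ℕ.+ r))
      (ℕ.*-assoc m (4 ℕ.+ r) ((5 ℕ.+ r) ^ 1))
      (ℕ.*-monoˡ-< ((5 ℕ.+ r) ^ 1) {{ℕ.m^n≢0 (5 ℕ.+ r) 1}} (ℕ.≤-trans (ℕ.m≤m+n (suc (2 ℕ.* ((5 ℕ.+ r) ℕ.* (5 ℕ.+ r)))) (21 ℕ.+ 34 ℕ.* r ℕ.+ 11 ℕ.* (r ℕ.* r) ℕ.+ r ℕ.* r ℕ.* r))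
        (ℕ.≤-reflexive (solveℕ 1 (λ r → conℕ 1 :+ conℕ 2 :* ((conℕ 5 :+ r) :* (conℕ 5 :+ r)) :+ (conℕ 21 :+ conℕ 34 :* r :+ conℕ 11 :* (r :* r) :+ r :* r :* r) :=
          (conℕ 18 :+ conℕ 9 :* r :+ r :* r) :* (conℕ 4 :+ r)) refl r))))

    index : ∀ {x} → T x → Fin size
    index tx = proj₁ (torus-surjective tx)

    torus-index : ∀ {x} (tx : T x) → torus (index tx) ≡ x
    torus-index tx = proj₂ (torus-surjective tx)

    τ-τ : ∀ {u v} → τ u ≡ v → u ≡ τ v
    τ-τ {u} refl = sym (σ⁶ u)

    τ-1 : τ 1# ≡ 1#
    τ-1 = trans (cong σ² 1#-homo) (trans (cong σ 1#-homo) 1#-homo)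

    x₀ : Carrier
    x₀ = torus (suc zero)

    x₀-T : T x₀
    x₀-T = torus-T (suc zero)

    x₀≢1 : x₀ ≢ 1#
    x₀≢1 eq = contradiction (torus-injective {suc zero} {zero} eq) λ ()

    τ≢ : ∀ {x} → T x → x ≢ 1# → x ≢ τ x
    τ≢ tx x≢1 eq = x≢1 (τ-fixed-1 tx (sym eq))

    τ≢1 : ∀ {x} → x ≢ 1# → τ x ≢ 1#
    τ≢1 x≢1 eq = x≢1 (trans (τ-τ eq) τ-1)

    -- The other points must avoid 1, which is its own inverse, and the pair of x₀.
    excluded : Vec Carrier 3
    excluded = 1# ∷ x₀ ∷ τ x₀ ∷ []

    excluded-T : ∀ i → T (lookup excluded i)
    excluded-T 0F = T-1
    excluded-T 1F = x₀-T
    excluded-T 2F = T-τ x₀-T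

    excluded-unique : Unique excluded
    excluded-unique = ((x₀≢1 ∘ sym) ∷ (τ≢1 x₀≢1 ∘ sym) ∷ []) ∷ (τ≢ x₀-T x₀≢1 ∷ []) ∷ [] ∷ []

    others = complement 3 {m} size≡3+m (index ∘ excluded-T) (λ {i} {j} eq → lookup-injective excluded-unique i j
      (trans (sym (torus-index (excluded-T i))) (trans (cong torus eq) (torus-index (excluded-T j)))))

    y : Fin m → Carrier
    y j = torus (proj₁ others j)

    y-T : ∀ j → T (y j)
    y-T j = torus-T (proj₁ others j)

    y≢ : ∀ j i → y j ≢ lookup excluded i
    y≢ j i eq = proj₂ (proj₂ others) j i (torus-injective (trans eq (sym (torus-index (excluded-T i)))))

    -- Different for x and τ x, so that the pigeonhole principle cannot return
    -- such a pair.
    colour : Fin size → Fin 2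
    colour i = if does (i Fin.<? index (T-τ (torus-T i))) then 0F else 1F

    colour-< : ∀ {i} → i Fin.< index (T-τ (torus-T i)) → colour i ≡ 0F
    colour-< {i} p = cong (λ b → if b then 0F else 1F) (dec-true (i Fin.<? index (T-τ (torus-T i))) p)

    colour-≮ : ∀ {i} → ¬ (i Fin.< index (T-τ (torus-T i))) → colour i ≡ 1F
    colour-≮ {i} p = cong (λ b → if b then 0F else 1F) (dec-false (i Fin.<? index (T-τ (torus-T i))) p)

    colour-τ : ∀ i j → torus i ≢ 1# → torus i ≡ τ (torus j) → colour i ≢ colour j
    colour-τ i j i≢1 eq with i Fin.<? index (T-τ (torus-T i)) | j Fin.<? index (T-τ (torus-T j))
    ... | yes p | no  q = λ eq → contradiction (trans (sym (colour-< p)) (trans eq (colour-≮ q))) λ ()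
    ... | no  p | yes q = λ eq → contradiction (trans (sym (colour-≮ p)) (trans eq (colour-< q))) λ ()
    ... | yes p | yes q = λ _ → Fin.<-asym (subst (i Fin.<_) τi≡j p) (subst (j Fin.<_) τj≡i q)
      where
      τj≡i : index (T-τ (torus-T j)) ≡ i
      τj≡i = torus-injective (trans (torus-index _) (sym eq))
      τi≡j : index (T-τ (torus-T i)) ≡ j
      τi≡j = torus-injective (trans (torus-index _) (trans (cong τ eq) (σ⁶ (torus j))))
    ... | no p | no q = λ _ → τ≢ (torus-T i) i≢1 (trans (cong torus i≡j) (trans (sym (σ⁶ (torus j))) (cong τ (sym eq))))
      where
      τj≡i : index (T-τ (torus-T j)) ≡ i
      τj≡i = torus-injective (trans (torus-index _) (sym eq))
      τi≡j : index (T-τ (torus-T i)) ≡ j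
      τi≡j = torus-injective (trans (torus-index _) (trans (cong τ eq) (σ⁶ (torus j))))
      i≡j : i ≡ j
      i≡j = Fin.≤-antisym (ℕ.≮⇒≥ (q ∘ subst (j Fin.<_) (sym τj≡i))) (ℕ.≮⇒≥ (p ∘ subst (i Fin.<_) (sym τi≡j)))

    τ-ι* : ∀ s x → τ (ι s * x) ≡ ι s * τ x
    τ-ι* s x = trans (τ-* (ι s) x) (cong (_* τ x) (trans (cong σ² (σ-ι s)) (trans (cong σ (σ-ι s)) (σ-ι s))))

    skew-two : ∀ {c d x y} → (∀ k → (c A.* skew x k A.+ A.0#) A.+ d A.* skew y k ≡ A.0#) →
      ι c * τ x + ι d * τ y ≡ ι c * x + ι d * y
    skew-two {c} {d} {x} {y} eq = trans (sym (trans (τ-+ _ _) (cong₂ _+_ (τ-ι* c x) (τ-ι* d y))))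
      (skew-zero _ λ k → trans (skew-+ _ _ k) (trans (cong₂ A._+_ (trans (skew-* c x k) (sym (A.+-identityʳ _))) (skew-* d y k)) (eq k)))

    distinct-pairs : ∀ {u v} → u ≢ v → u ≢ τ v → τ u ≢ v × τ u ≢ τ v
    distinct-pairs u≢v u≢τv = (λ eq → u≢τv (τ-τ eq)) , λ eq → u≢v (σ-injective (σ-injective (σ-injective eq)))

    independent : ∀ j d (c : Fin 1 → A.Carrier) →
      (∀ k → AP.sum (λ l → c l A.* skew x₀ k) A.+ d A.* skew (y j) k ≡ A.0#) → d ≡ A.0# × (∀ l → c l ≡ A.0#)
    independent j d c eq = zeros 2F , λ { 0F → zeros 0F }
      where
      -- The point 1, with weight zero, only brings the number of points to five.
      p : Vec Carrier 5
      p = x₀ ∷ τ x₀ ∷ y j ∷ τ (y j) ∷ 1# ∷ []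

      a : Vec A.Carrier 5
      a = c 0F ∷ A.- c 0F ∷ d ∷ A.- d ∷ A.0# ∷ []

      pair = distinct-pairs (y≢ j 1F ∘ sym) (λ eq → y≢ j 2F (trans (sym (σ⁶ (y j))) (cong τ (sym eq))))

      p-unique : Unique p
      p-unique =
        (τ≢ x₀-T x₀≢1 ∷ (y≢ j 1F ∘ sym) ∷ (λ eq → y≢ j 2F (τ-τ (sym eq))) ∷ x₀≢1 ∷ []) ∷
        ((y≢ j 2F ∘ sym) ∷ proj₂ pair ∷ τ≢1 x₀≢1 ∷ []) ∷
        (τ≢ (y-T j) (y≢ j 0F) ∷ y≢ j 0F ∷ []) ∷
        (τ≢1 (y≢ j 0F) ∷ []) ∷ [] ∷ []

      zeros : ∀ i → lookup a i ≡ A.0#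
      zeros = five-points {lookup p}
        (λ { 0F → x₀-T ; 1F → T-τ x₀-T ; 2F → y-T j ; 3F → T-τ (y-T j) ; 4F → T-1 })
        (lookup-injective p-unique _ _) (lookup a)
        (record
          { fixed    = σ-ι ∘ lookup a
          ; weights  = trans (sym (ι-sum (lookup a))) (trans (cong ι (AP.solve 2 (λ c d → c ⊕ (⊝ c ⊕ (d ⊕ (⊝ d ⊕ (con 0 ⊕ con 0)))) ⊜ con 0) refl (c 0F) d)) ι.0#-homo)
          ; combined = linear₁ (- 1#)
              (begin
                ι (c 0F) * x₀ + (ι (A.- c 0F) * τ x₀ + (ι d * y j + (ι (A.- d) * τ (y j) + (ι A.0# * 1# + 0#)))) - 0#
                  ≡⟨ cong₂ (λ s t → ι (c 0F) * x₀ + (s * τ x₀ + (ι d * y j + (t * τ (y j) + (ι A.0# * 1# + 0#)))) - 0#) (ι.-‿homo (c 0F)) (ι.-‿homo d) ⟩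
                ι (c 0F) * x₀ + (- ι (c 0F) * τ x₀ + (ι d * y j + (- ι d * τ (y j) + (ι A.0# * 1# + 0#)))) - 0#
                  ≡⟨ cong (λ s → ι (c 0F) * x₀ + (- ι (c 0F) * τ x₀ + (ι d * y j + (- ι d * τ (y j) + (s * 1# + 0#)))) - 0#) ι.0#-homo ⟩
                ι (c 0F) * x₀ + (- ι (c 0F) * τ x₀ + (ι d * y j + (- ι d * τ (y j) + (0# * 1# + 0#)))) - 0#
                  ≡⟨ solve 6 (λ c d x X y Y → c ⊗ x ⊕ (⊝ c ⊗ X ⊕ (d ⊗ y ⊕ (⊝ d ⊗ Y ⊕ (con 0 ⊗ con 1 ⊕ con 0)))) ⊖ con 0 ⊜
                       ⊝ con 1 ⊗ (c ⊗ X ⊕ d ⊗ Y ⊖ (c ⊗ x ⊕ d ⊗ y))) refl (ι (c 0F)) (ι d) x₀ (τ x₀) (y j) (τ (y j)) ⟩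
                - 1# * (ι (c 0F) * τ x₀ + ι d * τ (y j) - (ι (c 0F) * x₀ + ι d * y j)) ∎)
              (skew-two eq)
          })

    pairs = coincidence {3} {1} {m} {2} (λ _ → skew x₀) (skew ∘ y) (colour ∘ proj₁ others) few independent

  -- The elements x - τ x form a space of dimension three, so three of them
  -- lie on a line.
  six-dependent : SixDependent
  six-dependent = record
    { x           = lookup p
    ; x-T         = λ { 0F → x₀-T ; 1F → T-τ x₀-T ; 2F → y-T j ; 3F → T-τ (y-T j) ; 4F → y-T j′ ; 5F → T-τ (y-T j′) }
    ; x-injective = lookup-injective p-unique _ _
    ; a           = lookup a
    ; a-relation  = record
      { fixed    = σ-ι ∘ lookup a
      ; weights  = trans (sym (ι-sum (lookup a))) (trans (cong ι (AP.solve 3 (λ c d d′ → c ⊕ (⊝ c ⊕ (d ⊕ (⊝ d ⊕ (⊝ d′ ⊕ (d′ ⊕ con 0))))) ⊜ con 0) refl c d d′)) ι.0#-homo)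
      ; combined = linear₁ (- 1#)
          (begin
            ι c * x₀ + (ι (A.- c) * τ x₀ + (ι d * y j + (ι (A.- d) * τ (y j) + (ι (A.- d′) * y j′ + (ι d′ * τ (y j′) + 0#))))) - 0#
              ≡⟨ cong₂ (λ s t → ι c * x₀ + (s * τ x₀ + (ι d * y j + (t * τ (y j) + (ι (A.- d′) * y j′ + (ι d′ * τ (y j′) + 0#))))) - 0#) (ι.-‿homo c) (ι.-‿homo d) ⟩
            ι c * x₀ + (- ι c * τ x₀ + (ι d * y j + (- ι d * τ (y j) + (ι (A.- d′) * y j′ + (ι d′ * τ (y j′) + 0#))))) - 0#
              ≡⟨ cong (λ s → ι c * x₀ + (- ι c * τ x₀ + (ι d * y j + (- ι d * τ (y j) + (s * y j′ + (ι d′ * τ (y j′) + 0#))))) - 0#) (ι.-‿homo d′) ⟩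
            ι c * x₀ + (- ι c * τ x₀ + (ι d * y j + (- ι d * τ (y j) + (- ι d′ * y j′ + (ι d′ * τ (y j′) + 0#))))) - 0#
              ≡⟨ solve 9 (λ c d d′ x X y Y z Z → c ⊗ x ⊕ (⊝ c ⊗ X ⊕ (d ⊗ y ⊕ (⊝ d ⊗ Y ⊕ (⊝ d′ ⊗ z ⊕ (d′ ⊗ Z ⊕ con 0))))) ⊖ con 0 ⊜
                   ⊝ con 1 ⊗ (c ⊗ X ⊕ d ⊗ Y ⊕ ⊝ d′ ⊗ Z ⊖ (c ⊗ x ⊕ d ⊗ y ⊕ ⊝ d′ ⊗ z)))
                   refl (ι c) (ι d) (ι d′) x₀ (τ x₀) (y j) (τ (y j)) (y j′) (τ (y j′)) ⟩
            - 1# * (ι c * τ x₀ + ι d * τ (y j) + - ι d′ * τ (y j′) - (ι c * x₀ + ι d * y j + - ι d′ * y j′)) ∎)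
          skew-three
      }
    ; a-nonzero   = 2F , d≢0
    }
    where
    j  = proj₁ pairs
    j′ = proj₁ (proj₂ pairs)
    d  = proj₁ (proj₂ (proj₂ pairs))
    d′ = proj₁ (proj₂ (proj₂ (proj₂ pairs)))
    c  = proj₁ (proj₂ (proj₂ (proj₂ (proj₂ pairs)))) 0F
    facts = proj₂ (proj₂ (proj₂ (proj₂ (proj₂ pairs))))
    j≢j′ = proj₁ facts
    same-colour = proj₁ (proj₂ facts)
    d≢0 = proj₁ (proj₂ (proj₂ facts))
    found = proj₂ (proj₂ (proj₂ (proj₂ facts)))

    p : Vec Carrier 6
    p = x₀ ∷ τ x₀ ∷ y j ∷ τ (y j) ∷ y j′ ∷ τ (y j′) ∷ []

    a : Vec A.Carrier 6
    a = c ∷ A.- c ∷ d ∷ A.- d ∷ A.- d′ ∷ d′ ∷ []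

    y≢y′ : y j ≢ y j′
    y≢y′ eq = j≢j′ (proj₁ (proj₂ others) (torus-injective eq))

    y≢τy′ : y j ≢ τ (y j′)
    y≢τy′ eq = colour-τ (proj₁ others j) (proj₁ others j′) (y≢ j 0F) eq same-colour

    x₀-pair : ∀ j → x₀ ≢ y j × x₀ ≢ τ (y j)
    x₀-pair j = y≢ j 1F ∘ sym , λ eq → y≢ j 2F (τ-τ (sym eq))

    p-unique : Unique p
    p-unique =
      (τ≢ x₀-T x₀≢1 ∷ proj₁ (x₀-pair j) ∷ proj₂ (x₀-pair j) ∷ proj₁ (x₀-pair j′) ∷ proj₂ (x₀-pair j′) ∷ []) ∷
      ((y≢ j 2F ∘ sym) ∷ proj₂ (distinct-pairs (proj₁ (x₀-pair j)) (proj₂ (x₀-pair j))) ∷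
       (y≢ j′ 2F ∘ sym) ∷ proj₂ (distinct-pairs (proj₁ (x₀-pair j′)) (proj₂ (x₀-pair j′))) ∷ []) ∷
      (τ≢ (y-T j) (y≢ j 0F) ∷ y≢y′ ∷ y≢τy′ ∷ []) ∷
      (proj₁ (distinct-pairs y≢y′ y≢τy′) ∷ proj₂ (distinct-pairs y≢y′ y≢τy′) ∷ []) ∷
      (τ≢ (y-T j′) (y≢ j′ 0F) ∷ []) ∷ [] ∷ []

    skew-three : ι c * τ x₀ + ι d * τ (y j) + - ι d′ * τ (y j′) ≡ ι c * x₀ + ι d * y j + - ι d′ * y j′
    skew-three = subst (λ s → ι c * τ x₀ + ι d * τ (y j) + s * τ (y j′) ≡ ι c * x₀ + ι d * y j + s * y j′) (ι.-‿homo d′)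
      (trans (sym (trans (τ-+ _ _) (cong₂ _+_ (trans (τ-+ _ _) (cong₂ _+_ (τ-ι* c x₀) (τ-ι* d (y j)))) (τ-ι* (A.- d′) (y j′)))))
        (skew-zero _ λ k → trans (skew-+ _ _ k) (trans
          (cong₂ A._+_ (trans (skew-+ _ _ k) (cong₂ A._+_ (skew-* c x₀ k) (skew-* d (y j) k))) (skew-* (A.- d′) (y j′) k))
          (AP.linear₁ A.1# (AP.solve 5 (λ u d v d′ w → u ⊕ d ⊗ v ⊕ ⊝ d′ ⊗ w ⊖ con 0 ⊜ con 1 ⊗ (u ⊕ con 0 ⊕ (d ⊗ v ⊖ d′ ⊗ w) ⊖ con 0)) refl
            (c A.* skew x₀ k) d (skew (y j) k) d′ (skew (y j′) k)) (found k)))))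

-- Six dependent points for q = 4.

record Homomorphic (R S : RawRing 0ℓ 0ℓ) (φ : RawRing.Carrier R → RawRing.Carrier S) : Set where
  private
    module R = RawRing R
    module S = RawRing S
  field
    +-homo  : ∀ x y → φ (x R.+ y) ≡ φ x S.+ φ y
    *-homo  : ∀ x y → φ (x R.* y) ≡ φ x S.* φ y
    -‿homo  : ∀ x → φ (R.- x) ≡ S.- φ x
    0#-homo : φ R.0# ≡ S.0#
    1#-homo : φ R.1# ≡ S.1#

-- Only the constants 0 and 1 matter.
constant : (R : RawRing 0ℓ 0ℓ) → ℤ → RawRing.Carrier R
constant R (ℤ.+ 1) = RawRing.1# R
constant R _     = RawRing.0# R

evaluate : (R : RawRing 0ℓ 0ℓ) → ∀ {n} → Expr ℤ n → Vec (RawRing.Carrier R) n → RawRing.Carrier R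
evaluate R = Eval.⟦_⟧ R (constant R)

-- All component formulas of the cubic and quadratic operations are expressions, so this one
-- induction transports them from a concrete field, where they compute, to an abstract one.
evaluate-natural : ∀ {R S φ} → Homomorphic R S φ → ∀ {n} (e : Expr ℤ n) ρ →
  φ (evaluate R e ρ) ≡ evaluate S e (Vec.map φ ρ)
evaluate-natural {R} {S} {φ} h = go
  where
  module S = RawRing S
  open Homomorphic h
  open import Data.Integer.Base using (+_; -[1+_])

  go : ∀ {n} (e : Expr ℤ n) ρ → φ (evaluate R e ρ) ≡ evaluate S e (Vec.map φ ρ)
  power : ∀ {n} (e : Expr ℤ n) ρ k → φ (evaluate R (e ⊛ k) ρ) ≡ evaluate S (e ⊛ k) (Vec.map φ ρ)
  go (Κ (+ 0))                ρ = 0#-homo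
  go (Κ (+ 1))                ρ = 1#-homo
  go (Κ (+ suc (suc _)))      ρ = 0#-homo
  go (Κ -[1+ _ ])                ρ = 0#-homo
  go (Ι i)                    ρ = sym (lookup-map i φ ρ)
  go (x ⊕ y)                  ρ = trans (+-homo _ _) (cong₂ S._+_ (go x ρ) (go y ρ))
  go (x ⊗ y)                  ρ = trans (*-homo _ _) (cong₂ S._*_ (go x ρ) (go y ρ))
  go (⊝ x)                    ρ = trans (-‿homo _) (cong S.-_ (go x ρ))
  go (x ⊛ k)                  ρ = power x ρ k
  power e ρ zero          = 1#-homo
  power e ρ (suc zero)    = go e ρ
  power e ρ (suc (suc k)) = trans (*-homo _ _) (cong₂ S._*_ (power e ρ (suc k)) (go e ρ))

cubicRing : (R : RawRing 0ℓ 0ℓ) → RawRing.Carrier R → RawRing 0ℓ 0ℓ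
cubicRing R a = record { Carrier = Triple (RawRing.Carrier R) ; _≈_ = _≡_ ; _+_ = add ; _*_ = mul ; -_ = neg
  ; 0# = embed (RawRing.0# R) ; 1# = embed (RawRing.1# R) }
  where open CubicOperations R a

quadraticRing : (R : RawRing 0ℓ 0ℓ) → RawRing.Carrier R → RawRing 0ℓ 0ℓ
quadraticRing R n = record { Carrier = Pair ; _≈_ = _≡_ ; _+_ = add ; _*_ = mul ; -_ = neg
  ; 0# = embed (RawRing.0# R) ; 1# = embed (RawRing.1# R) }
  where open QuadraticOperations R n

module Naturality {R S : RawRing 0ℓ 0ℓ} {φ : RawRing.Carrier R → RawRing.Carrier S} (h : Homomorphic R S φ) where

  private
    module R = RawRing R
    module S = RawRing S
    module C (n : ℕ) = CubicOperations (exprRing n)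
    module Q (n : ℕ) = QuadraticOperations (exprRing n)
  open Homomorphic h

  map₃ : Triple R.Carrier → Triple S.Carrier
  map₃ ⟨ x₀ , x₁ , x₂ ⟩ = ⟨ φ x₀ , φ x₁ , φ x₂ ⟩

  map₂ : R.Carrier × R.Carrier → S.Carrier × S.Carrier
  map₂ (p , q) = φ p , φ q

  private
    a : ∀ {n} → Expr ℤ (suc n)
    a = Ι 0F

    x y : Triple (Expr ℤ 7)
    x = ⟨ Ι 1F , Ι 2F , Ι 3F ⟩
    y = ⟨ Ι 4F , Ι 5F , Ι 6F ⟩

  map₃-homomorphic : ∀ a → Homomorphic (cubicRing R a) (cubicRing S (φ a)) map₃
  map₃-homomorphic α = record
    { +-homo  = λ _ _ → triple-≡ (+-homo _ _) (+-homo _ _) (+-homo _ _)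
    ; *-homo  = λ { ⟨ x₀ , x₁ , x₂ ⟩ ⟨ y₀ , y₁ , y₂ ⟩ → let ρ = α ∷ x₀ ∷ x₁ ∷ x₂ ∷ y₀ ∷ y₁ ∷ y₂ ∷ [] in triple-≡
        (evaluate-natural h (c₀ (C.mul 7 a x y)) ρ)
        (evaluate-natural h (c₁ (C.mul 7 a x y)) ρ)
        (evaluate-natural h (c₂ (C.mul 7 a x y)) ρ) }
    ; -‿homo  = λ _ → triple-≡ (-‿homo _) (-‿homo _) (-‿homo _)
    ; 0#-homo = triple-≡ 0#-homo 0#-homo 0#-homo
    ; 1#-homo = triple-≡ 1#-homo 0#-homo 0#-homo
    }

  map₃-ς : ∀ a x → map₃ (CubicOperations.ς R a x) ≡ CubicOperations.ς S (φ a) (map₃ x)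
  map₃-ς α ⟨ x₀ , x₁ , x₂ ⟩ = triple-≡
    (evaluate-natural h (c₀ (C.ς 4 a ⟨ Ι 1F , Ι 2F , Ι 3F ⟩)) ρ)
    (evaluate-natural h (c₁ (C.ς 4 a ⟨ Ι 1F , Ι 2F , Ι 3F ⟩)) ρ)
    (evaluate-natural h (c₂ (C.ς 4 a ⟨ Ι 1F , Ι 2F , Ι 3F ⟩)) ρ)
    where ρ = α ∷ x₀ ∷ x₁ ∷ x₂ ∷ []

  map₂-homomorphic : ∀ n → Homomorphic (quadraticRing R n) (quadraticRing S (φ n)) map₂
  map₂-homomorphic n = record
    { +-homo  = λ _ _ → cong₂ _,_ (+-homo _ _) (+-homo _ _)
    ; *-homo  = λ { (p , q) (r , s) → let ρ = n ∷ p ∷ q ∷ r ∷ s ∷ [] in cong₂ _,_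
        (evaluate-natural h (proj₁ (Q.mul 5 (Ι 0F) (Ι 1F , Ι 2F) (Ι 3F , Ι 4F))) ρ)
        (evaluate-natural h (proj₂ (Q.mul 5 (Ι 0F) (Ι 1F , Ι 2F) (Ι 3F , Ι 4F))) ρ) }
    ; -‿homo  = λ _ → cong₂ _,_ (-‿homo _) (-‿homo _)
    ; 0#-homo = cong₂ _,_ 0#-homo 0#-homo
    ; 1#-homo = cong₂ _,_ 1#-homo 0#-homo
    }

-- The field of four elements; p , q stands for p + q ω.
𝔽₄ : RawRing 0ℓ 0ℓ
𝔽₄ = record
  { Carrier = Bool × Bool ; _≈_ = _≡_
  ; _+_ = λ (p , q) (r , s) → p xor r , q xor s
  ; _*_ = λ (p , q) (r , s) → (p ∧ r) xor (q ∧ s) , (p ∧ s) xor ((q ∧ r) xor (q ∧ s))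
  ; -_ = id ; 0# = false , false ; 1# = true , false }

module FourElements (A : Field) (A↔Fin : Fin 4 ↔ Field.Carrier A) where

  open Field A
  open FieldProperties A
  open FiniteScalars A A↔Fin using (from-injective)
  open Inverse A↔Fin using (to; from; strictlyInverseˡ; strictlyInverseʳ)

  private
    -- The square of 1 + 1 is the sum of four ones, which vanishes in a field of four elements.
    2≡0 : 1# + 1# ≡ 0#
    2≡0 = [ id , id ]′ (*≡0 (linear₁ 1# (solve 0
      ((con 1 ⊕ con 1) ⊗ (con 1 ⊕ con 1) ⊖ con 0 ⊜ con 1 ⊗ ((con 1 ⊕ (con 1 ⊕ (con 1 ⊕ (con 1 ⊕ con 0)))) ⊖ con 0)) refl) (FiniteField.sum-1 A A↔Fin)))

    bits : Fin 2 → Fin 4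
    bits 0F = from 0#
    bits 1F = from 1#

    bits-injective : Injective _≡_ _≡_ bits
    bits-injective {0F} {0F} eq = refl
    bits-injective {0F} {1F} eq = contradiction (sym (from-injective eq)) 1≢0
    bits-injective {1F} {0F} eq = contradiction (from-injective eq) 1≢0
    bits-injective {1F} {1F} eq = refl

    third : ∃ λ (g : Fin 2 → Fin 4) → Injective _≡_ _≡_ g × (∀ i j → g i ≢ bits j)
    third = complement 2 refl bits bits-injective

  ω : Carrier
  ω = to (proj₁ third 0F)

  private
    ω≢ : ∀ x j → bits j ≡ from x → ω ≢ x
    ω≢ x j eq ω≡x = proj₂ (proj₂ third) 0F j (trans (sym (strictlyInverseʳ _)) (trans (cong from ω≡x) (sym eq)))

    ω≢0 : ω ≢ 0#
    ω≢0 = ω≢ 0# 0F refl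

    ω≢1 : ω ≢ 1#
    ω≢1 = ω≢ 1# 1F refl

    1+ω≢0 : 1# + ω ≢ 0#
    1+ω≢0 eq = ω≢1 (linear₂ 1# (- 1#) (solve 1 (λ w → w ⊖ con 1 ⊜ con 1 ⊗ (con 1 ⊕ w ⊖ con 0) ⊕ (⊝ con 1) ⊗ (con 1 ⊕ con 1 ⊖ con 0)) refl ω) eq 2≡0)

    elements : Vec Carrier 4
    elements = 0# ∷ 1# ∷ ω ∷ 1# + ω ∷ []

    elements-unique : Unique elements
    elements-unique =
      ((1≢0 ∘ sym) ∷ (ω≢0 ∘ sym) ∷ (1+ω≢0 ∘ sym) ∷ []) ∷
      ((ω≢1 ∘ sym) ∷ (λ eq → ω≢0 (linear₁ (- 1#) (solve 1 (λ w → w ⊖ con 0 ⊜ (⊝ con 1) ⊗ (con 1 ⊖ (con 1 ⊕ w))) refl ω) eq)) ∷ []) ∷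
      ((λ eq → 1≢0 (linear₁ (- 1#) (solve 1 (λ w → con 1 ⊖ con 0 ⊜ (⊝ con 1) ⊗ (w ⊖ (con 1 ⊕ w))) refl ω) eq)) ∷ []) ∷ [] ∷ []

    cases : ∀ (P : Carrier → Set) → (∀ i → P (lookup elements i)) → ∀ r → P r
    cases P p r with r ≟ 0# | r ≟ 1# | r ≟ ω | r ≟ 1# + ω
    ... | yes refl | _ | _ | _ = p 0F
    ... | no _ | yes refl | _ | _ = p 1F
    ... | no _ | no _ | yes refl | _ = p 2F
    ... | no _ | no _ | no _ | yes refl = p 3F
    ... | no a | no b | no c | no d = contradiction
      (λ {i} {j} eq → lookup-injective ((a ∷ b ∷ c ∷ d ∷ []) ∷ elements-unique) i j (from-injective eq))
      (Fin.<⇒notInjective {f = from ∘ lookup (r ∷ elements)} ℕ.≤-refl)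

  -- By elimination: the values 0, 1 and ω of the square would make ω equal to 0 or 1.
  ω² : ω * ω ≡ 1# + ω
  ω² = cases (λ r → ω * ω ≡ r → ω * ω ≡ 1# + ω) (λ
    { 0F eq → contradiction ([ id , id ]′ (*≡0 eq)) ω≢0
    ; 1F eq → contradiction ([ x-y≈0⇒x≈y ω 1# , x-y≈0⇒x≈y ω 1# ]′ (*≡0 (linear₂ 1# (1# - ω)
        (solve 1 (λ w → (w ⊖ con 1) ⊗ (w ⊖ con 1) ⊖ con 0 ⊜ con 1 ⊗ (w ⊗ w ⊖ con 1) ⊕ (con 1 ⊖ w) ⊗ (con 1 ⊕ con 1 ⊖ con 0)) refl ω) eq 2≡0))) ω≢1
    ; 2F eq → contradiction (*-cancelˡ ω≢0 (trans eq (sym (*-identityʳ ω)))) ω≢1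
    ; 3F eq → eq }) (ω * ω) refl

  -- In characteristic two this cubic is t³ + t + 1. Both polynomials are fixed here, since explicit
  -- points need an explicit extension.
  irreducible₃ : CubicHasNoRoot A 0#
  irreducible₃ = cases _ λ
    { 0F eq → 1≢0 (linear₁ (- 1#) (solve 0 (con 1 ⊖ con 0 ⊜ (⊝ con 1) ⊗ (f (con 0) ⊖ con 0)) refl) eq)
    ; 1F eq → 1≢0 (linear₂ 1# (1# + 1#) (solve 0 (con 1 ⊖ con 0 ⊜ con 1 ⊗ (f (con 1) ⊖ con 0) ⊕ (con 1 ⊕ con 1) ⊗ (con 1 ⊕ con 1 ⊖ con 0)) refl) eq 2≡0)
    ; 2F eq → ω≢0 (linear₃ 1# (- (ω + 1#)) (1# * ω)
        (solve 1 (λ w → w ⊖ con 0 ⊜ con 1 ⊗ (f w ⊖ con 0) ⊕ (⊝ (w ⊕ con 1)) ⊗ (w ⊗ w ⊖ (con 1 ⊕ w)) ⊕ con 1 ⊗ w ⊗ (con 1 ⊕ con 1 ⊖ con 0)) refl ω) eq ω² 2≡0)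
    ; 3F eq → 1+ω≢0 (linear₃ 1# (- (ω + 1# + 1# + 1# + 1#)) (- (ω + ω))
        (solve 1 (λ w → con 1 ⊕ w ⊖ con 0 ⊜ con 1 ⊗ (f (con 1 ⊕ w) ⊖ con 0) ⊕ (⊝ (w ⊕ con 1 ⊕ con 1 ⊕ con 1 ⊕ con 1)) ⊗ (w ⊗ w ⊖ (con 1 ⊕ w)) ⊕ (⊝ (w ⊕ w)) ⊗ (con 1 ⊕ con 1 ⊖ con 0)) refl ω) eq ω² 2≡0) }
    where
    f : ∀ {n} → Expr ℤ n → Expr ℤ n
    f r = r ⊗ r ⊗ r ⊖ con 0 ⊗ (r ⊗ r) ⊖ (con 0 ⊕ con 1 ⊕ con 1 ⊕ con 1) ⊗ r ⊖ con 1

  irreducible₂ : QuadraticHasNoRoot A ω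
  irreducible₂ = cases _ λ
    { 0F eq → ω≢0 (linear₁ 1# (solve 1 (λ w → w ⊖ con 0 ⊜ con 1 ⊗ (con 0 ⊗ con 0 ⊖ con 0 ⊕ w ⊖ con 0)) refl ω) eq)
    ; 1F eq → ω≢0 (linear₁ 1# (solve 1 (λ w → w ⊖ con 0 ⊜ con 1 ⊗ (con 1 ⊗ con 1 ⊖ con 1 ⊕ w ⊖ con 0)) refl ω) eq)
    ; 2F eq → *-≢0 ω≢0 ω≢0 (linear₁ 1# (solve 1 (λ w → w ⊗ w ⊖ con 0 ⊜ con 1 ⊗ (w ⊗ w ⊖ w ⊕ w ⊖ con 0)) refl ω) eq)
    ; 3F eq → *-≢0 ω≢0 ω≢0 (linear₂ 1# (- ω) (solve 1 (λ w → w ⊗ w ⊖ con 0 ⊜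
        con 1 ⊗ ((con 1 ⊕ w) ⊗ (con 1 ⊕ w) ⊖ (con 1 ⊕ w) ⊕ w ⊖ con 0) ⊕ (⊝ w) ⊗ (con 1 ⊕ con 1 ⊖ con 0)) refl ω) eq 2≡0) }

  extension₄ : Extension A
  extension₄ = Construction.extension A 0# ω irreducible₃ irreducible₂

  private
    bit : Bool → Carrier
    bit false = 0#
    bit true  = 1#

    φ : Bool × Bool → Carrier
    φ (p , q) = bit p + bit q * ω

    bit-xor : ∀ p q → bit (p xor q) ≡ bit p + bit q
    bit-xor false q     = sym (+-identityˡ (bit q))
    bit-xor true  false = sym (+-identityʳ 1#)
    bit-xor true  true  = sym 2≡0

    bit-∧ : ∀ p q → bit (p ∧ q) ≡ bit p * bit q
    bit-∧ false q = sym (zeroˡ (bit q))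
    bit-∧ true  q = sym (*-identityˡ (bit q))

    φ-+ : ∀ x y → φ (RawRing._+_ 𝔽₄ x y) ≡ φ x + φ y
    φ-+ (p , q) (r , s) = trans (cong₂ (λ u v → u + v * ω) (bit-xor p r) (bit-xor q s))
      (solve 5 (λ p q r s w → p ⊕ r ⊕ (q ⊕ s) ⊗ w ⊜ p ⊕ q ⊗ w ⊕ (r ⊕ s ⊗ w)) refl (bit p) (bit q) (bit r) (bit s) ω)

    φ-homomorphic : Homomorphic 𝔽₄ rawRing φ
    φ-homomorphic = record
      { +-homo  = φ-+
      ; *-homo  = λ { (p , q) (r , s) → trans
          (cong₂ (λ u v → u + v * ω)
            (trans (bit-xor (p ∧ r) (q ∧ s)) (cong₂ _+_ (bit-∧ p r) (bit-∧ q s)))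
            (trans (bit-xor (p ∧ s) _) (cong₂ _+_ (bit-∧ p s) (trans (bit-xor (q ∧ r) (q ∧ s)) (cong₂ _+_ (bit-∧ q r) (bit-∧ q s))))))
          (linear₁ (- (bit q * bit s)) (solve 5 (λ p q r s w →
            p ⊗ r ⊕ q ⊗ s ⊕ (p ⊗ s ⊕ (q ⊗ r ⊕ q ⊗ s)) ⊗ w ⊖ (p ⊕ q ⊗ w) ⊗ (r ⊕ s ⊗ w) ⊜
            (⊝ (q ⊗ s)) ⊗ (w ⊗ w ⊖ (con 1 ⊕ w))) refl (bit p) (bit q) (bit r) (bit s) ω) ω²) }
      ; -‿homo  = λ x → linear₁ (φ x) (solve 1 (λ x → x ⊖ ⊝ x ⊜ x ⊗ (con 1 ⊕ con 1 ⊖ con 0)) refl (φ x)) 2≡0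
      ; 0#-homo = solve 1 (λ w → con 0 ⊕ con 0 ⊗ w ⊜ con 0) refl ω
      ; 1#-homo = solve 1 (λ w → con 1 ⊕ con 0 ⊗ w ⊜ con 1) refl ω
      }

    φ-kernel : ∀ x → φ x ≡ 0# → x ≡ (false , false)
    φ-kernel (false , false) _  = refl
    φ-kernel (true  , false) eq = contradiction (trans (sym (Homomorphic.1#-homo φ-homomorphic)) eq) 1≢0
    φ-kernel (false , true)  eq = contradiction (trans (solve 1 (λ w → w ⊜ con 0 ⊕ con 1 ⊗ w) refl ω) eq) ω≢0
    φ-kernel (true  , true)  eq = contradiction (trans (solve 1 (λ w → con 1 ⊕ w ⊜ con 1 ⊕ con 1 ⊗ w) refl ω) eq) 1+ω≢0

    xor-false : ∀ p q → p xor q ≡ false → p ≡ q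
    xor-false false false _ = refl
    xor-false true  true  _ = refl

    φ-injective : ∀ x y → φ x ≡ φ y → x ≡ y
    φ-injective (p , q) (r , s) eq =
      let zero′ = φ-kernel _ (trans (φ-+ (p , q) (r , s)) (trans (cong (_+ φ (r , s)) eq)
            (linear₁ (φ (r , s)) (solve 1 (λ x → x ⊕ x ⊖ con 0 ⊜ x ⊗ (con 1 ⊕ con 1 ⊖ con 0)) refl (φ (r , s))) 2≡0)))
      in cong₂ _,_ (xor-false p r (cong proj₁ zero′)) (xor-false q s (cong proj₂ zero′))

    -- Over 𝔽₄ itself the points can be checked by evaluation.
    0₄ 1₄ ω₄ ω̄₄ : Bool × Bool
    0₄ = false , false
    1₄ = true , false
    ω₄ = false , true
    ω̄₄ = true , true

    𝔽₆₄ : RawRing 0ℓ 0ℓ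
    𝔽₆₄ = cubicRing 𝔽₄ 0₄

    embed₃ : Bool × Bool → Triple (Bool × Bool)
    embed₃ = CubicOperations.embed 𝔽₄ 0₄

    𝔽₄₀₉₆ : RawRing 0ℓ 0ℓ
    𝔽₄₀₉₆ = quadraticRing 𝔽₆₄ (embed₃ ω₄)

    module F = RawRing 𝔽₄₀₉₆

    ς₄ : Triple (Bool × Bool) → Triple (Bool × Bool)
    ς₄ = CubicOperations.ς 𝔽₄ 0₄

    σ₄ : F.Carrier → F.Carrier
    σ₄ (p , q) = QuadraticOperations.conjugate 𝔽₆₄ (embed₃ ω₄) (ς₄ p , ς₄ q)

    open Extension extension₄ using (cyclicSextic; ι; σ; K; ι-homo; σ-ι)
    module K = Field K
    module N₃ = Naturality φ-homomorphic
    φ0 : φ 0₄ ≡ 0#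
    φ0 = Homomorphic.0#-homo φ-homomorphic
    φω : φ ω₄ ≡ ω
    φω = solve 1 (λ w → con 0 ⊕ con 1 ⊗ w ⊜ w) refl ω

    -- The parameters `0₄` and `ω₄` go to 0 and ω by propositional equalities only, whence the
    -- substitution here and in `Φ-homomorphic`.
    map₃-homomorphic : Homomorphic 𝔽₆₄ (cubicRing rawRing 0#) N₃.map₃
    map₃-homomorphic = subst (λ a → Homomorphic 𝔽₆₄ (cubicRing rawRing a) N₃.map₃) φ0 (N₃.map₃-homomorphic 0₄)

    module N₂ = Naturality map₃-homomorphic

    Φ : F.Carrier → K.Carrier
    Φ = N₂.map₂

    Φ-homomorphic : Homomorphic 𝔽₄₀₉₆ K.rawRing Φ
    Φ-homomorphic = record { Homomorphic h }
      where
      h : Homomorphic 𝔽₄₀₉₆ (quadraticRing (cubicRing rawRing 0#) (CubicOperations.embed rawRing 0# ω)) Φ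
      h = subst (λ n → Homomorphic 𝔽₄₀₉₆ (quadraticRing (cubicRing rawRing 0#) n) Φ) (triple-≡ φω φ0 φ0) (N₂.map₂-homomorphic (embed₃ ω₄))

    open Homomorphic Φ-homomorphic

    Φ-σ : ∀ x → Φ (σ₄ x) ≡ σ (Φ x)
    Φ-σ (p , q) = cong₂ _,_
      (trans (Homomorphic.+-homo map₃-homomorphic (ς₄ p) (ς₄ q)) (cong₂ (CubicOperations.add rawRing 0#) (map₃-ς p) (map₃-ς q)))
      (trans (Homomorphic.-‿homo map₃-homomorphic (ς₄ q)) (cong (CubicOperations.neg rawRing 0#) (map₃-ς q)))
      where
      map₃-ς : ∀ x → N₃.map₃ (ς₄ x) ≡ CubicOperations.ς rawRing 0# (N₃.map₃ x)
      map₃-ς x = trans (N₃.map₃-ς 0₄ x) (cong (λ a → CubicOperations.ς rawRing a (N₃.map₃ x)) φ0)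

    Φ-injective : ∀ x y → Φ x ≡ Φ y → x ≡ y
    Φ-injective (p , q) (r , s) eq = cong₂ _,_ (map₃-injective p r (cong proj₁ eq)) (map₃-injective q s (cong proj₂ eq))
      where
      map₃-injective : ∀ x y → N₃.map₃ x ≡ N₃.map₃ y → x ≡ y
      map₃-injective x y eq = triple-≡ (φ-injective _ _ (cong c₀ eq)) (φ-injective _ _ (cong c₁ eq)) (φ-injective _ _ (cong c₂ eq))

    ι₄ : Bool × Bool → F.Carrier
    ι₄ s = embed₃ s , embed₃ 0₄

    Φ-ι : ∀ s → Φ (ι₄ s) ≡ ι (φ s)
    Φ-ι s = cong₂ _,_ (triple-≡ refl φ0 φ0) (triple-≡ φ0 φ0 φ0)

    points : Vec F.Carrier 6
    points =
      (⟨ 0₄ , 0₄ , 1₄ ⟩ , ⟨ ω̄₄ , ω₄ , ω₄ ⟩) ∷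
      (⟨ 0₄ , 1₄ , 0₄ ⟩ , ⟨ ω̄₄ , 0₄ , ω₄ ⟩) ∷
      (⟨ 0₄ , 1₄ , 1₄ ⟩ , ⟨ ω̄₄ , ω₄ , 0₄ ⟩) ∷
      (⟨ 1₄ , 1₄ , ω₄ ⟩ , ⟨ ω₄ , 0₄ , ω̄₄ ⟩) ∷
      (⟨ 1₄ , ω₄ , ω̄₄ ⟩ , ⟨ ω₄ , ω̄₄ , ω̄₄ ⟩) ∷
      (⟨ 1₄ , ω̄₄ , 1₄ ⟩ , ⟨ ω₄ , ω̄₄ , 0₄ ⟩) ∷ []

    weights₄ : Vec (Bool × Bool) 6
    weights₄ = ω̄₄ ∷ 1₄ ∷ ω₄ ∷ ω̄₄ ∷ ω₄ ∷ 1₄ ∷ []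

    points-unique : Unique points
    points-unique =
      ((λ ()) ∷ (λ ()) ∷ (λ ()) ∷ (λ ()) ∷ (λ ()) ∷ []) ∷
      ((λ ()) ∷ (λ ()) ∷ (λ ()) ∷ (λ ()) ∷ []) ∷
      ((λ ()) ∷ (λ ()) ∷ (λ ()) ∷ []) ∷
      ((λ ()) ∷ (λ ()) ∷ []) ∷
      ((λ ()) ∷ []) ∷ [] ∷ []

    points-twist : ∀ i → let x = lookup points i in x F.* σ₄ (σ₄ x) ≡ σ₄ x
    points-twist 0F = refl
    points-twist 1F = refl
    points-twist 2F = refl
    points-twist 3F = refl
    points-twist 4F = refl
    points-twist 5F = refl

    points-≢0 : ∀ i → lookup points i ≢ F.0#
    points-≢0 0F ()
    points-≢0 1F ()
    points-≢0 2F ()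
    points-≢0 3F ()
    points-≢0 4F ()
    points-≢0 5F ()

    Φ-sum : ∀ {n} (f : Fin n → F.Carrier) → FieldProperties.sum K (Φ ∘ f) ≡ Φ (Vector.foldr F._+_ F.0# f)

    Φ-sum {zero}  f = sym 0#-homo
    Φ-sum {suc n} f = trans (cong (Φ (f 0F) K.+_) (Φ-sum (f ∘ suc))) (sym (+-homo (f 0F) (Vector.foldr F._+_ F.0# (f ∘ suc))))

  open Torus cyclicSextic using (T; Relation)

  six-dependent₄ : Coordinates.SixDependent extension₄
  six-dependent₄ = record
    { x           = Φ ∘ lookup points
    ; x-T         = λ i → record
      { nonZero = λ eq → points-≢0 i (Φ-injective _ _ (trans eq (sym 0#-homo)))
      ; twist   = let x = lookup points i in begin
          Φ x K.* σ (σ (Φ x))   ≡⟨ cong (Φ x K.*_) (trans (Φ-σ (σ₄ x)) (cong σ (Φ-σ x))) ⟨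
          Φ x K.* Φ (σ₄ (σ₄ x)) ≡⟨ *-homo x (σ₄ (σ₄ x)) ⟨
          Φ (x F.* σ₄ (σ₄ x))   ≡⟨ cong Φ (points-twist i) ⟩
          Φ (σ₄ x)              ≡⟨ Φ-σ x ⟩
          σ (Φ x)               ∎ }
    ; x-injective = λ {i} {j} eq → lookup-injective points-unique i j (Φ-injective _ _ eq)
    ; a           = φ ∘ lookup weights₄
    ; a-relation  = record
      { fixed    = λ i → σ-ι (φ (lookup weights₄ i))
      ; weights  = begin
          KP.sum (ι ∘ φ ∘ lookup weights₄)    ≡⟨ KP.sum-cong-≗ (λ i → Φ-ι (lookup weights₄ i)) ⟨
          -- In the concrete field the sum evaluates to `F.0#`, here and in `combined`.
          KP.sum (Φ ∘ ι₄ ∘ lookup weights₄)   ≡⟨ Φ-sum (ι₄ ∘ lookup weights₄) ⟩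
          Φ F.0#                              ≡⟨ 0#-homo ⟩
          K.0#                                ∎
      ; combined = begin
          KP.sum (λ i → ι (φ (lookup weights₄ i)) K.* Φ (lookup points i))
            ≡⟨ KP.sum-cong-≗ (λ i → trans (*-homo (ι₄ (lookup weights₄ i)) (lookup points i)) (cong (K._* Φ (lookup points i)) (Φ-ι (lookup weights₄ i)))) ⟨
          KP.sum (λ i → Φ (ι₄ (lookup weights₄ i) F.* lookup points i))
            ≡⟨ Φ-sum (λ i → ι₄ (lookup weights₄ i) F.* lookup points i) ⟩
          Φ F.0#
            ≡⟨ 0#-homo ⟩
          K.0# ∎ }
    ; a-nonzero   = 1F , λ eq → contradiction (φ-injective 1₄ 0₄ (trans eq (sym φ0))) λ ()
    }
    where module KP = FieldProperties K

-- From a finite Heyting field to a field with propositional equality.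

module Transport {c ℓ₁ ℓ₂} (F : HeytingField c ℓ₁ ℓ₂) (r : ℕ) (order : HasOrder F (4 ℕ.+ r)) where

  private
    module F = CommutativeRing (HeytingCommutativeRing.commutativeRing (HeytingField.heytingCommutativeRing F))
    module H = HeytingField F
  open Bijection order public using () renaming (to to fromIndex)
  open Bijection order using (injective; surjective)

  toIndex : F.Carrier → Fin (4 ℕ.+ r)
  toIndex x = proj₁ (surjective x)

  fromIndex-toIndex : ∀ x → fromIndex (toIndex x) F.≈ x
  fromIndex-toIndex x = proj₂ (surjective x) refl

  private
    rawRing : RawRing 0ℓ 0ℓ
    rawRing = record
      { Carrier = Fin (4 ℕ.+ r) ; _≈_ = _≡_
      ; _+_ = λ i j → toIndex (fromIndex i F.+ fromIndex j)
      ; _*_ = λ i j → toIndex (fromIndex i F.* fromIndex j)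
      ; -_ = λ i → toIndex (F.- fromIndex i)
      ; 0# = toIndex F.0# ; 1# = toIndex F.1# }

    isRingMonomorphism : IsRingMonomorphism rawRing F.rawRing fromIndex
    isRingMonomorphism = record
      { isRingHomomorphism = record
        { isSemiringHomomorphism = record
          { isNearSemiringHomomorphism = record
            { +-isMonoidHomomorphism = record
              { isMagmaHomomorphism = record
                { isRelHomomorphism = record { cong = λ { refl → F.refl } }
                ; homo = λ _ _ → fromIndex-toIndex _ }
              ; ε-homo = fromIndex-toIndex _ }
            ; *-homo = λ _ _ → fromIndex-toIndex _ }
          ; 1#-homo = fromIndex-toIndex _ }
        ; -‿homo = λ _ → fromIndex-toIndex _ }
      ; injective = injective }

    module R = RawRing rawRing

    -- The search for an inverse is finite. If it fails, the element is not apart from zero, as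
    -- apartness would yield an inverse, and tightness makes it zero.
    inverse : ∀ i → i ≢ R.0# → ∃ λ j → i R.* j ≡ R.1#
    inverse i i≢0 with Fin.any? (λ j → i R.* j Fin.≟ R.1#)
    ... | yes found = found
    ... | no none   = contradiction (injective (F.trans (proj₁ (H.tight (fromIndex i) F.0#) not-apart) (F.sym (fromIndex-toIndex F.0#)))) i≢0
      where
      not-apart : ¬ (fromIndex i H.# F.0#)
      not-apart i#0 = let y , _ , xy≈1 = H.#⇒invertible i#0 in none (toIndex y , injective
        (F.trans (fromIndex-toIndex _) (F.trans (F.*-cong minus-0 (fromIndex-toIndex y))
          (F.trans xy≈1 (F.sym (fromIndex-toIndex F.1#))))))
        where
        open import Algebra.Properties.Ring F.ring using (-0#≈0#)
        minus-0 : fromIndex i F.≈ fromIndex i F.- F.0#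
        minus-0 = F.sym (F.trans (F.+-congˡ -0#≈0#) (F.+-identityʳ _))

    invert : Fin (4 ℕ.+ r) → Fin (4 ℕ.+ r)
    invert i with i Fin.≟ R.0#
    ... | yes _  = R.0#
    ... | no i≢0 = proj₁ (inverse i i≢0)

    invert-inverse : ∀ {i} → i ≢ R.0# → i R.* invert i ≡ R.1#
    invert-inverse {i} i≢0 with i Fin.≟ R.0#
    ... | yes i≡0 = contradiction i≡0 i≢0
    ... | no i≢0′ = proj₂ (inverse i i≢0′)

    isCommutativeRing = RingMonomorphism.isCommutativeRing isRingMonomorphism F.isCommutativeRing

    trivial : R.1# ≡ R.0# → ∀ i → i ≡ R.0#
    trivial 1≡0 i = trans (sym (proj₂ *-identity i)) (trans (cong (i R.*_) 1≡0) (zeroʳ i))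
      where open IsCommutativeRing isCommutativeRing using (*-identity; zeroʳ)

  -- Carried by `Fin`, so that equality becomes propositional and decidable. A trivial ring is
  -- excluded by its having at least two elements.
  A : Field
  A = record
    { Carrier = Fin (4 ℕ.+ r) ; _+_ = R._+_ ; _*_ = R._*_ ; -_ = R.-_ ; 0# = R.0# ; 1# = R.1#
    ; isCommutativeRing = isCommutativeRing
    ; 1≢0 = λ 1≡0 → contradiction (trans (trivial 1≡0 0F) (sym (trivial 1≡0 1F))) λ ()
    ; _⁻¹ = invert ; *-inverseʳ = invert-inverse ; _≟_ = Fin._≟_ }

  private module A = Field A

  toIndex-≈ : ∀ {x y} → x F.≈ y → toIndex x ≡ toIndex y
  toIndex-≈ x≈y = injective (F.trans (fromIndex-toIndex _) (F.trans x≈y (F.sym (fromIndex-toIndex _))))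

  toIndex-≡ : ∀ {x y} → toIndex x ≡ toIndex y → x F.≈ y
  toIndex-≡ eq = F.trans (F.sym (fromIndex-toIndex _)) (F.trans (F.reflexive (cong fromIndex eq)) (fromIndex-toIndex _))

  toIndex-fromIndex : ∀ i → toIndex (fromIndex i) ≡ i
  toIndex-fromIndex i = injective (fromIndex-toIndex (fromIndex i))

  toIndex-+ : ∀ x y → toIndex (x F.+ y) ≡ toIndex x A.+ toIndex y
  toIndex-+ x y = toIndex-≈ (F.+-cong (F.sym (fromIndex-toIndex x)) (F.sym (fromIndex-toIndex y)))

  toIndex-* : ∀ x y → toIndex (x F.* y) ≡ toIndex x A.* toIndex y
  toIndex-* x y = toIndex-≈ (F.*-cong (F.sym (fromIndex-toIndex x)) (F.sym (fromIndex-toIndex y)))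

  open import Algebra.Definitions.RawMonoid F.+-rawMonoid using (sum)

  toIndex-sum : ∀ {n} (f : Fin n → F.Carrier) → toIndex (sum f) ≡ FieldProperties.sum A (toIndex ∘ f)
  toIndex-sum {zero}  f = refl
  toIndex-sum {suc n} f = trans (toIndex-+ _ _) (cong (toIndex (f zero) A.+_) (toIndex-sum (f ∘ suc)))

-- Pairs of inverse points leave out q = 4, which has its own extension; all larger fields take
-- irreducible polynomials obtained from mere existence.
model : ∀ (A : Field) r → Fin (4 ℕ.+ r) ↔ Field.Carrier A → ∃ λ (E : Extension A) → Coordinates.SixDependent E
model A zero    A↔Fin = FourElements.extension₄ A A↔Fin , FourElements.six-dependent₄ A A↔Fin
model A (suc r) A↔Fin = E , Pairs.six-dependent E r A↔Fin
  where
  E : Extension A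
  E = Construction.extension A _ _
    (proj₂ (FiniteField.irreducible-cubic A A↔Fin)) (proj₂ (FiniteField.irreducible-quadratic A A↔Fin))

-- The set X in projective space, its incidences and its symmetries.

module Geometry {c ℓ₁ ℓ₂} (F : HeytingField c ℓ₁ ℓ₂) (r : ℕ) (order : HasOrder F (4 ℕ.+ r))
  (E : Extension (Transport.A F r order)) (six : Coordinates.SixDependent E) where

  open Transport F r order
  private
    module F = CommutativeRing (HeytingCommutativeRing.commutativeRing (HeytingField.heytingCommutativeRing F))
    module A = Field A
    module AP = FieldProperties A
    A↔Fin : Fin (4 ℕ.+ r) ↔ A.Carrier
    A↔Fin = ↔-id _
  open Extension E hiding (σ²; τ)
  private
    module K = FieldProperties K
    module ι = IsRingHomomorphism ι-homo
  open Torus cyclicSextic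
  open SevenPoints cyclicSextic
  open T
  open Relation
  open Coordinates E
  open SixDependent six
  open Parametrisation E using (ι-sum)
  open Parametrisation.Enumeration E A↔Fin
  open Fourier E A↔Fin (s≤s (s≤s (s≤s z≤n))) using (coefficient; fourier-weights; fourier-combined)
  open PG F 6
  open Point
  open Subspace

  private
    Space : Set c
    Space = Vector.Vector F.Carrier 7

    indices : Space → Fin 7 → A.Carrier
    indices u k = toIndex (u k)

  vectorOf : Carrier → Space
  vectorOf x k = fromIndex (homogeneous x k)

  point : Carrier → Point
  point x = record
    { vector  = vectorOf x
    ; nonZero = λ eq → A.1≢0 (trans (sym (toIndex-fromIndex A.1#)) (toIndex-≈ (eq zero))) }

  indices-vectorOf : ∀ x k → indices (vectorOf x) k ≡ homogeneous x k
  indices-vectorOf x k = toIndex-fromIndex (homogeneous x k)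

  infix 4 _Lifts_
  -- P is the affine point (1 , x). The scale is the first coordinate of the chosen vector, so that
  -- P determines x.
  record _Lifts_ (P : Point) (x : Carrier) : Set where
    field
      scale      : A.Carrier
      scale-≢0   : scale ≢ A.0#
      scaled     : ∀ k → indices (vector P) k ≡ scale A.* homogeneous x k

  open _Lifts_

  X : Pred Point (c ⊔ ℓ₁)
  X P = Lift (c ⊔ ℓ₁) (∃ λ x → T x × P Lifts x)

  point-lifts : ∀ x → point x Lifts x
  point-lifts x = record { scale = A.1# ; scale-≢0 = A.1≢0
    ; scaled = λ k → trans (indices-vectorOf x k) (sym (A.*-identityˡ _)) }

  point-X : ∀ {x} → T x → X (point x)
  point-X {x} tx = lift (x , tx , point-lifts x)

  private
    fromIndex-≢0 : ∀ {i} → i ≢ A.0# → ¬ (fromIndex i F.≈ F.0#)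
    fromIndex-≢0 i≢0 eq = i≢0 (trans (sym (toIndex-fromIndex _)) (toIndex-≈ eq))

    ∼-scalar : ∀ {P Q} → P ∼ Q → ∃ λ s → s ≢ A.0# × (∀ k → indices (vector P) k ≡ s A.* indices (vector Q) k)
    ∼-scalar (a , a≢0 , eq) = toIndex a , (λ ≡0 → a≢0 (toIndex-≡ ≡0)) , λ k → trans (toIndex-≈ (eq k)) (toIndex-* a _)

    scalar-∼ : ∀ {P Q} s → s ≢ A.0# → (∀ k → indices (vector P) k ≡ s A.* indices (vector Q) k) → P ∼ Q
    scalar-∼ s s≢0 eq = fromIndex s , fromIndex-≢0 s≢0 , λ k →
      toIndex-≡ (trans (eq k) (trans (cong (A._* _) (sym (toIndex-fromIndex s))) (sym (toIndex-* _ _))))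

    cancel : ∀ {s u} → s ≢ A.0# → s A.⁻¹ A.* (s A.* u) ≡ u
    cancel {s} {u} s≢0 = trans (sym (A.*-assoc _ _ u)) (trans (cong (A._* u) (trans (A.*-comm _ s) (A.*-inverseʳ s≢0))) (A.*-identityˡ u))

  lifts-∼ : ∀ {P Q x} → P Lifts x → Q Lifts x → P ∼ Q
  lifts-∼ {P} {Q} {x} p q = scalar-∼ {P} {Q} (scale p A.* scale q A.⁻¹) (AP.*-≢0 (scale-≢0 p) (AP.⁻¹-≢0 (scale-≢0 q))) λ k → begin
    indices (vector P) k
      ≡⟨ scaled p k ⟩
    scale p A.* homogeneous x k
      ≡⟨ cong (scale p A.*_) (cancel (scale-≢0 q)) ⟨
    scale p A.* (scale q A.⁻¹ A.* (scale q A.* homogeneous x k))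
      ≡⟨ A.*-assoc _ _ _ ⟨
    scale p A.* scale q A.⁻¹ A.* (scale q A.* homogeneous x k)
      ≡⟨ cong (scale p A.* scale q A.⁻¹ A.*_) (scaled q k) ⟨
    scale p A.* scale q A.⁻¹ A.* indices (vector Q) k ∎

  ∼-lifts : ∀ {P Q x} → P ∼ Q → P Lifts x → Q Lifts x
  ∼-lifts {P} {Q} {x} P∼Q p = let s , s≢0 , eq = ∼-scalar {P} {Q} P∼Q in record
    { scale    = s A.⁻¹ A.* scale p
    ; scale-≢0 = AP.*-≢0 (AP.⁻¹-≢0 s≢0) (scale-≢0 p)
    ; scaled   = λ k → begin
        indices (vector Q) k                              ≡⟨ cancel s≢0 ⟨
        s A.⁻¹ A.* (s A.* indices (vector Q) k)           ≡⟨ cong (s A.⁻¹ A.*_) (trans (sym (eq k)) (scaled p k)) ⟩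
        s A.⁻¹ A.* (scale p A.* homogeneous x k)          ≡⟨ A.*-assoc _ _ _ ⟨
        s A.⁻¹ A.* scale p A.* homogeneous x k            ∎ }

  lifts-unique : ∀ {P x y} → P Lifts x → P Lifts y → x ≡ y
  lifts-unique {P} {x} {y} p q = coordinate-injective x y λ k → AP.*-cancelˡ (scale-≢0 p) (begin
    scale p A.* coordinate x k   ≡⟨ scaled p (suc k) ⟨
    indices (vector P) (suc k)   ≡⟨ scaled q (suc k) ⟩
    scale q A.* coordinate y k   ≡⟨ cong (A._* coordinate y k) scales ⟨
    scale p A.* coordinate y k   ∎)
    where
    scales : scale p ≡ scale q
    scales = trans (sym (A.*-identityʳ _)) (trans (sym (scaled p zero)) (trans (scaled q zero) (A.*-identityʳ _)))

  point-injective : ∀ {x y} → point x ∼ point y → x ≡ y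
  point-injective {x} {y} eq = lifts-unique {point y} (∼-lifts {point x} {point y} eq (point-lifts x)) (point-lifts y)

  X-respects : X Respects _∼_
  X-respects {P} {Q} P∼Q (lift (x , tx , p)) = lift (x , tx , ∼-lifts {P} {Q} P∼Q p)

  X-affine : ∀ {P} → X P → AG P
  X-affine {P} (lift (x , tx , p)) P∈H∞ = scale-≢0 p (trans (sym (A.*-identityʳ _)) (trans (sym (scaled p zero)) (toIndex-≈ P∈H∞)))

  X-order : HasExactly size X
  X-order = point ∘ torus , ((λ eq → torus-injective (point-injective eq)) , λ i → point-X (torus-T i)) ,
    λ P (lift (x , tx , p)) → let i , torus-i = torus-surjective tx in
      i , lifts-∼ {P} {point (torus i)} p (subst (point (torus i) Lifts_) torus-i (point-lifts (torus i)))

  private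
    ∈-indices : ∀ {m} {u : Space} {v : Fin m → Space} → u ∈⟨ v ⟩ →
      ∃ λ (a : Fin m → A.Carrier) → ∀ k → indices u k ≡ AP.sum (λ j → a j A.* indices (v j) k)
    ∈-indices {v = v} (a , eq) = toIndex ∘ a , λ k → trans (toIndex-≈ (eq k))
      (trans (toIndex-sum (λ j → a j F.* v j k)) (AP.sum-cong-≗ λ j → toIndex-* (a j) (v j k)))

    indices-∈ : ∀ {m} {u : Space} {v : Fin m → Space} (a : Fin m → A.Carrier) →
      (∀ k → indices u k ≡ AP.sum (λ j → a j A.* indices (v j) k)) → u ∈⟨ v ⟩
    indices-∈ {v = v} a eq = fromIndex ∘ a , λ k → toIndex-≡ (trans (eq k)
      (trans (AP.sum-cong-≗ λ j → trans (cong (A._* indices (v j) k) (sym (toIndex-fromIndex (a j)))) (sym (toIndex-* (fromIndex (a j)) (v j k)))) (sym (toIndex-sum (λ j → fromIndex (a j) F.* v j k)))))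

    points-∈ : ∀ {m u} {p : Fin m → Carrier} → InSpan u p → vectorOf u ∈⟨ vectorOf ∘ p ⟩
    points-∈ {u = u} {p} (a , eq) = indices-∈ {v = vectorOf ∘ p} a λ k →
      trans (indices-vectorOf u k) (trans (eq k) (AP.sum-cong-≗ λ j → cong (a j A.*_) (sym (indices-vectorOf (p j) k))))

    points-independent : ∀ {m} {p : Fin m → Carrier} → Independent p → LinearlyIndependent (vectorOf ∘ p)
    points-independent {p = p} independent a eq j = toIndex-≡ (independent (toIndex ∘ a) (relation λ k → begin
      AP.sum (λ j → toIndex (a j) A.* homogeneous (p j) k)
        ≡⟨ AP.sum-cong-≗ (λ j → trans (cong (toIndex (a j) A.*_) (sym (indices-vectorOf (p j) k))) (sym (toIndex-* _ _))) ⟩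
      AP.sum (λ j → toIndex (a j F.* vectorOf (p j) k))
        ≡⟨ toIndex-sum (λ j → a j F.* vectorOf (p j) k) ⟨
      toIndex (linearCombination a (vectorOf ∘ p) k)
        ≡⟨ toIndex-≈ (eq k) ⟩
      A.0# ∎) j)

    -- The points outnumber the basis, so their coefficient vectors with respect to it are
    -- dependent. The scales of the representatives, all nonzero, are absorbed into the weights.
    dependent : ∀ {m s} (S : Subspace s) (P : Fin m → Point) (x : Fin m → Carrier) → (∀ i → P i Lifts x i) →
      (∀ i → points S (P i)) → suc s < m → ∃ λ (a : Fin m → A.Carrier) → Relation (ι ∘ a) x × ∃ λ i → a i ≢ A.0#
    dependent {m} {s} S P x p P∈S s<m = (λ i → d i A.* scale (p i)) , relation combination ,
      proj₁ (proj₁ (proj₂ dep)) , AP.*-≢0 (proj₂ (proj₁ (proj₂ dep))) (scale-≢0 (p _))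
      where
      M : Fin m → Fin (suc s) → A.Carrier
      M i = proj₁ (∈-indices {v = basis S} (P∈S i))

      dep = AP.linearlyDependent s<m M
      d = proj₁ dep

      combination : ∀ k → AP.sum (λ i → d i A.* scale (p i) A.* homogeneous (x i) k) ≡ A.0#
      combination k = begin
        AP.sum (λ i → d i A.* scale (p i) A.* homogeneous (x i) k)
          ≡⟨ AP.sum-cong-≗ (λ i → trans (A.*-assoc _ _ _) (cong (d i A.*_) (trans (sym (scaled (p i) k)) (proj₂ (∈-indices {v = basis S} (P∈S i)) k)))) ⟩
        AP.sum (λ i → d i A.* AP.sum (λ l → M i l A.* indices (basis S l) k))
          ≡⟨ AP.sum-cong-≗ (λ i → trans (AP.*-distribˡ-sum (d i) (λ l → M i l A.* indices (basis S l) k))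
               (AP.sum-cong-≗ (λ l → sym (A.*-assoc (d i) (M i l) (indices (basis S l) k))))) ⟩
        AP.sum (λ i → AP.sum (λ l → d i A.* M i l A.* indices (basis S l) k))
          ≡⟨ AP.∑-comm (λ i l → d i A.* M i l A.* indices (basis S l) k) ⟩
        AP.sum (λ l → AP.sum (λ i → d i A.* M i l A.* indices (basis S l) k))
          ≡⟨ AP.sum-cong-≗ (λ l → sym (AP.*-distribʳ-sum (indices (basis S l) k) (λ i → d i A.* M i l))) ⟩
        AP.sum (λ l → AP.sum (λ i → d i A.* M i l) A.* indices (basis S l) k)
          ≡⟨ AP.sum-zero _ (λ l → trans (cong (A._* indices (basis S l) k) (proj₂ (proj₂ dep) l)) (A.zeroˡ (indices (basis S l) k))) ⟩
        A.0# ∎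

    module Enumerated {m s} {S : Subspace s} {f : Fin m → Point} (e : Enumerates (X ∩points S) f) where

      coordinates : Fin m → Carrier
      coordinates i = proj₁ (lower (proj₁ (proj₂ e i)))

      coordinates-T : ∀ i → T (coordinates i)
      coordinates-T i = proj₁ (proj₂ (lower (proj₁ (proj₂ e i))))

      coordinates-lifts : ∀ i → f i Lifts coordinates i
      coordinates-lifts i = proj₂ (proj₂ (lower (proj₁ (proj₂ e i))))

      coordinates-injective : Injective _≡_ _≡_ coordinates
      coordinates-injective {i} {j} eq = proj₁ e (lifts-∼ {f i} {f j} (coordinates-lifts i) (subst (f j Lifts_) (sym eq) (coordinates-lifts j)))

    restrict : ∀ {m k s} {S : Subspace s} {f : Fin m → Point} (k≤m : k ≤ m) → Enumerates (X ∩points S) f →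
      Enumerates (X ∩points S) (f ∘ λ i → inject≤ i k≤m)
    restrict k≤m (f-inj , mem) = (λ {i} {j} eq → Fin.inject≤-injective k≤m k≤m i j (f-inj eq)) , λ i → mem (inject≤ i k≤m)

    at-most : ∀ {b s} {S : Subspace s} → (∀ f → ¬ Enumerates {m = suc b} (X ∩points S) f) → HasAtMost b (X ∩points S)
    at-most {b} {S = S} impossible m (f , enumerated) = decidable-stable (m ℕ.≤? b) λ m≰b →
      impossible _ (restrict {S = S} (ℕ.≰⇒> m≰b) enumerated)

  -- Over F, the vector space is the sum of F and K. Fourier inversion gives weights on T whose sum
  -- is the component in F and whose weighted sum of points is the component in K.
  spanning : Spanning X
  spanning Q = size , point ∘ torus , (λ i → point-X (torus-T i)) , indices-∈ {v = vectorOf ∘ torus} weight combination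
    where
    height : A.Carrier
    height = indices (vector Q) zero

    affine : Carrier
    affine = element (indices (vector Q) ∘ suc)

    weight : Fin size → A.Carrier
    weight = coefficient height affine

    combination : ∀ k → indices (vector Q) k ≡ AP.sum (λ i → weight i A.* indices (vectorOf (torus i)) k)
    combination zero = begin
      height
        ≡⟨ AP.x-y≈0⇒x≈y _ _ (ι-≡0 (trans (ι.+-homo height _) (trans (cong (ι height +_) (ι.-‿homo _)) (trans (cong (λ s → ι height - s) (trans (ι-sum weight) (fourier-weights height affine))) (K.x≈y⇒x-y≈0 refl))))) ⟩
      AP.sum weight
        ≡⟨ AP.sum-cong-≗ (λ i → trans (cong (weight i A.*_) (indices-vectorOf (torus i) zero)) (A.*-identityʳ (weight i))) ⟨
      AP.sum (λ i → weight i A.* indices (vectorOf (torus i)) zero) ∎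
    combination (suc k) = begin
      indices (vector Q) (suc k)
        ≡⟨ coordinate-element (indices (vector Q) ∘ suc) k ⟨
      coordinate affine k
        ≡⟨ cong (λ y → coordinate y k) (fourier-combined height affine) ⟨
      coordinate (K.sum (λ i → ι (weight i) * torus i)) k
        ≡⟨ coordinate-sum weight torus k ⟩
      AP.sum (λ i → weight i A.* coordinate (torus i) k)
        ≡⟨ AP.sum-cong-≗ (λ i → cong (weight i A.*_) (indices-vectorOf (torus i) (suc k))) ⟨
      AP.sum (λ i → weight i A.* indices (vectorOf (torus i)) (suc k)) ∎

  private
    attained-by : ∀ {s m} (p : Fin (suc s) → Carrier) (independent : Independent p)
      (x : Fin m → Carrier) → (∀ i → T (x i)) → Injective _≡_ _≡_ x → (∀ i → InSpan (x i) p) →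
      ∃ λ (S : Subspace s) → HasAtLeast m (X ∩points S)
    attained-by p independent x tx x-inj inSpan =
      record { basis = vectorOf ∘ p ; independent = points-independent independent } ,
      point ∘ x , (λ eq → x-inj (point-injective eq)) , λ i → point-X (tx i) , points-∈ {p = p} (inSpan i)

  isGeneralSet : IsGeneralSet 5 X
  isGeneralSet = record
    { atMost   = λ S → at-most {S = S} λ f enumerated →
        let open Enumerated {S = S} enumerated
            a , rel , i , ai≢0 = dependent S f coordinates coordinates-lifts (λ i → proj₂ (proj₂ enumerated i)) ℕ.≤-refl
        in ai≢0 (five-points coordinates-T coordinates-injective a rel i)
    ; spanning = spanning
    ; attained = attained-by (x ∘ suc) (five-points (x-T ∘ suc) (Fin.suc-injective ∘ x-injective)) x x-T x-injective five-inSpan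
    }

  -- Among seven points of a subspace of vector space dimension five, any six
  -- are dependent.
  isRSSet : IsRSSet 6 4 X
  isRSSet = record
    { atMost   = λ S → at-most {S = S} λ f enumerated →
        let open Enumerated {S = S} enumerated
            y = coordinates
            -- The two dependencies leave out the points 0 and 1, respectively. The first gives six
            -- dependent points, and the second contradicts the independence of the remaining point
            -- and five of these.
            a , rel , nz = dependent S (λ i → f (suc i)) (λ i → y (suc i)) (λ i → coordinates-lifts (suc i)) (λ i → proj₂ (proj₂ enumerated (suc i))) ℕ.≤-refl
            b , rel′ , i , bi≢0 = dependent S (λ i → f (Fin.punchIn 1F i)) (λ i → y (Fin.punchIn 1F i)) (λ i → coordinates-lifts (Fin.punchIn 1F i))
              (λ i → proj₂ (proj₂ enumerated (Fin.punchIn 1F i))) ℕ.≤-refl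
            other = record
              { x = λ i → y (suc i) ; x-T = λ i → coordinates-T (suc i) ; x-injective = λ eq → Fin.suc-injective (coordinates-injective eq)
              ; a = a ; a-relation = rel ; a-nonzero = nz }
            -- The two listings of the points agree at each index; in a rebuilt record this is
            -- checked on the expanded sum.
            permuted = record { fixed = fixed rel′ ; weights = weights rel′ ; combined = combined rel′ }
        in bi≢0 (SixDependent.sixth-independent other (coordinates-T zero)
             (λ j eq → contradiction (coordinates-injective {zero} {suc j} eq) λ ()) b permuted i)
    ; spanning = spanning
    ; attained = attained-by basis₆ basis-independent (EightPoints.points eight) points-T points-injective points-inSpan
    }
    where
    eight = Hyperplane.eight-points E r A↔Fin six
    open EightPoints eight renaming (basis to basis₆)

  private
    -- Multiplication by g on the component K of the space, with the component F left alone; hence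
    -- the hyperplane at infinity is preserved.
    act : Carrier → (Fin 7 → A.Carrier) → Fin 7 → A.Carrier
    act g u zero    = u zero
    act g u (suc k) = coordinate (g * element (λ j → u (suc j))) k

    element-unique : ∀ {f y} → (∀ k → f k ≡ coordinate y k) → element f ≡ y
    element-unique {f} {y} eq = coordinate-injective (element f) y λ k → trans (coordinate-element f k) (eq k)

    act-unique : ∀ {g f y} → (∀ k → f k ≡ coordinate y k) → ∀ k → coordinate (g * element f) k ≡ coordinate (g * y) k
    act-unique {g} eq k = cong (λ y → coordinate (g * y) k) (element-unique eq)

    act-cong : ∀ {g u v} → (∀ k → u k ≡ v k) → ∀ k → act g u k ≡ act g v k
    act-cong eq zero    = eq zero
    act-cong {v = v} eq (suc k) = act-unique (λ j → trans (eq (suc j)) (sym (coordinate-element (λ j → v (suc j)) j))) k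

    act-+ : ∀ {g} u v k → act g (λ j → u j A.+ v j) k ≡ act g u k A.+ act g v k
    act-+ u v zero = refl
    act-+ {g} u v (suc k) = trans
      (act-unique {y = element u′ + element v′} (λ j → sym (trans (coordinate-+ _ _ j) (cong₂ A._+_ (coordinate-element u′ j) (coordinate-element v′ j)))) k)
      (trans (cong (λ y → coordinate y k) (distribˡ g _ _)) (coordinate-+ _ _ k))
      where
      u′ v′ : Fin 6 → A.Carrier
      u′ j = u (suc j)
      v′ j = v (suc j)

    act-* : ∀ {g} s u k → act g (λ j → s A.* u j) k ≡ s A.* act g u k
    act-* s u zero = refl
    act-* {g} s u (suc k) = trans
      (act-unique {y = ι s * element u′} (λ j → sym (trans (coordinate-* s _ j) (cong (s A.*_) (coordinate-element u′ j)))) k)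
      (trans (cong (λ y → coordinate y k) (K.solve 3 (λ g s y → g ⊗ (s ⊗ y) ⊜ s ⊗ (g ⊗ y)) refl g (ι s) (element u′))) (coordinate-* s _ k))
      where
      u′ : Fin 6 → A.Carrier
      u′ j = u (suc j)

    act-homogeneous : ∀ {g} x k → act g (homogeneous x) k ≡ homogeneous (g * x) k
    act-homogeneous x zero    = refl
    act-homogeneous x (suc k) = act-unique (λ _ → refl) k

    act-inverse : ∀ {g h} → h * g ≡ 1# → ∀ u k → act h (act g u) k ≡ u k
    act-inverse hg≡1 u zero = refl
    act-inverse {g} {h} hg≡1 u (suc k) = begin
      act h (act g u) (suc k)            ≡⟨ act-unique (λ _ → refl) k ⟩
      coordinate (h * (g * element u′)) k  ≡⟨ cong (λ y → coordinate y k) (trans (sym (*-assoc h g _)) (trans (cong (_* element u′) hg≡1) (*-identityˡ _))) ⟩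
      coordinate (element u′) k            ≡⟨ coordinate-element u′ k ⟩
      u (suc k)                          ∎
      where
      u′ : Fin 6 → A.Carrier
      u′ j = u (suc j)

    transform : Carrier → Space → Space
    transform g u k = fromIndex (act g (indices u) k)

    indices-transform : ∀ g u k → indices (transform g u) k ≡ act g (indices u) k
    indices-transform g u k = toIndex-fromIndex _

    transform-cong : ∀ g {u v : Space} → (∀ k → u k F.≈ v k) → ∀ k → transform g u k F.≈ transform g v k
    transform-cong g eq k = F.reflexive (cong fromIndex (act-cong (λ j → toIndex-≈ (eq j)) k))

    transform-* : ∀ g s (u : Space) k → transform g (λ j → s F.* u j) k F.≈ s F.* transform g u k
    transform-* g s u k = toIndex-≡ (begin
      indices (transform g (λ j → s F.* u j)) k   ≡⟨ indices-transform g _ k ⟩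
      act g (λ j → toIndex (s F.* u j)) k         ≡⟨ act-cong (λ j → toIndex-* s (u j)) k ⟩
      act g (λ j → toIndex s A.* indices u j) k   ≡⟨ act-* (toIndex s) (indices u) k ⟩
      toIndex s A.* act g (indices u) k           ≡⟨ cong (toIndex s A.*_) (indices-transform g u k) ⟨
      toIndex s A.* indices (transform g u) k     ≡⟨ toIndex-* s _ ⟨
      toIndex (s F.* transform g u k)             ∎)

    transform-+ : ∀ g (u v : Space) k → transform g (λ j → u j F.+ v j) k F.≈ transform g u k F.+ transform g v k
    transform-+ g u v k = toIndex-≡ (begin
      indices (transform g (λ j → u j F.+ v j)) k                   ≡⟨ indices-transform g _ k ⟩
      act g (λ j → toIndex (u j F.+ v j)) k                         ≡⟨ act-cong (λ j → toIndex-+ (u j) (v j)) k ⟩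
      act g (λ j → indices u j A.+ indices v j) k                   ≡⟨ act-+ (indices u) (indices v) k ⟩
      act g (indices u) k A.+ act g (indices v) k                   ≡⟨ cong₂ A._+_ (indices-transform g u k) (indices-transform g v k) ⟨
      indices (transform g u) k A.+ indices (transform g v) k       ≡⟨ toIndex-+ _ _ ⟨
      toIndex (transform g u k F.+ transform g v k)                 ∎)

    transform-inverse : ∀ {g h} → h * g ≡ 1# → ∀ u k → transform h (transform g u) k F.≈ u k
    transform-inverse {g} {h} hg≡1 u k = toIndex-≡ (begin
      indices (transform h (transform g u)) k   ≡⟨ indices-transform h _ k ⟩
      act h (indices (transform g u)) k         ≡⟨ act-cong (indices-transform g u) k ⟩
      act h (act g (indices u)) k               ≡⟨ act-inverse hg≡1 (indices u) k ⟩
      indices u k                               ∎)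

  module _ {g h : Carrier} (gh≡1 : g * h ≡ 1#) where

    private
      hg≡1 : h * g ≡ 1#
      hg≡1 = trans (*-comm h g) gh≡1

      open import Algebra.Properties.Ring F.ring using (-1*x≈-x)

    translation : Projectivity
    translation = record
      { ⟦_⟧ = transform g
      ; isIsomorphism = record
        { isLeftModuleMonomorphism = record
          { isLeftModuleHomomorphism = record
            { +ᴹ-isGroupHomomorphism = record
              { isMonoidHomomorphism = record
                { isMagmaHomomorphism = record
                  { isRelHomomorphism = record { cong = λ {u} {v} → transform-cong g {u} {v} }
                  ; homo = transform-+ g }
                ; ε-homo = λ k → F.trans (transform-cong g (λ _ → F.sym (F.zeroˡ F.0#)) k)
                    (F.trans (transform-* g F.0# (λ _ → F.0#) k) (F.zeroˡ _)) }
              ; ⁻¹-homo = λ u k → F.trans (transform-cong g (λ j → F.sym (-1*x≈-x (u j))) k)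
                  (F.trans (transform-* g (F.- F.1#) u k) (-1*x≈-x _)) }
            ; *ₗ-homo = transform-* g }
          ; injective = λ {u} {v} eq k → F.trans (F.sym (transform-inverse hg≡1 u k))
              (F.trans (transform-cong h eq k) (transform-inverse hg≡1 v k)) }
        ; surjective = λ u → transform h u , λ {v} eq k →
            F.trans (transform-cong g {v} {transform h u} eq k) (transform-inverse gh≡1 u k) } }

    open Projectivity using (_·_)

    translation-lifts : ∀ {P x} → P Lifts x → (translation · P) Lifts (g * x)
    translation-lifts {P} {x} p = record { scale = scale p ; scale-≢0 = scale-≢0 p ; scaled = λ k → begin
      indices (transform g (vector P)) k                ≡⟨ indices-transform g (vector P) k ⟩
      act g (indices (vector P)) k                      ≡⟨ act-cong (scaled p) k ⟩
      act g (λ j → scale p A.* homogeneous x j) k       ≡⟨ act-* (scale p) (homogeneous x) k ⟩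
      scale p A.* act g (homogeneous x) k               ≡⟨ cong (scale p A.*_) (act-homogeneous x k) ⟩
      scale p A.* homogeneous (g * x) k                 ∎ }

    translation-lifts⁻¹ : ∀ {P y} → (translation · P) Lifts y → P Lifts (h * y)
    translation-lifts⁻¹ {P} {y} q = record { scale = scale q ; scale-≢0 = scale-≢0 q ; scaled = λ k → begin
      indices (vector P) k                              ≡⟨ act-inverse hg≡1 (indices (vector P)) k ⟨
      act h (act g (indices (vector P))) k              ≡⟨ act-cong (λ j → trans (sym (indices-transform g (vector P) j)) (scaled q j)) k ⟩
      act h (λ j → scale q A.* homogeneous y j) k       ≡⟨ act-* (scale q) (homogeneous y) k ⟩
      scale q A.* act h (homogeneous y) k               ≡⟨ cong (scale q A.*_) (act-homogeneous y k) ⟩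
      scale q A.* homogeneous (h * y) k                 ∎ }

    translation-stabilizes-X : T g → T h → Stabilizes translation X
    translation-stabilizes-X tg th P = mk⇔
      (λ (lift (x , tx , p)) → lift (g * x , T-* tg tx , translation-lifts {P} p))
      (λ (lift (y , ty , q)) → lift (h * y , T-* th ty , translation-lifts⁻¹ {P} q))

    translation-stabilizes-H∞ : Stabilizes translation H∞
    translation-stabilizes-H∞ P = mk⇔ (F.trans (fromIndex-toIndex _)) (F.trans (F.sym (fromIndex-toIndex _)))

  isTransitive : IsTransitive X
  isTransitive P Q (lift (x , tx , p)) (lift (y , ty , q)) =
    translation gh≡1 ,
    translation-stabilizes-X gh≡1 (T-* ty (T-τ tx)) (T-* tx (T-τ ty)) ,
    translation-stabilizes-H∞ gh≡1 ,
    lifts-∼ {translation gh≡1 · P} {Q} (subst ((translation gh≡1 · P) Lifts_) gx≡y (translation-lifts gh≡1 {P} p)) q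
    where
    open Projectivity using (_·_)

    -- As τ inverts T, the factors are y / x, which moves x to y, and its inverse x / y.
    gh≡1 : y * τ x * (x * τ y) ≡ 1#
    gh≡1 = K.linear₂ (x * τ x) 1# (K.solve 4 (λ x X y Y → y ⊗ X ⊗ (x ⊗ Y) ⊖ con 1 ⊜
      x ⊗ X ⊗ (y ⊗ Y ⊖ con 1) ⊕ con 1 ⊗ (x ⊗ X ⊖ con 1)) refl x (τ x) y (τ y)) (τ-inverse ty) (τ-inverse tx)

    gx≡y : y * τ x * x ≡ y
    gx≡y = K.linear₁ y (K.solve 3 (λ x X y → y ⊗ X ⊗ x ⊖ y ⊜ y ⊗ (x ⊗ X ⊖ con 1)) refl x (τ x) y) (τ-inverse tx)

open import Data.Nat.Base using (_+_)

mainTheorem13 : ∀ {c ℓ₁ ℓ₂} (q : ℕ) → IsPrimePower q → 4 ≤ q →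
    (F : HeytingField c ℓ₁ ℓ₂) → HasOrder F q →
    let open PG F 6 in
    ∃ λ (X : Pred Point (c ⊔ ℓ₁)) →
    X Respects _∼_ ×
    HasExactly (q ^ 2 ∸ q + 1) X ×
    IsAffineGeneralSet 5 X ×
    IsAffineRSSet 6 4 X ×
    IsTransitive X
mainTheorem13 q _ 4≤q F order with r , refl ← ℕ.m≤n⇒∃[o]m+o≡n 4≤q =
  X , X-respects , subst (λ n → PG.HasExactly F 6 n X) size≡ X-order ,
  (X-affine , isGeneralSet) , (X-affine , isRSSet) , isTransitive
  where
  open Geometry F r order (proj₁ (model _ r (↔-id _))) (proj₂ (model _ r (↔-id _)))
  size≡ : suc ((3 ℕ.+ r) ℕ.* (4 ℕ.+ r)) ≡ (4 ℕ.+ r) ^ 2 ∸ (4 ℕ.+ r) ℕ.+ 1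
  size≡ = sym (trans (ℕ.+-comm _ 1) (cong suc (trans
    (cong (λ n → (4 ℕ.+ r) ℕ.* n ∸ (4 ℕ.+ r)) (ℕ.*-identityʳ (4 ℕ.+ r)))
    (ℕ.m+n∸m≡n (4 ℕ.+ r) ((3 ℕ.+ r) ℕ.* (4 ℕ.+ r))))))
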